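{- For all compositions $\eta,\gamma\in\mathbb{N}^n$, the coefficient $b_{\eta,\gamma}(\alpha)$ defined by the expansion $F_\eta^{r\delta}=\sum_\gamma\alpha^{|\gamma|-|\eta|}\,b_{\eta,\gamma}(\alpha)\,x^\gamma$ is a polynomial in $\mathbb{N}[\alpha]$.
   Context: Fix $n\ge1$. Let $r$ be an indeterminate, $\alpha=1/r$, and work in $\mathbb{Q}(r)[x_1,\dots,x_n]$. A composition is $\eta\in\mathbb{N}^n$ ($\mathbb{N}$ includes $0$), $|\eta|=\sum\eta_i$, $x^\eta=\prod x_i^{\eta_i}$; a partition is a weakly decreasing composition. Let $\delta=(n-1,\dots,1,0)$. Permutations $w\in S_n$ act on vectors by $(wv)_{w(i)}=v_i$. For a composition $\gamma$ let $w_\gamma$ be the permutation of minimal length such that $\gamma^+=w_\gamma^{ -1}(\gamma)$ is a partition, and set $\overline{\gamma}=\gamma+w_\gamma(r\delta)$. It is known that for each composition $\eta$ there is a unique polynomial $E_\eta^{r\delta}$ of total degree $|\eta|$ with $E_\eta^{r\delta}(\overline\gamma)=0$ for all compositions $\gamma\ne\eta$ with $|\gamma|\le|\eta|$, and with coefficient of $x^\eta$ equal to $1$. For a box $(i,j)$ of $\eta$ (i.e. $1\le j\le \eta_i$) let $a_\eta(i,j)=\eta_i-j$ and $l_\eta(i,j)=\#\{k>i: j\le\eta_k\le\eta_i\}+\#\{k<i: j\le\eta_k+1\le\eta_i\}$, and $d_\eta(\alpha)=\prod_s(\alpha(a_\eta(s)+1)+l_\eta(s)+1)$ over all boxes $s$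 of $\eta$. Define $F_\eta^{r\delta}(x)=(-1)^{|\eta|}d_\eta(\alpha)E_\eta^{r\delta}(-x)$ and define $b_{\eta,\gamma}(\alpha)\in\mathbb{Q}(\alpha)$ by $F_\eta^{r\delta}=\sum_\gamma\alpha^{|\gamma|-|\eta|}b_{\eta,\gamma}(\alpha)x^\gamma$. -}

module Defs where

open import Data.Nat as ℕ using (ℕ; zero; suc; _∸_)
open import Data.Bool using (Bool; true; false; _∧_; if_then_else_)
open import Data.Rational as ℚ using (ℚ; 0ℚ; 1ℚ)
open import Data.List as L using (List; []; _∷_; map; concatMap; upTo; foldr)
open import Data.List.Relation.Unary.All using (All)
open import Data.Vec as V using (Vec)
open import Data.Fin as F using (Fin; toℕ)
open import Relation.Binary.PropositionalEquality using (_≡_)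
open import Relation.Nullary using (¬_)
open import Data.Product using (_×_; _,_; proj₁; proj₂)
open import Data.Bool.Properties renaming (_≟_ to _≟B_) using ()

-- Univariate polynomials over ℚ in the indeterminate r
-- (coefficient lists, lowest degree first).

Pol : Set
Pol = List ℚ

_⊕_ : Pol → Pol → Pol
[] ⊕ q = q
(a ∷ p) ⊕ [] = a ∷ p
(a ∷ p) ⊕ (b ∷ q) = (a ℚ.+ b) ∷ (p ⊕ q)

scale : ℚ → Pol → Pol
scale a = map (a ℚ.*_)

_⊛_ : Pol → Pol → Pol
[] ⊛ q = []
(a ∷ p) ⊛ q = scale a q ⊕ (0ℚ ∷ (p ⊛ q))

negP : Pol → Pol
negP = scale (ℚ.- 1ℚ)

IsZeroPol : Pol → Set
IsZeroPol p = All (_≡ 0ℚ) p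

-- The field ℚ(r) of rational functions, as fractions num/den.
-- Elements are meaningful when den is not the zero polynomial.

record QR : Set where
  constructor _//_
  field
    num : Pol
    den : Pol
open QR public

NonZeroDen : QR → Set
NonZeroDen x = ¬ IsZeroPol (den x)

_≈_ : QR → QR → Set
x ≈ y = IsZeroPol ((num x ⊛ den y) ⊕ negP (num y ⊛ den x))

infix 4 _≈_
infixl 6 _+Q_
infixl 7 _*Q_

_+Q_ : QR → QR → QR
x +Q y = ((num x ⊛ den y) ⊕ (num y ⊛ den x)) // (den x ⊛ den y)

_*Q_ : QR → QR → QR
x *Q y = (num x ⊛ num y) // (den x ⊛ den y)

-Q_ : QR → QR
-Q x = negP (num x) // den x

0# : QR
0# = [] // (1ℚ ∷ [])

1# : QR
1# = (1ℚ ∷ []) // (1ℚ ∷ [])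

nat : ℕ → QR
nat k = (ℚ.normalize k 1 ∷ []) // (1ℚ ∷ [])

_^Q_ : QR → ℕ → QR
x ^Q zero = 1#
x ^Q suc k = x *Q (x ^Q k)

sumQ : List QR → QR
sumQ = foldr _+Q_ 0#

prodQ : List QR → QR
prodQ = foldr _*Q_ 1#

negPow : ℕ → QR
negPow zero = 1#
negPow (suc m) = -Q negPow m

r : QR
r = (0ℚ ∷ 1ℚ ∷ []) // (1ℚ ∷ [])

α : QR
α = (1ℚ ∷ []) // (0ℚ ∷ 1ℚ ∷ [])

evalℕα : List ℕ → QR
evalℕα [] = 0#
evalℕα (b ∷ bs) = nat b +Q α *Q evalℕα bs

∣_∣ : {n : ℕ} → Vec ℕ n → ℕ
∣ γ ∣ = V.sum γ

comps : (n d : ℕ) → List (Vec ℕ n)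
comps zero d = V.[] ∷ []
comps (suc n) d = concatMap (λ k → map (k V.∷_) (comps n (d ∸ k))) (upTo (suc d))

-- polynomials in x₁..xₙ over ℚ(r) are given by their coefficient
-- function (composition ↦ coefficient); evaluation of a polynomial of
-- total degree ≤ d at a point
monomial : {n : ℕ} → Vec QR n → Vec ℕ n → QR
monomial pt β = V.foldr _ _*Q_ 1# (V.zipWith _^Q_ pt β)

evalPoly : (n d : ℕ) → (Vec ℕ n → QR) → Vec QR n → QR
evalPoly n d c pt = sumQ (map (λ β → c β *Q monomial pt β) (comps n d))

count : {n : ℕ} → (Fin n → Bool) → ℕ
count {n} p = L.length (L.filter (λ i → _≟B_ (p i) true) (L.allFin n))

-- w_γ^{-1}(j) (0-indexed), where w_γ is the minimal-length permutation
-- sorting γ into the partition γ⁺ (stable sort: equal parts keep order)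
sortPos : {n : ℕ} → Vec ℕ n → Fin n → ℕ
sortPos γ j =
  count (λ k → V.lookup γ j ℕ.<ᵇ V.lookup γ k)
  ℕ.+ count (λ k → (toℕ k ℕ.<ᵇ toℕ j) ∧ (V.lookup γ k ℕ.≡ᵇ V.lookup γ j))

δ : (n : ℕ) → ℕ → ℕ
δ n i = n ∸ 1 ∸ i

-- γ̄ = γ + w_γ(rδ);  (w_γ(rδ))_j = r · δ_{w_γ^{-1}(j)}
bar : {n : ℕ} → Vec ℕ n → Vec QR n
bar {n} γ = V.tabulate (λ j → nat (V.lookup γ j) +Q r *Q nat (δ n (sortPos γ j)))

arm : {n : ℕ} → Vec ℕ n → Fin n → ℕ → ℕ
arm η i j = V.lookup η i ∸ j

leg : {n : ℕ} → Vec ℕ n → Fin n → ℕ → ℕ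
leg η i j =
  count (λ k → (toℕ i ℕ.<ᵇ toℕ k) ∧ ((j ℕ.≤ᵇ V.lookup η k) ∧ (V.lookup η k ℕ.≤ᵇ V.lookup η i)))
  ℕ.+ count (λ k → (toℕ k ℕ.<ᵇ toℕ i) ∧ ((j ℕ.≤ᵇ suc (V.lookup η k)) ∧ (suc (V.lookup η k) ℕ.≤ᵇ V.lookup η i)))

boxes : {n : ℕ} → Vec ℕ n → List (Fin n × ℕ)
boxes {n} η = concatMap (λ i → map (λ j → i , suc j) (upTo (V.lookup η i))) (L.allFin n)

dη : {n : ℕ} → Vec ℕ n → QR
dη η = prodQ (map (λ s → α *Q nat (suc (arm η (proj₁ s) (proj₂ s))) +Q nat (suc (leg η (proj₁ s) (proj₂ s)))) (boxes η))

-- coefficient of x^γ in F_η(x) = (-1)^{|η|} d_η(α) E(-x),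
-- where E has coefficient function c
coefF : {n : ℕ} → Vec ℕ n → (Vec ℕ n → QR) → Vec ℕ n → QR
coefF η c γ = negPow (∣ η ∣ ℕ.+ ∣ γ ∣) *Q (dη η *Q c γ)

-- c is the coefficient function of E_η^{rδ}: the characterising properties
record IsInterpolation (n : ℕ) (η : Vec ℕ n) (c : Vec ℕ n → QR) : Set where
  field
    wf       : ∀ γ → NonZeroDen (c γ)
    degree   : ∀ γ → ∣ η ∣ ℕ.< ∣ γ ∣ → c γ ≈ 0#
    monic    : c η ≈ 1#
    vanishes : ∀ γ → ¬ (γ ≡ η) → ∣ γ ∣ ℕ.≤ ∣ η ∣ → evalPoly n ∣ η ∣ c (bar γ) ≈ 0#

{-# OPTIONS --safe #-}
module Submission where

-- The operators x_i + ξ_i, with ξ_i the Cherednik operators, commute; hence there is a linear map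
-- from homogeneous to inhomogeneous polynomials which turns x_i + ξ_i into multiplication by x_i.
-- It sends monomials to "bar monomials" and Jack polynomials E_η to interpolation polynomials.
-- Hence F_η expands in bar monomials with the coefficients of the homogeneous case, which are in
-- ℕ[α] by the recursion of Knop and Sahi. Up to signs the bar monomial with exponent η + e_i is
-- x_i + ξ_i applied to that of η, and if i is the first maximum of η + e_i, then ξ_i x^η has
-- nonnegative coefficients, so that the bar monomials are positive as well.
-- The identity of coefficients over ℚ(r) is checked at all large natural numbers r = 1/α.

open import Defs
open import Data.Nat using (ℕ; _≤_)
open import Data.List using (List)
open import Data.Vec using (Vec)
open import Data.Product using (Σ)
open import Data.Nat as ℕ using (ℕ; zero; suc; _∸_; z≤n; s≤s)
import Data.Nat.Properties as NP
import Data.Nat.Coprimality as C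
import Data.Integer as ℤ
import Data.Integer.Properties as ZP
open import Data.Bool as Bool using (Bool; true; false; if_then_else_; _∧_)
import Data.Bool.Properties as BP
open import Data.List as L using (List; []; _∷_; _++_)
import Data.List.Properties as LP
open import Data.List.Relation.Unary.All as All using (All; []; _∷_)
import Data.List.Relation.Unary.All.Properties as AllP
open import Data.Maybe using (Maybe; just; nothing)
open import Data.Rational as ℚ using (ℚ; 0ℚ; 1ℚ; _+_; _*_; -_; _-_; mkℚ)
open import Data.Rational.Properties as QP using (_≟_)
open import Data.Fin as F using (Fin; zero; suc; inject₁; fromℕ; toℕ; punchIn)
import Data.Fin.Properties as FP
open import Data.Fin.Induction using (>-weakInduction)
open import Data.Vec as V using (Vec; []; _∷_; _∷ʳ_; lookup; _[_]≔_; updateAt; insertAt; removeAt)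
import Data.Vec.Properties as VP
open import Data.Sum using (_⊎_; inj₁; inj₂)
open import Data.Product using (Σ; _×_; _,_; proj₁; proj₂)
open import Data.Empty using (⊥-elim)
open import Function using (_∘_; id)
open import Relation.Binary using (Tri; tri<; tri≈; tri>)
open import Relation.Binary.PropositionalEquality
open import Relation.Nullary
open import Algebra.Bundles using (CommutativeRing)
open import Algebra.Properties.CommutativeMonoid.Sum QP.+-0-commutativeMonoid
  using (sum; sum-remove; sum-init-last; ∑-distrib-+; sum-cong-≗; sum-replicate-zero)
open import Algebra.Properties.CommutativeMonoid.Sum QP.*-1-commutativeMonoid
  using () renaming (sum to prod; sum-remove to prod-remove; sum-cong-≗ to prod-cong; sum-replicate-zero to prod-replicate-1)
open import Algebra.Properties.Semiring.Sum (CommutativeRing.semiring QP.+-*-commutativeRing)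
  using (*-distribˡ-sum; *-distribʳ-sum)
open import Tactic.RingSolver using (solve-∀)
open import Tactic.RingSolver.Core.AlmostCommutativeRing using (AlmostCommutativeRing; fromCommutativeRing)

-- The linear map itself is never built. Composed with evaluation at a point `z` it is a functional
-- `E z` on monomials, and being a joint eigenvector of the transposes `Y i` with eigenvalues
-- `lookup z i` determines this functional up to a scalar. Every symmetry of `E`, under a
-- transposition or under the rotation `Φ`, is therefore found by exhibiting another joint
-- eigenvector and comparing values at the constant monomial. The obstacle is that these symmetries
-- involve inverses of coordinate differences, which would destroy positivity. They are used only to
-- locate zeros: the constants of the recursion are chosen so that the one dangerous value cancels,
-- and no denominator enters the expansion. A numerical `α > 0` makes an order available, which
-- separates the interpolation points. The variables are rescaled by `α`; the points become
-- `αγ + ρ`, and the powers of `α` in the definition of the coefficients reduce to one common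
-- factor.

ring : AlmostCommutativeRing _ _
ring = fromCommutativeRing QP.+-*-commutativeRing isZero
  where
  isZero : ∀ x → Maybe (0ℚ ≡ x)
  isZero x with 0ℚ ≟ x
  ... | yes p = just p
  ... | no _ = nothing

-- Finite sums of rationals and the embedding of the natural numbers

+-sub : ∀ a b → a ≡ a + b - b
+-sub = solve-∀ ring

*-left-comm : ∀ a b c → a * (b * c) ≡ b * (a * c)
*-left-comm = solve-∀ ring

sum-0 : ∀ {n} (f : Fin n → ℚ) → (∀ i → f i ≡ 0ℚ) → sum f ≡ 0ℚ
sum-0 {n} f h = trans (sum-cong-≗ h) (sum-replicate-zero n)

sum-difference : ∀ {n} (f g : Fin n → ℚ) → sum (λ i → f i - g i) ≡ sum f - sum g
sum-difference {zero} f g = refl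
sum-difference {suc n} f g =
  trans (cong (f zero - g zero +_) (sum-difference (f ∘ suc) (g ∘ suc))) (lemma (f zero) (g zero) (sum (f ∘ suc)) (sum (g ∘ suc)))
  where
  lemma : ∀ a b c d → (a - b) + (c - d) ≡ (a + c) - (b + d)
  lemma = solve-∀ ring

sum-*ʳ : ∀ {n} (f : Fin n → ℚ) x → sum (λ i → f i * x) ≡ sum f * x
sum-*ʳ f x = sym (*-distribʳ-sum x f)

sum-punchIn : ∀ {n} (f : Fin (suc n) → ℚ) i → sum f ≡ f i + sum (f ∘ F.punchIn i)
sum-punchIn f i = sum-remove {i = i} f

ι : ℕ → ℚ
ι zero = 0ℚ
ι (suc n) = 1ℚ + ι n

ι-+ : ∀ m n → ι (m ℕ.+ n) ≡ ι m + ι n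
ι-+ zero n = sym (QP.+-identityˡ (ι n))
ι-+ (suc m) n = trans (cong (1ℚ +_) (ι-+ m n)) (sym (QP.+-assoc 1ℚ (ι m) (ι n)))

-- Adjacent transpositions of entries and of indices

swap : ∀ {A : Set} {m} → Fin m → Vec A (suc m) → Vec A (suc m)
swap zero (a ∷ b ∷ v) = b ∷ a ∷ v
swap (suc i) (a ∷ v) = a ∷ swap i v

π : ∀ {m} → Fin m → Fin (suc m) → Fin (suc m)
π zero zero = suc zero
π zero (suc zero) = zero
π zero (suc (suc k)) = suc (suc k)
π (suc i) zero = zero
π (suc i) (suc k) = suc (π i k)

π-involutive : ∀ {m} (i : Fin m) k → π i (π i k) ≡ k
π-involutive zero zero = refl
π-involutive zero (suc zero) = refl
π-involutive zero (suc (suc k)) = refl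
π-involutive (suc i) zero = refl
π-involutive (suc i) (suc k) = cong suc (π-involutive i k)

π-inject₁ : ∀ {m} (i : Fin m) → π i (inject₁ i) ≡ suc i
π-inject₁ zero = refl
π-inject₁ (suc i) = cong suc (π-inject₁ i)

π-suc : ∀ {m} (i : Fin m) → π i (suc i) ≡ inject₁ i
π-suc zero = refl
π-suc (suc i) = cong suc (π-suc i)

swap-involutive : ∀ {A : Set} {m} (i : Fin m) (v : Vec A (suc m)) → swap i (swap i v) ≡ v
swap-involutive zero (a ∷ b ∷ v) = refl
swap-involutive (suc i) (a ∷ v) = cong (a ∷_) (swap-involutive i v)

lookup-swap : ∀ {A : Set} {m} (i : Fin m) (v : Vec A (suc m)) k → lookup (swap i v) k ≡ lookup v (π i k)
lookup-swap zero (a ∷ b ∷ v) zero = refl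
lookup-swap zero (a ∷ b ∷ v) (suc zero) = refl
lookup-swap zero (a ∷ b ∷ v) (suc (suc k)) = refl
lookup-swap (suc i) (a ∷ v) zero = refl
lookup-swap (suc i) (a ∷ v) (suc k) = lookup-swap i v k

swap-updateAt : ∀ {A : Set} {m} (i : Fin m) (v : Vec A (suc m)) k (f : A → A) →
  swap i (updateAt v (π i k) f) ≡ updateAt (swap i v) k f
swap-updateAt zero (a ∷ b ∷ v) zero f = refl
swap-updateAt zero (a ∷ b ∷ v) (suc zero) f = refl
swap-updateAt zero (a ∷ b ∷ v) (suc (suc k)) f = refl
swap-updateAt (suc i) (a ∷ v) zero f = refl
swap-updateAt (suc i) (a ∷ v) (suc k) f = cong (a ∷_) (swap-updateAt i v k f)

sum-π : ∀ {m} (i : Fin m) (f : Fin (suc m) → ℚ) → sum (f ∘ π i) ≡ sum f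
sum-π zero f = lemma (f zero) (f (suc zero)) (sum (λ k → f (suc (suc k))))
  where
  lemma : ∀ a b c → b + (a + c) ≡ a + (b + c)
  lemma = solve-∀ ring
sum-π (suc i) f = cong (f zero +_) (sum-π i (f ∘ suc))

vec-ext : ∀ {A : Set} {n} {u v : Vec A n} → (∀ k → lookup u k ≡ lookup v k) → u ≡ v
vec-ext {u = []} {[]} h = refl
vec-ext {u = a ∷ u} {b ∷ v} h = cong₂ _∷_ (h zero) (vec-ext (h ∘ suc))

lookup-∷ʳ-inject₁ : ∀ {A : Set} {n} (v : Vec A n) x k → lookup (v ∷ʳ x) (inject₁ k) ≡ lookup v k
lookup-∷ʳ-inject₁ (a ∷ v) x zero = refl
lookup-∷ʳ-inject₁ (a ∷ v) x (suc k) = lookup-∷ʳ-inject₁ v x k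

lookup-∷ʳ-last : ∀ {A : Set} {n} (v : Vec A n) x → lookup (v ∷ʳ x) (fromℕ n) ≡ x
lookup-∷ʳ-last [] x = refl
lookup-∷ʳ-last (a ∷ v) x = lookup-∷ʳ-last v x

lookup-∷ʳ-not-last : ∀ {A : Set} {n} (v : Vec A n) x y i → i ≢ fromℕ n → lookup (v ∷ʳ x) i ≡ lookup (v ∷ʳ y) i
lookup-∷ʳ-not-last v x y = >-weakInduction _ (λ ne → ⊥-elim (ne refl))
  (λ j _ _ → trans (lookup-∷ʳ-inject₁ v x j) (sym (lookup-∷ʳ-inject₁ v y j)))

updateAt-∷ʳ-inject₁ : ∀ {A : Set} {n} (v : Vec A n) x k f → updateAt (v ∷ʳ x) (inject₁ k) f ≡ updateAt v k f ∷ʳ x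
updateAt-∷ʳ-inject₁ (a ∷ v) x zero f = refl
updateAt-∷ʳ-inject₁ (a ∷ v) x (suc k) f = cong (a ∷_) (updateAt-∷ʳ-inject₁ v x k f)

updateAt-∷ʳ-last : ∀ {A : Set} {n} (v : Vec A n) x f → updateAt (v ∷ʳ x) (fromℕ n) f ≡ v ∷ʳ f x
updateAt-∷ʳ-last [] x f = refl
updateAt-∷ʳ-last (a ∷ v) x f = cong (a ∷_) (updateAt-∷ʳ-last v x f)

-- ε k j = [j ≤ k] records the asymmetry in the order of the variables, both of the Cherednik
-- operators and of the ranks ρ.
ε : ∀ {n} → Fin n → Fin n → ℕ
ε k zero = 1
ε zero (suc j) = 0
ε (suc k) (suc j) = ε k j

ε-inject₁ : ∀ {n} (k j : Fin n) → ε (inject₁ k) (inject₁ j) ≡ ε k j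
ε-inject₁ k zero = refl
ε-inject₁ zero (suc j) = refl
ε-inject₁ (suc k) (suc j) = ε-inject₁ k j

ε-inject₁-last : ∀ {n} (k : Fin n) → ε (inject₁ k) (fromℕ n) ≡ 0
ε-inject₁-last zero = refl
ε-inject₁-last (suc k) = ε-inject₁-last k

ε-last : ∀ {n} (j : Fin (suc n)) → ε (fromℕ n) j ≡ 1
ε-last zero = refl
ε-last {suc n} (suc j) = ε-last j

ε-refl : ∀ {n} (k : Fin n) → ε k k ≡ 1
ε-refl zero = refl
ε-refl (suc k) = ε-refl k

ε-antisym : ∀ {n} (i k : Fin n) → i ≢ k → ε i k ℕ.+ ε k i ≡ 1
ε-antisym zero zero i≢k = ⊥-elim (i≢k refl)
ε-antisym zero (suc k) i≢k = refl
ε-antisym (suc i) zero i≢k = refl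
ε-antisym (suc i) (suc k) i≢k = ε-antisym i k (i≢k ∘ cong suc)

ε-01 : ∀ {n} (k j : Fin n) → ε k j ≡ 0 ⊎ ε k j ≡ 1
ε-01 k zero = inj₂ refl
ε-01 zero (suc j) = inj₁ refl
ε-01 (suc k) (suc j) = ε-01 k j

-- An adjacent transposition changes the order of two indices only if it exchanges them.
ε-π : ∀ {m} (i : Fin m) k j → ε (π i k) (π i j) ≡ ε k j ⊎ (π i k ≡ j × π i j ≡ k × k ≢ j)
ε-π zero zero zero = inj₁ refl
ε-π zero zero (suc zero) = inj₂ (refl , refl , λ ())
ε-π zero zero (suc (suc j)) = inj₁ refl
ε-π zero (suc zero) zero = inj₂ (refl , refl , λ ())
ε-π zero (suc zero) (suc zero) = inj₁ refl
ε-π zero (suc zero) (suc (suc j)) = inj₁ refl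
ε-π zero (suc (suc k)) zero = inj₁ refl
ε-π zero (suc (suc k)) (suc zero) = inj₁ refl
ε-π zero (suc (suc k)) (suc (suc j)) = inj₁ refl
ε-π (suc i) zero zero = inj₁ refl
ε-π (suc i) zero (suc j) = inj₁ refl
ε-π (suc i) (suc k) zero = inj₁ refl
ε-π (suc i) (suc k) (suc j) with ε-π i k j
... | inj₁ e = inj₁ e
... | inj₂ (a , b , c) = inj₂ (cong suc a , cong suc b , λ { refl → c refl })

-- The failure of `ε` to be invariant under a transposition. It is nonzero only for the exchanged
-- pair of indices, and its row sums `displ` are the constants in the relations `Y-swap`.
κ : ∀ {m} → Fin m → Fin (suc m) → Fin (suc m) → ℚ
κ i k j = ι (ε (π i k) (π i j)) - ι (ε k j)

displ : ∀ {m} → Fin m → Fin (suc m) → ℚ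
displ zero zero = 1ℚ
displ zero (suc zero) = - 1ℚ
displ zero (suc (suc k)) = 0ℚ
displ (suc i) zero = 0ℚ
displ (suc i) (suc k) = displ i k

displ-inject₁ : ∀ {m} (i : Fin m) → displ i (inject₁ i) ≡ 1ℚ
displ-inject₁ zero = refl
displ-inject₁ (suc i) = displ-inject₁ i

displ-suc : ∀ {m} (i : Fin m) → displ i (suc i) ≡ - 1ℚ
displ-suc zero = refl
displ-suc (suc i) = displ-suc i

sum-κ : ∀ {m} (i : Fin m) k → sum (κ i k) ≡ displ i k
sum-κ {suc m} zero zero = cong (λ x → 0ℚ + (1ℚ + x)) (sum-0 {m} (λ j → κ {suc m} zero zero (suc (suc j))) (λ j → refl))
sum-κ {suc m} zero (suc zero) = cong (λ x → - 1ℚ + (0ℚ + x)) (sum-0 {m} (λ j → κ {suc m} zero (suc zero) (suc (suc j))) (λ j → refl))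
sum-κ zero (suc (suc k)) = cong (λ x → 0ℚ + (0ℚ + x)) (sum-0 (λ j → κ zero (suc (suc k)) (suc (suc j))) (λ j → QP.+-inverseʳ (ι (ε k j))))
sum-κ (suc i) zero = cong (0ℚ +_) (sum-0 (λ j → κ (suc i) zero (suc j)) (λ j → refl))
sum-κ (suc i) (suc k) = trans (QP.+-identityˡ _) (sum-κ i k)

π-cases : ∀ {m} (i : Fin m) k → k ≡ inject₁ i ⊎ k ≡ suc i ⊎ (π i k ≡ k × displ i k ≡ 0ℚ)
π-cases zero zero = inj₁ refl
π-cases zero (suc zero) = inj₂ (inj₁ refl)
π-cases zero (suc (suc k)) = inj₂ (inj₂ (refl , refl))
π-cases (suc i) zero = inj₂ (inj₂ (refl , refl))
π-cases (suc i) (suc k) with π-cases i k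
... | inj₁ refl = inj₁ refl
... | inj₂ (inj₁ refl) = inj₂ (inj₁ refl)
... | inj₂ (inj₂ (p , q)) = inj₂ (inj₂ (cong suc p , q))

-- Cherednik operators

Comp : ℕ → Set
Comp = Vec ℕ

Φ : ∀ {m} → Comp (suc m) → Comp (suc m)
Φ (b ∷ v) = v ∷ʳ suc b

-- pre f b = Σ_{l<b} f l, so that pre f b - pre f a is a signed sum over the interval from a to b.
pre : (ℕ → ℚ) → ℕ → ℚ
pre f zero = 0ℚ
pre f (suc b) = pre f b + f b

pre-cong : ∀ {f g} b → (∀ l → l ℕ.< b → f l ≡ g l) → pre f b ≡ pre g b
pre-cong zero h = refl
pre-cong (suc b) h = cong₂ _+_ (pre-cong b (λ l l<b → h l (NP.m<n⇒m<1+n l<b))) (h b NP.≤-refl)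

pre-head : ∀ f b → pre f (suc b) ≡ f 0 + pre (f ∘ suc) b
pre-head f zero = QP.+-comm 0ℚ (f 0)
pre-head f (suc b) = trans (cong (_+ f (suc b)) (pre-head f b)) (QP.+-assoc (f 0) (pre (f ∘ suc) b) (f (suc b)))

pre-linear : ∀ f g c b → pre (λ l → f l + c * g l) b ≡ pre f b + c * pre g b
pre-linear f g c zero = lemma c
  where
  lemma : ∀ c → 0ℚ ≡ 0ℚ + c * 0ℚ
  lemma = solve-∀ ring
pre-linear f g c (suc b) = trans (cong (_+ (f b + c * g b)) (pre-linear f g c b)) (lemma (pre f b) (pre g b) (f b) (g b) c)
  where
  lemma : ∀ a b f g c → a + c * b + (f + c * g) ≡ a + f + c * (b + g)
  lemma = solve-∀ ring

-- Both boundaries are `q` or `q + 1`, so only the term `f q` can be gained or lost. This is how a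
-- change of `ε` acts on the signed sums.
pre-shift : ∀ f q {e e'} → e ≡ 0 ⊎ e ≡ 1 → e' ≡ 0 ⊎ e' ≡ 1 →
  pre f (e' ℕ.+ q) - pre f (e ℕ.+ q) ≡ (ι e' - ι e) * f q
pre-shift f q (inj₁ refl) (inj₁ refl) = lemma (pre f q) (f q)
  where
  lemma : ∀ a b → a - a ≡ (0ℚ - 0ℚ) * b
  lemma = solve-∀ ring
pre-shift f q (inj₁ refl) (inj₂ refl) = lemma (pre f q) (f q)
  where
  lemma : ∀ a b → a + b - a ≡ (1ℚ + 0ℚ - 0ℚ) * b
  lemma = solve-∀ ring
pre-shift f q (inj₂ refl) (inj₁ refl) = lemma (pre f q) (f q)
  where
  lemma : ∀ a b → a - (a + b) ≡ (0ℚ - (1ℚ + 0ℚ)) * b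
  lemma = solve-∀ ring
pre-shift f q (inj₂ refl) (inj₂ refl) = lemma (pre f q) (f q)
  where
  lemma : ∀ a b → a + b - (a + b) ≡ (1ℚ + 0ℚ - (1ℚ + 0ℚ)) * b
  lemma = solve-∀ ring

put : ∀ {n} → Fin n → Fin n → ℕ → ℕ → Comp n → Comp n
put k j a b β = (β [ k ]≔ a) [ j ]≔ b

-- Operators on polynomials are represented by their transposes, acting on functionals
-- φ β = φ(x^β). T k j is the transpose of x_k/(x_k - x_j)·(1 - s_kj) for j < k, and of
-- 1 + x_j/(x_k - x_j)·(1 - s_kj) for j > k: both are signed sums over the exponent l of x_k.
ψ : ∀ {n} → Fin n → Fin n → (Comp n → ℚ) → Comp n → ℕ → ℚ
ψ k j φ β l = φ (put k j l (lookup β k ℕ.+ lookup β j ∸ l) β)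

T : ∀ {n} → Fin n → Fin n → (Comp n → ℚ) → Comp n → ℚ
T k j φ β = pre (ψ k j φ β) (suc (lookup β k)) - pre (ψ k j φ β) (ε k j ℕ.+ lookup β j)

-- Since `ε k k` is 1 the two bounds coincide, so that the sum in `ξ` may run over all `j`.
T-self : ∀ {n} (k : Fin n) φ β → T k k φ β ≡ 0ℚ
T-self k φ β rewrite ε-refl k = QP.+-inverseʳ (pre (ψ k k φ β) (suc (lookup β k)))

-- No exponent beyond the sum of the two old ones occurs, so the truncated difference in `ψ` is a
-- true one. With `sum-put` this gives the homogeneity of `ξ`.
T-range : ∀ {n} {k j : Fin n} {φ φ'} {β : Comp n} →
  (∀ l → l ℕ.≤ lookup β k ℕ.+ lookup β j → ψ k j φ β l ≡ ψ k j φ' β l) → T k j φ β ≡ T k j φ' β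
T-range {k = k} {j} {φ} {φ'} {β} h = cong₂ _-_
  (pre-cong (suc (lookup β k)) λ { l (s≤s l≤) → h l (NP.≤-trans l≤ (NP.m≤m+n _ _)) })
  (pre-cong (ε k j ℕ.+ lookup β j) λ l l< → h l (NP.≤-trans (NP.≤-pred (NP.≤-trans l< (NP.+-monoˡ-≤ (lookup β j) ε≤1))) (NP.m≤n+m _ _)))
  where
  ε≤1 : ε k j ℕ.≤ 1
  ε≤1 with ε-01 k j
  ... | inj₁ e rewrite e = z≤n
  ... | inj₂ e rewrite e = s≤s z≤n

T-linear : ∀ {n} (k j : Fin n) φ χ c β → T k j (λ β → φ β + c * χ β) β ≡ T k j φ β + c * T k j χ β
T-linear k j φ χ c β = trans
  (cong₂ _-_ (pre-linear (ψ k j φ β) (ψ k j χ β) c P) (pre-linear (ψ k j φ β) (ψ k j χ β) c Q))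
  (lemma (pre (ψ k j φ β) P) (pre (ψ k j χ β) P) (pre (ψ k j φ β) Q) (pre (ψ k j χ β) Q) c)
  where
  P = suc (lookup β k)
  Q = ε k j ℕ.+ lookup β j
  lemma : ∀ a b d e c → a + c * b - (d + c * e) ≡ a - d + c * (b - e)
  lemma = solve-∀ ring

-- Degrees, and induction on compositions

sum-updateAt : ∀ {n} (β : Comp n) k → V.sum (updateAt β k suc) ≡ suc (V.sum β)
sum-updateAt (b ∷ β) zero = refl
sum-updateAt (b ∷ β) (suc k) = trans (cong (b ℕ.+_) (sum-updateAt β k)) (NP.+-suc b _)

sum-set : ∀ {n} (β : Comp n) k a → V.sum (β [ k ]≔ a) ℕ.+ lookup β k ≡ V.sum β ℕ.+ a
sum-set (b ∷ β) zero a = trans (NP.+-assoc a _ b) (trans (NP.+-comm a _) (cong (ℕ._+ a) (NP.+-comm _ b)))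
sum-set (b ∷ β) (suc k) a = trans (NP.+-assoc b _ _) (trans (cong (b ℕ.+_) (sum-set β k a)) (sym (NP.+-assoc b _ a)))

sum-put : ∀ {n} {k j : Fin n} → k ≢ j → ∀ β {l} → l ℕ.≤ lookup β k ℕ.+ lookup β j →
  V.sum (put k j l (lookup β k ℕ.+ lookup β j ∸ l) β) ≡ V.sum β
sum-put {k = k} {j} k≢j β {l} l≤ = NP.+-cancelʳ-≡ (lookup β k ℕ.+ lookup β j) _ _ (begin
  V.sum B ℕ.+ (p ℕ.+ q) ≡⟨ cong (V.sum B ℕ.+_) (NP.+-comm p q) ⟩
  V.sum B ℕ.+ (q ℕ.+ p) ≡⟨ sym (NP.+-assoc (V.sum B) q p) ⟩
  V.sum B ℕ.+ q ℕ.+ p ≡⟨ cong (λ x → V.sum B ℕ.+ x ℕ.+ p) (sym (VP.lookup∘updateAt′ j k (k≢j ∘ sym) β)) ⟩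
  V.sum B ℕ.+ lookup A j ℕ.+ p ≡⟨ cong (ℕ._+ p) (sum-set A j _) ⟩
  V.sum A ℕ.+ (p ℕ.+ q ∸ l) ℕ.+ p ≡⟨ NP.+-assoc (V.sum A) _ p ⟩
  V.sum A ℕ.+ (p ℕ.+ q ∸ l ℕ.+ p) ≡⟨ cong (V.sum A ℕ.+_) (NP.+-comm _ p) ⟩
  V.sum A ℕ.+ (p ℕ.+ (p ℕ.+ q ∸ l)) ≡⟨ sym (NP.+-assoc (V.sum A) p _) ⟩
  V.sum A ℕ.+ p ℕ.+ (p ℕ.+ q ∸ l) ≡⟨ cong (ℕ._+ (p ℕ.+ q ∸ l)) (sum-set β k l) ⟩
  V.sum β ℕ.+ l ℕ.+ (p ℕ.+ q ∸ l) ≡⟨ NP.+-assoc (V.sum β) l _ ⟩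
  V.sum β ℕ.+ (l ℕ.+ (p ℕ.+ q ∸ l)) ≡⟨ cong (V.sum β ℕ.+_) (NP.m+[n∸m]≡n l≤) ⟩
  V.sum β ℕ.+ (p ℕ.+ q) ∎)
  where
  open ≡-Reasoning
  p = lookup β k
  q = lookup β j
  A = β [ k ]≔ l
  B = put k j l (p ℕ.+ q ∸ l) β

sum-swap : ∀ {m} (i : Fin m) β → V.sum (swap i β) ≡ V.sum β
sum-swap zero (a ∷ b ∷ β) = trans (sym (NP.+-assoc b a _)) (trans (cong (ℕ._+ V.sum β) (NP.+-comm b a)) (NP.+-assoc a b _))
sum-swap (suc i) (a ∷ β) = cong (a ℕ.+_) (sum-swap i β)

sum-∷ʳ : ∀ {n} (v : Comp n) x → V.sum (v ∷ʳ x) ≡ V.sum v ℕ.+ x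
sum-∷ʳ [] x = NP.+-identityʳ x
sum-∷ʳ (a ∷ v) x = trans (cong (a ℕ.+_) (sum-∷ʳ v x)) (sym (NP.+-assoc a _ x))

sum-Φ : ∀ {m} (β : Comp (suc m)) → V.sum (Φ β) ≡ suc (V.sum β)
sum-Φ (b ∷ v) = trans (sum-∷ʳ v (suc b)) (NP.+-comm (V.sum v) (suc b))

0v : ∀ {n} → Comp n
0v {n} = V.replicate n 0

sum≡0 : ∀ {n} (β : Comp n) → V.sum β ≡ 0 → β ≡ 0v
sum≡0 [] h = refl
sum≡0 (zero ∷ β) h = cong (0 ∷_) (sum≡0 β h)

nonzero-index : ∀ {n} (β : Comp n) {d} → V.sum β ≡ suc d → Σ (Fin n) λ k → Σ ℕ λ a → lookup β k ≡ suc a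
nonzero-index (suc b ∷ β) h = zero , b , refl
nonzero-index (zero ∷ β) h with nonzero-index β h
... | k , a , e = suc k , a , e

unsnoc : ∀ {A : Set} {n} (v : Vec A (suc n)) → v ≡ V.init v ∷ʳ lookup v (fromℕ n)
unsnoc (a ∷ []) = refl
unsnoc (a ∷ b ∷ v) = cong (a ∷_) (unsnoc (b ∷ v))

-- Transpositions carry a positive entry to the end; the composition is then a value of `Φ` at one
-- of degree one less.
comp-ind : ∀ {m} (P : Comp (suc m) → Set) → P 0v → (∀ i β → P β → P (swap i β)) → (∀ β → P β → P (Φ β)) → ∀ β → P β
comp-ind {m} P base sw ro β = go (V.sum β) β refl
  where
  go : ∀ d β → V.sum β ≡ d → P β
  go zero β h = subst P (sym (sum≡0 β h)) base
  go (suc d) β h with nonzero-index β h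
  ... | k , a , e = >-weakInduction (λ k → ∀ β → V.sum β ≡ suc d → ∀ a → lookup β k ≡ suc a → P β) at-last step k β h a e
    where
    at-last : ∀ β → V.sum β ≡ suc d → ∀ a → lookup β (fromℕ m) ≡ suc a → P β
    at-last β h a e = subst P (sym eq) (ro (a ∷ V.init β) (go d (a ∷ V.init β) (NP.suc-injective
        (trans (sym (sum-Φ (a ∷ V.init β))) (trans (cong V.sum (sym eq)) h)))))
      where
      eq : β ≡ Φ (a ∷ V.init β)
      eq = trans (unsnoc β) (cong (V.init β ∷ʳ_) e)
    step : ∀ i → (∀ β → V.sum β ≡ suc d → ∀ a → lookup β (suc i) ≡ suc a → P β) →
      ∀ β → V.sum β ≡ suc d → ∀ a → lookup β (inject₁ i) ≡ suc a → P β
    step i IH β h a e = subst P (swap-involutive i β)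
      (sw i (swap i β) (IH (swap i β) (trans (sum-swap i β) h) a
        (trans (lookup-swap i β (suc i)) (trans (cong (lookup β) (π-suc i)) e))))

-- The operators `Y` and their relations with transpositions and `Φ`

module _ (α : ℚ) where

  -- The first summand is the transpose of `α x_k ∂/∂x_k`.
  ξ : ∀ {n} → Fin n → (Comp n → ℚ) → Comp n → ℚ
  ξ k φ β = α * ι (lookup β k) * φ β + sum (λ j → T k j φ β)

  -- x_k + ξ_k, which represents multiplication by x_k in the basis of bar monomials.
  Y : ∀ {n} → Fin n → (Comp n → ℚ) → Comp n → ℚ
  Y k φ β = φ (updateAt β k suc) + ξ k φ β

  ξ-degree : ∀ {n} (k : Fin n) {φ φ'} β → (∀ ν → V.sum ν ≡ V.sum β → φ ν ≡ φ' ν) → ξ k φ β ≡ ξ k φ' β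
  ξ-degree k {φ} {φ'} β h = cong₂ _+_ (cong (α * ι (lookup β k) *_) (h β refl)) (sum-cong-≗ pointwise)
    where
    pointwise : ∀ j → T k j φ β ≡ T k j φ' β
    pointwise j with k FP.≟ j
    ... | yes refl = trans (T-self k φ β) (sym (T-self k φ' β))
    ... | no k≢j = T-range {k = k} {j} {φ} {φ'} {β} (λ l l≤ → h _ (sum-put k≢j β l≤))

  Y-cong : ∀ {n} (k : Fin n) {φ φ'} → (∀ β → φ β ≡ φ' β) → ∀ β → Y k φ β ≡ Y k φ' β
  Y-cong k h β = cong₂ _+_ (h _) (ξ-degree k β (λ ν _ → h ν))

  ξ-linear : ∀ {n} (k : Fin n) φ χ c β → ξ k (λ β → φ β + c * χ β) β ≡ ξ k φ β + c * ξ k χ β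
  ξ-linear k φ χ c β = trans
    (cong (α * ι (lookup β k) * (φ β + c * χ β) +_)
      (trans (sum-cong-≗ (λ j → T-linear k j φ χ c β))
      (trans (∑-distrib-+ (λ j → T k j φ β) (λ j → c * T k j χ β))
        (cong (sum (λ j → T k j φ β) +_) (sym (*-distribˡ-sum c (λ j → T k j χ β)))))))
    (lemma (α * ι (lookup β k)) (φ β) (χ β) c (sum (λ j → T k j φ β)) (sum (λ j → T k j χ β)))
    where
    lemma : ∀ a f g c s t → a * (f + c * g) + (s + c * t) ≡ a * f + s + c * (a * g + t)
    lemma = solve-∀ ring

  Y-linear : ∀ {n} (k : Fin n) φ χ c β → Y k (λ β → φ β + c * χ β) β ≡ Y k φ β + c * Y k χ β
  Y-linear k φ χ c β = trans (cong (φ β⁺ + c * χ β⁺ +_) (ξ-linear k φ χ c β))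
      (lemma (φ β⁺) (χ β⁺) c (ξ k φ β) (ξ k χ β))
    where
    β⁺ = updateAt β k suc
    lemma : ∀ f g c s t → f + c * g + (s + c * t) ≡ f + s + c * (g + t)
    lemma = solve-∀ ring

  -- Conjugation changes only `ε`, hence moves the lower bound by at most one. A term is gained or
  -- lost only for the exchanged pair, and there it is `φ β`: interchanging the two exponents undoes
  -- the swap.
  T-swap : ∀ {m} (i : Fin m) k j φ β → T k j φ (swap i β) ≡ T (π i k) (π i j) (φ ∘ swap i) β + κ i k j * φ β
  T-swap i k j φ β = trans (cong₂ _-_ (same (suc p')) (same (ε k j ℕ.+ q'))) (trans
      (cong₂ (λ x y → pre f' (suc x) - pre f' (ε k j ℕ.+ y)) (lookup-swap i β k) (lookup-swap i β j))
      (trans (lemma (pre f' (suc p)) (pre f' (ε k j ℕ.+ q)) (pre f' (ε (π i k) (π i j) ℕ.+ q)))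
        (cong (T (π i k) (π i j) (φ ∘ swap i) β +_)
          (trans (pre-shift f' q (ε-01 k j) (ε-01 (π i k) (π i j))) last-step))))
    where
    p' = lookup (swap i β) k
    q' = lookup (swap i β) j
    p = lookup β (π i k)
    q = lookup β (π i j)
    f = ψ k j φ (swap i β)
    f' = ψ (π i k) (π i j) (φ ∘ swap i) β
    lemma : ∀ a b c → a - b ≡ a - c + (c - b)
    lemma = solve-∀ ring
    swap-put : ∀ a b → put k j a b (swap i β) ≡ swap i (put (π i k) (π i j) a b β)
    swap-put a b = sym (trans (swap-updateAt i (β [ π i k ]≔ a) j (λ _ → b)) (cong (_[ j ]≔ b) (swap-updateAt i β k (λ _ → a))))
    f≡f' : ∀ l → f l ≡ f' l
    f≡f' l = cong φ (trans (cong (λ x → put k j l (x ∸ l) (swap i β)) (cong₂ ℕ._+_ (lookup-swap i β k) (lookup-swap i β j)))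
      (swap-put l _))
    same : ∀ b → pre f b ≡ pre f' b
    same b = pre-cong b (λ l _ → f≡f' l)
    last-step : (ι (ε (π i k) (π i j)) - ι (ε k j)) * f' q ≡ κ i k j * φ β
    last-step with ε-π i k j
    ... | inj₁ e rewrite e = lem2 (ι (ε k j)) (f' q) (φ β)
      where
      lem2 : ∀ a x y → (a - a) * x ≡ (a - a) * y
      lem2 = solve-∀ ring
    ... | inj₂ (πk≡j , πj≡k , k≢j) = cong ((ι (ε (π i k) (π i j)) - ι (ε k j)) *_) (cong φ restore)
      where
      restore : swap i (put (π i k) (π i j) q (p ℕ.+ q ∸ q) β) ≡ β
      restore = trans (sym (swap-put q (p ℕ.+ q ∸ q))) (trans (cong₂ (λ a b → put k j a b (swap i β))
          (trans (cong (lookup β) πj≡k) refl) (trans (NP.m+n∸n≡m p q) (cong (lookup β) πk≡j))) (vec-ext pointwise))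
        where
        pointwise : ∀ l → lookup (put k j (lookup β k) (lookup β j) (swap i β)) l ≡ lookup β l
        pointwise l with j FP.≟ l | k FP.≟ l
        ... | yes refl | _ = VP.lookup∘update j (swap i β [ k ]≔ lookup β k) (lookup β j)
        ... | no j≢l | yes refl = trans (VP.lookup∘update′ (j≢l ∘ sym) (swap i β [ k ]≔ lookup β k) (lookup β j))
              (VP.lookup∘update k (swap i β) (lookup β k))
        ... | no j≢l | no k≢l = trans (VP.lookup∘update′ (j≢l ∘ sym) (swap i β [ k ]≔ lookup β k) (lookup β j))
              (trans (VP.lookup∘update′ (k≢l ∘ sym) (swap i β) (lookup β k))
              (trans (lookup-swap i β l) (cong (lookup β) fixed)))
          where
          fixed : π i l ≡ l
          fixed with π-cases i l | π-cases i k
          ... | inj₂ (inj₂ (e , _)) | _ = e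
          ... | inj₁ refl | inj₁ refl = ⊥-elim (k≢l refl)
          ... | inj₁ refl | inj₂ (inj₁ refl) = ⊥-elim (j≢l (trans (sym πk≡j) (π-suc i)))
          ... | inj₁ refl | inj₂ (inj₂ (e , _)) = ⊥-elim (k≢j (trans (sym e) πk≡j))
          ... | inj₂ (inj₁ refl) | inj₁ refl = ⊥-elim (j≢l (trans (sym πk≡j) (π-inject₁ i)))
          ... | inj₂ (inj₁ refl) | inj₂ (inj₁ refl) = ⊥-elim (k≢l refl)
          ... | inj₂ (inj₁ refl) | inj₂ (inj₂ (e , _)) = ⊥-elim (k≢j (trans (sym e) πk≡j))

  -- The relation of the degenerate affine Hecke algebra, with constant `displ i k`.
  Y-swap : ∀ {m} (i : Fin m) k φ β → Y k φ (swap i β) ≡ Y (π i k) (φ ∘ swap i) β + displ i k * φ β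
  Y-swap i k φ β = trans (cong₂ _+_ raise (cong₂ _+_ (cong (λ x → α * ι x * φ (swap i β)) (lookup-swap i β k)) sums))
      (lemma (φ (swap i (updateAt β (π i k) suc))) (α * ι (lookup β (π i k)) * φ (swap i β))
        (sum (λ j → T (π i k) j (φ ∘ swap i) β)) (displ i k * φ β))
    where
    lemma : ∀ a b c d → a + (b + (c + d)) ≡ a + (b + c) + d
    lemma = solve-∀ ring
    raise : φ (updateAt (swap i β) k suc) ≡ φ (swap i (updateAt β (π i k) suc))
    raise = cong φ (sym (swap-updateAt i β k suc))
    sums : sum (λ j → T k j φ (swap i β)) ≡ sum (λ j → T (π i k) j (φ ∘ swap i) β) + displ i k * φ β
    sums = trans (sum-cong-≗ (λ j → T-swap i k j φ β))
      (trans (∑-distrib-+ (λ j → T (π i k) (π i j) (φ ∘ swap i) β) (λ j → κ i k j * φ β))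
      (cong₂ _+_ (sum-π i (λ j → T (π i k) j (φ ∘ swap i) β))
        (trans (sum-*ʳ (κ i k) (φ β)) (cong (_* φ β) (sum-κ i k)))))

  -- The first index becomes the last, so its `ε` against `k` drops from 1 to 0 while its exponent
  -- grows by one: the lower bound, which is their sum, stays the same.
  Y-Φ-inject₁ : ∀ {m} (k : Fin m) φ β → Y (inject₁ k) φ (Φ β) ≡ Y (suc k) (φ ∘ Φ) β
  Y-Φ-inject₁ {m} k φ (b ∷ v) = cong₂ _+_ (cong φ (updateAt-∷ʳ-inject₁ v (suc b) k suc))
      (cong₂ _+_ (cong (λ x → α * ι x * φ w) (lookup-∷ʳ-inject₁ v (suc b) k))
        (trans (sum-init-last (λ j → T (inject₁ k) j φ w))
        (trans (cong₂ _+_ (sum-cong-≗ inner) outer)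
          (QP.+-comm (sum (λ j → T (suc k) (suc j) (φ ∘ Φ) (b ∷ v))) (T (suc k) zero (φ ∘ Φ) (b ∷ v))))))
    where
    w = v ∷ʳ suc b
    p = lookup v k
    inner : ∀ j → T (inject₁ k) (inject₁ j) φ w ≡ T (suc k) (suc j) (φ ∘ Φ) (b ∷ v)
    inner j rewrite lookup-∷ʳ-inject₁ v (suc b) k | lookup-∷ʳ-inject₁ v (suc b) j | ε-inject₁ k j =
      cong₂ _-_ (pre-cong (suc p) (λ l _ → same l)) (pre-cong (ε k j ℕ.+ lookup v j) (λ l _ → same l))
      where
      same : ∀ l → φ (put (inject₁ k) (inject₁ j) l (p ℕ.+ lookup v j ∸ l) w)
                 ≡ φ (put k j l (p ℕ.+ lookup v j ∸ l) v ∷ʳ suc b)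
      same l = cong φ (trans (cong (λ u → updateAt u (inject₁ j) (λ _ → p ℕ.+ lookup v j ∸ l)) (updateAt-∷ʳ-inject₁ v (suc b) k (λ _ → l)))
        (updateAt-∷ʳ-inject₁ (v [ k ]≔ l) (suc b) j _))
    outer : T (inject₁ k) (fromℕ m) φ w ≡ T (suc k) zero (φ ∘ Φ) (b ∷ v)
    outer rewrite lookup-∷ʳ-inject₁ v (suc b) k | lookup-∷ʳ-last v (suc b) | ε-inject₁-last k =
      cong₂ _-_ (pre-cong (suc p) (λ { l (s≤s l≤p) → same l (NP.≤-trans l≤p (NP.m≤m+n p b)) }))
                (pre-cong (suc b) (λ { l (s≤s l≤b) → same l (NP.≤-trans l≤b (NP.m≤n+m b p)) }))
      where
      same : ∀ l → l ℕ.≤ p ℕ.+ b → φ (put (inject₁ k) (fromℕ m) l (p ℕ.+ suc b ∸ l) w) ≡ φ ((v [ k ]≔ l) ∷ʳ suc (p ℕ.+ b ∸ l))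
      same l l≤ = cong φ (trans (cong (λ u → updateAt u (fromℕ m) (λ _ → p ℕ.+ suc b ∸ l)) (updateAt-∷ʳ-inject₁ v (suc b) k (λ _ → l)))
        (trans (updateAt-∷ʳ-last (v [ k ]≔ l) (suc b) (λ _ → p ℕ.+ suc b ∸ l))
          (cong ((v [ k ]≔ l) ∷ʳ_) (trans (cong (_∸ l) (NP.+-suc p b)) (NP.+-∸-assoc 1 l≤)))))

  -- All ranges for the moved variable are shifted by one, and the extra terms at exponent 0 cancel
  -- in the difference. The defect `α` comes from the derivative, as the exponent has grown by one.
  Y-Φ-last : ∀ {m} φ (β : Comp (suc m)) → Y (fromℕ m) φ (Φ β) ≡ Y zero (φ ∘ Φ) β + α * φ (Φ β)
  Y-Φ-last {m} φ (b ∷ v) = trans (cong₂ _+_ (cong φ (updateAt-∷ʳ-last v (suc b) suc))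
      (cong₂ _+_ (cong (λ x → α * ι x * φ w) (lookup-∷ʳ-last v (suc b)))
        (trans (sum-init-last (λ j → T (fromℕ m) j φ w))
          (cong₂ _+_ (sum-cong-≗ inner) (trans (T-self (fromℕ m) φ w) (sym (T-self zero (φ ∘ Φ) (b ∷ v))))))))
      (lemma (φ (v ∷ʳ suc (suc b))) α (ι b) (φ w) (sum (λ j → T zero (suc j) (φ ∘ Φ) (b ∷ v))) (T zero zero (φ ∘ Φ) (b ∷ v)))
    where
    w = v ∷ʳ suc b
    lemma : ∀ a α i w s t → a + (α * (1ℚ + i) * w + (s + t)) ≡ a + (α * i * w + (t + s)) + α * w
    lemma = solve-∀ ring
    inner : ∀ j → T (fromℕ m) (inject₁ j) φ w ≡ T zero (suc j) (φ ∘ Φ) (b ∷ v)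
    inner j rewrite lookup-∷ʳ-inject₁ v (suc b) j | lookup-∷ʳ-last v (suc b) | ε-last (inject₁ j) =
        trans (cong₂ _-_ (pre-head f (suc b)) (pre-head f q))
        (trans (cong₂ _-_ (cong (f 0 +_) (pre-cong (suc b) (λ l _ → same l))) (cong (f 0 +_) (pre-cong q (λ l _ → same l))))
          (lemma2 (f 0) (pre g (suc b)) (pre g q)))
      where
      q = lookup v j
      f = λ l → φ (put (fromℕ m) (inject₁ j) l (suc b ℕ.+ q ∸ l) w)
      g = λ l → φ ((v [ j ]≔ (b ℕ.+ q ∸ l)) ∷ʳ suc l)
      same : ∀ l → f (suc l) ≡ g l
      same l = cong φ (trans (cong (λ u → updateAt u (inject₁ j) (λ _ → b ℕ.+ q ∸ l)) (updateAt-∷ʳ-last v (suc b) (λ _ → suc l)))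
        (updateAt-∷ʳ-inject₁ v (suc l) j _))
      lemma2 : ∀ c x y → c + x - (c + y) ≡ x - y
      lemma2 = solve-∀ ring

-- Commutativity of the `Y k` and their joint eigenvectors

lookup-0v : ∀ {n} (k : Fin n) → lookup 0v k ≡ 0
lookup-0v k = VP.lookup-replicate k 0

sum-0v : ∀ {n} → V.sum (0v {n}) ≡ 0
sum-0v {zero} = refl
sum-0v {suc n} = sum-0v {n}

swap-0v : ∀ {m} (i : Fin m) → swap i 0v ≡ 0v
swap-0v {m} i = sum≡0 _ (trans (sum-swap i (0v {suc m})) (sum-0v {suc m}))

unit : ∀ {n} → Fin n → Comp n
unit k = updateAt 0v k suc

sum-dec : ∀ {n} (β : Comp n) k {a} → lookup β k ≡ suc a → suc (V.sum (updateAt β k ℕ.pred)) ≡ V.sum β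
sum-dec (suc b ∷ β) zero e = refl
sum-dec (b ∷ β) (suc k) e = trans (sym (NP.+-suc b _)) (cong (b ℕ.+_) (sum-dec β k e))

inc-dec : ∀ {n} (β : Comp n) k {a} → lookup β k ≡ suc a → updateAt (updateAt β k ℕ.pred) k suc ≡ β
inc-dec β k e = trans (VP.updateAt-updateAt k β) (VP.updateAt-id-local k β (subst (λ x → suc (ℕ.pred x) ≡ x) (sym e) refl))

dec-inc : ∀ {n} (β : Comp n) k → updateAt (updateAt β k suc) k ℕ.pred ≡ β
dec-inc β k = trans (VP.updateAt-updateAt k β) (VP.updateAt-id-local k β refl)

firstMax : ∀ {n} → Vec ℕ (suc n) → Fin (suc n)
firstMax (a ∷ []) = zero
firstMax (a ∷ b ∷ v) with lookup (b ∷ v) (firstMax (b ∷ v)) ℕ.≤? a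
... | yes _ = zero
... | no _ = suc (firstMax (b ∷ v))

-- Strict for the indices before the first maximum, weak for those after it. This is exactly what
-- makes every signed sum in `T k j` run upwards once entry `k` has been lowered by one.
firstMax-strict : ∀ {n} (v : Vec ℕ (suc n)) j → j ≢ firstMax v → ε (firstMax v) j ℕ.+ lookup v j ℕ.≤ lookup v (firstMax v)
firstMax-max : ∀ {n} (v : Vec ℕ (suc n)) j → lookup v j ℕ.≤ lookup v (firstMax v)
firstMax-strict (a ∷ []) zero j≢ = ⊥-elim (j≢ refl)
firstMax-strict (a ∷ b ∷ v) j j≢ with lookup (b ∷ v) (firstMax (b ∷ v)) ℕ.≤? a
firstMax-strict (a ∷ b ∷ v) zero j≢ | yes p = ⊥-elim (j≢ refl)
firstMax-strict (a ∷ b ∷ v) (suc j) j≢ | yes p = NP.≤-trans (firstMax-max (b ∷ v) j) p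
firstMax-strict (a ∷ b ∷ v) zero j≢ | no p = NP.≰⇒> p
firstMax-strict (a ∷ b ∷ v) (suc j) j≢ | no p = firstMax-strict (b ∷ v) j (j≢ ∘ cong suc)
firstMax-max v j with j FP.≟ firstMax v
... | yes e = NP.≤-reflexive (cong (lookup v) e)
... | no j≢ = NP.≤-trans (NP.m≤n+m _ (ε (firstMax v) j)) (firstMax-strict v j j≢)

-- The correction terms of two successive uses of `Y-swap` agree in either order; this is the
-- inductive step of commutativity under a transposition.
displ-exchange : ∀ {m} (s : Fin m) i k (y : Fin (suc m) → ℚ) A →
  A + displ s k * y (π s i) + displ s i * y k ≡ A + displ s i * y (π s k) + displ s k * y i
displ-exchange s i k y A with π-cases s i | π-cases s k
... | inj₂ (inj₂ (e , d)) | inj₂ (inj₂ (e' , d')) rewrite e | d | e' | d' = lem A (y i) (y k)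
  where
  lem : ∀ A a b → A + 0ℚ * a + 0ℚ * b ≡ A + 0ℚ * b + 0ℚ * a
  lem = solve-∀ ring
... | inj₁ refl | inj₁ refl = refl
... | inj₁ refl | inj₂ (inj₁ refl) rewrite π-inject₁ s | π-suc s | displ-inject₁ s | displ-suc s = lem A (y (inject₁ s)) (y (suc s))
  where
  lem : ∀ A a b → A + - 1ℚ * b + 1ℚ * b ≡ A + 1ℚ * a + - 1ℚ * a
  lem = solve-∀ ring
... | inj₁ refl | inj₂ (inj₂ (e' , d')) rewrite e' | d' = lem A (y (π s (inject₁ s))) (y (inject₁ s)) (displ s (inject₁ s) * y k)
  where
  lem : ∀ A a b c → A + 0ℚ * a + c ≡ A + c + 0ℚ * b
  lem = solve-∀ ring
... | inj₂ (inj₁ refl) | inj₁ refl rewrite π-inject₁ s | π-suc s | displ-inject₁ s | displ-suc s = lem A (y (inject₁ s)) (y (suc s))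
  where
  lem : ∀ A a b → A + 1ℚ * a + - 1ℚ * a ≡ A + - 1ℚ * b + 1ℚ * b
  lem = solve-∀ ring
... | inj₂ (inj₁ refl) | inj₂ (inj₁ refl) = refl
... | inj₂ (inj₁ refl) | inj₂ (inj₂ (e' , d')) rewrite e' | d' = lem A (y (π s (suc s))) (y (suc s)) (displ s (suc s) * y k)
  where
  lem : ∀ A a b c → A + 0ℚ * a + c ≡ A + c + 0ℚ * b
  lem = solve-∀ ring
... | inj₂ (inj₂ (e , d)) | inj₁ refl rewrite e | d = lem A (y (inject₁ s)) (y (π s (inject₁ s))) (displ s (inject₁ s) * y i)
  where
  lem : ∀ A a b c → A + c + 0ℚ * a ≡ A + 0ℚ * b + c
  lem = solve-∀ ring
... | inj₂ (inj₂ (e , d)) | inj₂ (inj₁ refl) rewrite e | d = lem A (y (suc s)) (y (π s (suc s))) (displ s (suc s) * y i)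
  where
  lem : ∀ A a b c → A + c + 0ℚ * a ≡ A + 0ℚ * b + c
  lem = solve-∀ ring

module _ (α : ℚ) where

  -- The number of indices after `k`, which is the eigenvalue of `ξ k` on constants.
  N : ∀ {n} → Fin n → ℚ
  N k = sum (λ j → 1ℚ - ι (ε k j))

  ξ-0v : ∀ {n} (k : Fin n) φ → ξ α k φ 0v ≡ N k * φ 0v
  ξ-0v {n} k φ = trans (cong₂ _+_ (cong (λ x → α * ι x * φ 0v) (lookup-0v k)) (trans (sum-cong-≗ pointwise) (sum-*ʳ (λ j → 1ℚ - ι (ε k j)) (φ 0v))))
    (lemma α (φ 0v) (N k * φ 0v))
    where
    lemma : ∀ a f s → a * 0ℚ * f + s ≡ s
    lemma = solve-∀ ring
    pointwise : ∀ j → T k j φ 0v ≡ (1ℚ - ι (ε k j)) * φ 0v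
    pointwise j rewrite lookup-0v k | lookup-0v j = trans (pre-shift f 0 (ε-01 k j) (inj₂ refl))
        (cong ((1ℚ - ι (ε k j)) *_) (cong φ (sum≡0 _ (sum-f))))
      where
      f = λ l → φ (put k j l (0 ∸ l) 0v)
      z : ∀ {n} (β : Comp n) i → β ≡ 0v → β [ i ]≔ 0 ≡ 0v
      z β i refl = trans (cong (0v [ i ]≔_) (sym (lookup-0v i))) (VP.[]≔-lookup 0v i)
      sum-f : V.sum (put k j 0 0 0v) ≡ 0
      sum-f = trans (cong V.sum (z _ j (z 0v k refl))) (sum-0v {n})

  -- Pairs of `k` with `j` other than `i` see two zero exponents and act as on constants. Only the
  -- pair with `i` can exchange the variable, and it does so for `i < k`.
  ξ-unit : ∀ {m} (k i : Fin (suc m)) → k ≢ i → ∀ φ →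
    ξ α k φ (unit i) ≡ (N k - (1ℚ - ι (ε k i))) * φ (unit i) - ι (ε k i) * φ (unit k)
  ξ-unit k i k≢i φ = trans (cong₂ _+_ (cong (λ x → α * ι x * φ (unit i)) (unit-off k k≢i)) sums)
      (trans (cong (λ x → α * 0ℚ * φ (unit i) + (- ι (ε k i) * φ (unit k) + x)) (sum-*ʳ (λ j → 1ℚ - ι (ε k (F.punchIn i j))) (φ (unit i))))
      (trans (lemma α (φ (unit i)) (ι (ε k i)) (φ (unit k)) (sum (λ j → 1ℚ - ι (ε k (F.punchIn i j)))))
        (cong (λ x → (x - (1ℚ - ι (ε k i))) * φ (unit i) - ι (ε k i) * φ (unit k)) (sym (sum-punchIn (λ j → 1ℚ - ι (ε k j)) i)))))
    where
    lemma : ∀ a f e g s → a * 0ℚ * f + (- e * g + s * f) ≡ (1ℚ - e + s - (1ℚ - e)) * f - e * g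
    lemma = solve-∀ ring
    unit-off : ∀ j → j ≢ i → lookup (unit i) j ≡ 0
    unit-off j j≢i = trans (VP.lookup∘updateAt′ j i j≢i 0v) (lookup-0v j)
    unit-on : lookup (unit i) i ≡ 1
    unit-on = trans (VP.lookup∘updateAt i 0v) (cong suc (lookup-0v i))
    at-i : T k i φ (unit i) ≡ - ι (ε k i) * φ (unit k)
    at-i rewrite unit-off k k≢i | unit-on = trans (pre-shift f 1 (ε-01 k i) (inj₁ refl))
        (trans (cong ((0ℚ - ι (ε k i)) *_) (cong φ (vec-ext pw))) (cong (_* φ (unit k)) (QP.+-identityˡ (- ι (ε k i)))))
      where
      f = λ l → φ (put k i l (1 ∸ l) (unit i))
      pw : ∀ l → lookup (put k i 1 0 (unit i)) l ≡ lookup (unit k) l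
      pw l with i FP.≟ l | k FP.≟ l
      ... | yes refl | _ = trans (VP.lookup∘update i (unit i [ k ]≔ 1) 0) (sym (trans (VP.lookup∘updateAt′ i k (k≢i ∘ sym) 0v) (lookup-0v i)))
      ... | no i≢l | yes refl = trans (VP.lookup∘update′ (i≢l ∘ sym) (unit i [ k ]≔ 1) 0) (trans (VP.lookup∘update k (unit i) 1)
              (sym (trans (VP.lookup∘updateAt k 0v) (cong suc (lookup-0v k)))))
      ... | no i≢l | no k≢l = trans (VP.lookup∘update′ (i≢l ∘ sym) (unit i [ k ]≔ 1) 0) (trans (VP.lookup∘update′ (k≢l ∘ sym) (unit i) 1)
              (trans (VP.lookup∘updateAt′ l i (i≢l ∘ sym) 0v) (sym (VP.lookup∘updateAt′ l k (k≢l ∘ sym) 0v))))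
    off-i : ∀ j → j ≢ i → T k j φ (unit i) ≡ (1ℚ - ι (ε k j)) * φ (unit i)
    off-i j j≢i rewrite unit-off k k≢i | unit-off j j≢i = trans (pre-shift f 0 (ε-01 k j) (inj₂ refl))
        (cong ((1ℚ - ι (ε k j)) *_) (cong φ (trans (cong (_[ j ]≔ 0) (z (unit i) k (unit-off k k≢i))) (z (unit i) j (unit-off j j≢i)))))
      where
      f = λ l → φ (put k j l (0 ∸ l) (unit i))
      z : ∀ {n} (β : Comp n) i → lookup β i ≡ 0 → β [ i ]≔ 0 ≡ β
      z β i e = trans (cong (β [ i ]≔_) (sym e)) (VP.[]≔-lookup β i)
    sums : sum (λ j → T k j φ (unit i)) ≡ - ι (ε k i) * φ (unit k) + sum (λ j → (1ℚ - ι (ε k (F.punchIn i j))) * φ (unit i))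
    sums = trans (sum-punchIn (λ j → T k j φ (unit i)) i)
      (cong₂ _+_ at-i (sum-cong-≗ (λ j → off-i (F.punchIn i j) (FP.punchInᵢ≢i i j))))

  -- The commutators are conjugated into one another by the transpositions and Φ, so it suffices
  -- to evaluate them at 0.
  Y-comm : ∀ {m} (i k : Fin (suc m)) φ β → Y α i (Y α k φ) β ≡ Y α k (Y α i φ) β
  Y-comm {m} i k φ β = comp-ind (λ β → ∀ i k φ → Y α i (Y α k φ) β ≡ Y α k (Y α i φ) β) base by-swap by-Φ β i k φ
    where
    base : ∀ i k φ → Y α i (Y α k φ) 0v ≡ Y α k (Y α i φ) 0v
    base i k φ with i FP.≟ k
    ... | yes refl = refl
    ... | no i≢k = trans (expand i k i≢k) (trans (cong₂ (λ e A → A + ((N k - (1ℚ - e)) * φ (unit i) - e * φ (unit k)) + N i * (φ (unit k) + N k * φ 0v))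
            ε-flip (cong φ (VP.updateAt-commutes k i (i≢k ∘ sym) 0v)))
          (trans (lemma (φ (updateAt (unit k) i suc)) (N i) (N k) (ι (ε i k)) (φ (unit i)) (φ (unit k)) (φ 0v)) (sym (expand k i (i≢k ∘ sym)))))
      where
      expand : ∀ i k → i ≢ k → Y α i (Y α k φ) 0v ≡
        φ (updateAt (unit i) k suc) + ((N k - (1ℚ - ι (ε k i))) * φ (unit i) - ι (ε k i) * φ (unit k)) + N i * (φ (unit k) + N k * φ 0v)
      expand i k i≢k = cong₂ _+_ (cong (φ (updateAt (unit i) k suc) +_) (ξ-unit k i (i≢k ∘ sym) φ))
        (trans (ξ-0v i (Y α k φ)) (cong (λ x → N i * (φ (unit k) + x)) (ξ-0v k φ)))
      lemma : ∀ A Ni Nk e x y c → A + ((Nk - (1ℚ - (1ℚ - e))) * x - (1ℚ - e) * y) + Ni * (y + Nk * c)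
                                ≡ A + ((Ni - (1ℚ - e)) * y - e * x) + Nk * (x + Ni * c)
      lemma = solve-∀ ring
      ε-flip : ι (ε k i) ≡ 1ℚ - ι (ε i k)
      ε-flip = trans (lem (ι (ε k i)) (ι (ε i k))) (cong (_- ι (ε i k)) (trans (sym (ι-+ (ε i k) (ε k i))) (cong ι (ε-antisym i k i≢k))))
        where
        lem : ∀ a b → a ≡ b + a - b
        lem = solve-∀ ring
    by-swap : ∀ s β → (∀ i k φ → Y α i (Y α k φ) β ≡ Y α k (Y α i φ) β) → ∀ i k φ → Y α i (Y α k φ) (swap s β) ≡ Y α k (Y α i φ) (swap s β)
    by-swap s β IH i k φ = trans (expand i k) (trans (cong (_+ displ s i * Y α k φ β)
        (cong (_+ displ s k * Y α (π s i) φ β) (IH (π s i) (π s k) (φ ∘ swap s))))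
        (trans (displ-exchange s i k (λ j → Y α j φ β) (Y α (π s k) (Y α (π s i) (φ ∘ swap s)) β)) (sym (expand k i))))
      where
      expand : ∀ i k → Y α i (Y α k φ) (swap s β) ≡
        Y α (π s i) (Y α (π s k) (φ ∘ swap s)) β + displ s k * Y α (π s i) φ β + displ s i * Y α k φ β
      expand i k = trans (Y-swap α s i (Y α k φ) β) (cong (_+ displ s i * Y α k φ β)
        (trans (Y-cong α (π s i) (λ β → Y-swap α s k φ β) β) (Y-linear α (π s i) (Y α (π s k) (φ ∘ swap s)) φ (displ s k) β)))
    -- Both relations with `Φ` in one form: the constant is `α` at the last index and 0 elsewhere.
    rotate : ∀ k → Σ (Fin (suc m)) λ k' → Σ ℚ λ c → ∀ φ β → Y α k φ (Φ β) ≡ Y α k' (φ ∘ Φ) β + c * φ (Φ β)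
    rotate = >-weakInduction _ (zero , α , Y-Φ-last α) (λ i _ → suc i , 0ℚ , λ φ β → trans (Y-Φ-inject₁ α i φ β) (lem (Y α (suc i) (φ ∘ Φ) β) (φ (Φ β))))
      where
      lem : ∀ a b → a ≡ a + 0ℚ * b
      lem = solve-∀ ring
    by-Φ : ∀ β → (∀ i k φ → Y α i (Y α k φ) β ≡ Y α k (Y α i φ) β) → ∀ i k φ → Y α i (Y α k φ) (Φ β) ≡ Y α k (Y α i φ) (Φ β)
    by-Φ β IH i k φ = trans (expand i k) (trans
        (cong (λ x → x + c k * Y α (rot i) (φ ∘ Φ) β + c i * (Y α (rot k) (φ ∘ Φ) β + c k * φ (Φ β))) (IH (rot i) (rot k) (φ ∘ Φ)))
        (trans (lem (Y α (rot k) (Y α (rot i) (φ ∘ Φ)) β) (Y α (rot i) (φ ∘ Φ) β) (Y α (rot k) (φ ∘ Φ) β) (c i) (c k) (φ (Φ β))) (sym (expand k i))))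
      where
      rot : Fin (suc m) → Fin (suc m)
      rot k = proj₁ (rotate k)
      c : Fin (suc m) → ℚ
      c k = proj₁ (proj₂ (rotate k))
      expand : ∀ i k → Y α i (Y α k φ) (Φ β) ≡ Y α (rot i) (Y α (rot k) (φ ∘ Φ)) β + c k * Y α (rot i) (φ ∘ Φ) β + c i * (Y α (rot k) (φ ∘ Φ) β + c k * φ (Φ β))
      expand i k = trans (proj₂ (proj₂ (rotate i)) (Y α k φ) β) (cong₂ _+_
        (trans (Y-cong α (rot i) (λ β → proj₂ (proj₂ (rotate k)) φ β) β) (Y-linear α (rot i) (Y α (rot k) (φ ∘ Φ)) (φ ∘ Φ) (c k) β))
        (cong (c i *_) (proj₂ (proj₂ (rotate k)) φ β)))
      lem : ∀ A x y c d f → A + d * x + c * (y + d * f) ≡ A + c * y + d * (x + c * f)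
      lem = solve-∀ ring

  -- E z β is the value at z of the bar monomial with exponent β.
  E-go : ∀ {m} → Vec ℚ (suc m) → ℕ → Comp (suc m) → ℚ
  E-go z zero β = 1ℚ
  E-go z (suc d) β = lookup z (firstMax β) * E-go z d (updateAt β (firstMax β) ℕ.pred) - ξ α (firstMax β) (E-go z d) (updateAt β (firstMax β) ℕ.pred)

  E : ∀ {m} → Vec ℚ (suc m) → Comp (suc m) → ℚ
  E z β = E-go z (V.sum β) β

  E-0v : ∀ {m} (z : Vec ℚ (suc m)) → E z 0v ≡ 1ℚ
  E-0v {m} z = cong (λ d → E-go z d 0v) (sum-0v {suc m})

  firstMax-positive : ∀ {m} (β : Comp (suc m)) {d} → V.sum β ≡ suc d → Σ ℕ λ a → lookup β (firstMax β) ≡ suc a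
  firstMax-positive β h with nonzero-index β h
  ... | k , a , e with lookup β (firstMax β) | firstMax-max β k
  ... | zero | le = ⊥-elim (NP.1+n≰n (NP.≤-trans (s≤s z≤n) (subst (ℕ._≤ 0) e le)))
  ... | suc b | _ = b , refl

  E-step : ∀ {m} (z : Vec ℚ (suc m)) β {d} → V.sum β ≡ suc d →
    E z β ≡ lookup z (firstMax β) * E z (updateAt β (firstMax β) ℕ.pred) - ξ α (firstMax β) (E z) (updateAt β (firstMax β) ℕ.pred)
  E-step {m} z β {d} h = trans (cong (λ d → E-go z d β) h) (cong₂ (λ x y → lookup z k * x - y)
      (same η sum-η) (ξ-degree α k η (λ ν e → same ν (trans e sum-η))))
    where
    k = firstMax β
    η = updateAt β k ℕ.pred
    sum-η : V.sum η ≡ d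
    sum-η = NP.suc-injective (trans (sum-dec β k (proj₂ (firstMax-positive β h))) h)
    same : ∀ ν → V.sum ν ≡ d → E-go z d ν ≡ E z ν
    same ν e = cong (λ d → E-go z d ν) (sym e)

  ξ-scaled : ∀ {m} (k : Fin (suc m)) φ χ c η → (∀ ν → V.sum ν ≡ V.sum η → φ ν ≡ c * χ ν) → ξ α k φ η ≡ c * ξ α k χ η
  ξ-scaled k φ χ c η h = trans (ξ-degree α k η (λ ν e → trans (h ν e) (lem c (χ ν))))
      (trans (ξ-linear α k χ χ (c - 1ℚ) η) (sym (lem c (ξ α k χ η))))
    where
    lem : ∀ c x → c * x ≡ x + (c - 1ℚ) * x
    lem = solve-∀ ring

  -- The recursion defining E is the eigenvalue equation for the first maximum of a composition;
  -- commutativity of the Y i extends it to the other indices.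
  E-eigen : ∀ {m} (z : Vec ℚ (suc m)) i η → Y α i (E z) η ≡ lookup z i * E z η
  E-eigen {m} z i η = go (V.sum η) η refl i
    where
    at-firstMax : ∀ η i → i ≡ firstMax (updateAt η i suc) → Y α i (E z) η ≡ lookup z i * E z η
    at-firstMax η i e = trans (cong (_+ ξ α i (E z) η) (trans (E-step z β (sum-updateAt η i))
        (cong₂ (λ k η → lookup z k * E z η - ξ α k (E z) η) (sym e)
          (trans (cong (λ k → updateAt β k ℕ.pred) (sym e)) (dec-inc η i)))))
        (lem (lookup z i * E z η) (ξ α i (E z) η))
      where
      β = updateAt η i suc
      lem : ∀ a b → a - b + b ≡ a
      lem = solve-∀ ring
    go : ∀ d η → V.sum η ≡ d → ∀ i → Y α i (E z) η ≡ lookup z i * E z η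
    go d η h i with i FP.≟ firstMax (updateAt η i suc)
    ... | yes e = at-firstMax η i e
    ... | no i≢k = descend d h
      where
      β = updateAt η i suc
      k = firstMax β
      ηk : Σ ℕ λ a → lookup η k ≡ suc a
      ηk with firstMax-positive β (sum-updateAt η i)
      ... | a , e = a , trans (sym (VP.lookup∘updateAt′ k i (i≢k ∘ sym) η)) e
      θ = updateAt η k ℕ.pred
      θk : updateAt θ k suc ≡ η
      θk = inc-dec η k (proj₂ ηk)
      θi = updateAt θ i suc
      θik : updateAt θi k suc ≡ β
      θik = trans (VP.updateAt-commutes k i (i≢k ∘ sym) θ) (cong (λ u → updateAt u i suc) θk)
      sum-θ : suc (V.sum θ) ≡ V.sum η
      sum-θ = sum-dec η k (proj₂ ηk)
      -- Compare the two orders of `Y α i` and `Y α k` at `θ`, where `η` is `θ` raised at `k`. The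
      -- induction hypothesis covers degree `d`, and the defining recursion covers index `k` at
      -- `θi`; the only unknown left is the value at `η`.
      descend : ∀ d → V.sum η ≡ d → Y α i (E z) η ≡ lookup z i * E z η
      descend zero h with () ← trans sum-θ h
      descend (suc d) h = solve-for (Y α i (E z) η) (E z η) (E z θ) (E z θi) (ξ α i (E z) θ) (ξ α k (E z) θ) (lookup z i) (lookup z k)
          (trans (sym left) (trans (Y-comm k i (E z) θ) right)) (IH θ refl i)
          (trans (cong (_+ ξ α k (E z) θ) (cong (E z) (sym θk))) (IH θ refl k))
        where
        IH : ∀ ν → V.sum ν ≡ V.sum θ → ∀ i → Y α i (E z) ν ≡ lookup z i * E z ν
        IH ν e = go d ν (trans e (NP.suc-injective (trans sum-θ h)))
        left : Y α k (Y α i (E z)) θ ≡ Y α i (E z) η + lookup z i * ξ α k (E z) θ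
        left = cong₂ _+_ (cong (Y α i (E z)) θk) (ξ-scaled k (Y α i (E z)) (E z) (lookup z i) θ (λ ν e → IH ν e i))
        right : Y α i (Y α k (E z)) θ ≡ lookup z k * E z θi + lookup z k * ξ α i (E z) θ
        right = cong₂ _+_ (at-firstMax θi k (sym (cong firstMax θik))) (ξ-scaled i (Y α k (E z)) (E z) (lookup z k) θ (λ ν e → IH ν e k))
        solve-for : ∀ y η θ θi ξi ξk zi zk → y + zi * ξk ≡ zk * θi + zk * ξi → θi + ξi ≡ zi * θ → η + ξk ≡ zk * θ → y ≡ zi * η
        solve-for y η θ θi ξi ξk zi zk h1 h2 h3 = trans (+-sub y (zi * ξk)) (trans (cong (_- zi * ξk) (trans h1 (trans (sym (QP.*-distribˡ-+ zk θi ξi))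
            (trans (cong (zk *_) h2) (trans (*-left-comm zk zi θ) (cong (zi *_) (sym h3))))))) (l3 zi η ξk))
          where
          l3 : ∀ a b c → a * (b + c) - a * c ≡ a * b
          l3 = solve-∀ ring

  -- A nonzero exponent is some `η` raised at `k`, and the eigenvalue equation for `k` at `η`
  -- expresses `χ` there by values in lower degree. Joint eigenspaces are thus at most
  -- one-dimensional.
  E-unique : ∀ {m} (z : Vec ℚ (suc m)) χ → (∀ i η → Y α i χ η ≡ lookup z i * χ η) → ∀ β → χ β ≡ χ 0v * E z β
  E-unique {m} z χ eig β = go (V.sum β) β refl
    where
    go : ∀ d β → V.sum β ≡ d → χ β ≡ χ 0v * E z β
    go zero β h rewrite sum≡0 β h | E-0v z = sym (QP.*-identityʳ (χ 0v))
    go (suc d) β h = trans (cong χ (sym inc)) (trans (+-sub (χ (updateAt η k suc)) (ξ α k χ η)) (trans (cong₂ _-_ (trans (eig k η) (cong (lookup z k *_) (go d η sum-η)))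
        (ξ-scaled k χ (E z) (χ 0v) η (λ ν e → go d ν (trans e sum-η))))
        (trans (lem₂ (lookup z k) (χ 0v) (E z η) (ξ α k (E z) η)) (cong (χ 0v *_) (sym (E-step z β h))))))
      where
      k = firstMax β
      η = updateAt β k ℕ.pred
      inc : updateAt η k suc ≡ β
      inc = inc-dec β k (proj₂ (firstMax-positive β h))
      sum-η : V.sum η ≡ d
      sum-η = NP.suc-injective (trans (sum-dec β k (proj₂ (firstMax-positive β h))) h)
      lem₂ : ∀ a b c d → a * (b * c) - b * d ≡ b * (a * c - d)
      lem₂ = solve-∀ ring

  -- By `Y-swap` the functional `E z ∘ swap s` is an eigenvector for `swap s z` up to multiples of
  -- `E z`. Subtracting `u` times `E z` removes them, and the result has value `1 - u` at `0v`.
  E-swap : ∀ {m} (s : Fin m) (z : Vec ℚ (suc m)) u → u * (lookup z (inject₁ s) - lookup z (suc s)) ≡ 1ℚ →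
    ∀ β → E z (swap s β) ≡ u * E z β + (1ℚ - u) * E (swap s z) β
  E-swap {m} s z u hu β = trans (lem₁ (E z (swap s β)) (- u * E z β) (u * E z β) (lem₀ u (E z β)))
      (cong (u * E z β +_) (trans (E-unique (swap s z) χ eig β) (cong (_* E (swap s z) β) χ0)))
    where
    χ : Comp (suc m) → ℚ
    χ β = E z (swap s β) + - u * E z β
    lem₀ : ∀ u e → - u * e ≡ - (u * e)
    lem₀ = solve-∀ ring
    lem₁ : ∀ a b c → b ≡ - c → a ≡ c + (a + b)
    lem₁ a b c refl = lem a c
      where
      lem : ∀ a c → a ≡ c + (a + - c)
      lem = solve-∀ ring
    χ0 : χ 0v ≡ 1ℚ - u
    χ0 = trans (cong₂ (λ x y → x + - u * y) (trans (cong (E z) (swap-0v s)) (E-0v z)) (E-0v z)) (lem u)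
      where
      lem : ∀ u → 1ℚ + - u * 1ℚ ≡ 1ℚ - u
      lem = solve-∀ ring
    u-displ : ∀ k → u * (lookup z (π s k) - lookup z k) ≡ displ s (π s k)
    u-displ k with π-cases s k
    ... | inj₁ refl rewrite π-inject₁ s | displ-suc s = trans (lem u (lookup z (inject₁ s)) (lookup z (suc s))) (cong -_ hu)
      where
      lem : ∀ u a b → u * (b - a) ≡ - (u * (a - b))
      lem = solve-∀ ring
    ... | inj₂ (inj₁ refl) rewrite π-suc s | displ-inject₁ s = hu
    ... | inj₂ (inj₂ (e , d)) rewrite e | d = lem u (lookup z k)
      where
      lem : ∀ u a → u * (a - a) ≡ 0ℚ
      lem = solve-∀ ring
    eig : ∀ k η → Y α k χ η ≡ lookup (swap s z) k * χ η
    eig k η = trans (Y-linear α k (E z ∘ swap s) (E z) (- u) η) (trans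
        (cong₂ (λ x y → x + - u * y) shifted (E-eigen z k η))
        (trans (lem (lookup z (π s k)) (E z (swap s η)) (E z η) u (lookup z k) (displ s (π s k)))
          (trans (cong (λ d → lookup z (π s k) * χ η + (u * (lookup z (π s k) - lookup z k) - d) * E z η) (sym (u-displ k)))
          (trans (lem₃ (lookup z (π s k) * χ η) (u * (lookup z (π s k) - lookup z k)) (E z η)) (cong (_* χ η) (sym (lookup-swap s z k)))))))
      where
      shifted : Y α k (E z ∘ swap s) η ≡ lookup z (π s k) * E z (swap s η) - displ s (π s k) * E z η
      shifted = trans (+-sub (Y α k (E z ∘ swap s) η) (displ s (π s k) * E z η)) (cong (_- displ s (π s k) * E z η)
        (trans (sym (trans (Y-swap α s (π s k) (E z) η) (cong (λ k → Y α k (E z ∘ swap s) η + displ s (π s k₀) * E z η) (π-involutive s k))))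
          (E-eigen z (π s k) (swap s η))))
        where
        k₀ = k
      lem : ∀ zp es e u zk d → zp * es - d * e + - u * (zk * e) ≡ zp * (es + - u * e) + (u * (zp - zk) - d) * e
      lem = solve-∀ ring
      lem₃ : ∀ a b e → a + (b - b) * e ≡ a
      lem₃ = solve-∀ ring

  unit-last : ∀ {m} → Φ (0v {suc m}) ≡ unit (fromℕ m)
  unit-last {zero} = refl
  unit-last {suc m} = cong (0 ∷_) (unit-last {m})

  -- `E (z ∷ʳ x) ∘ Φ` is a joint eigenvector for the rotated point. Its value at `0v` is that on the
  -- last variable, namely `x`, because the last Cherednik operator kills constants.
  E-Φ : ∀ {m} (z : Vec ℚ m) x β → E (z ∷ʳ x) (Φ β) ≡ x * E ((x - α) ∷ z) β
  E-Φ {m} z x β = trans (E-unique ((x - α) ∷ z) (E w ∘ Φ) eig β) (cong (_* E ((x - α) ∷ z) β) at-0)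
    where
    w = z ∷ʳ x
    at-0 : E w (Φ 0v) ≡ x
    at-0 = trans (cong (E w) (unit-last {m})) (trans (+-sub (E w (unit (fromℕ m))) (ξ α (fromℕ m) (E w) 0v))
      (trans (cong₂ _-_ (trans (E-eigen w (fromℕ m) 0v) (cong₂ _*_ (lookup-∷ʳ-last z x) (E-0v w)))
        (trans (ξ-0v (fromℕ m) (E w)) (cong (_* E w 0v) (sum-0 (λ j → 1ℚ - ι (ε (fromℕ m) j)) (λ j → cong (λ e → 1ℚ - ι e) (ε-last j))))))
        (lem₂ x (E w 0v))))
      where
      lem₂ : ∀ x y → x * 1ℚ - 0ℚ * y ≡ x
      lem₂ = solve-∀ ring
    eig : ∀ i η → Y α i (E w ∘ Φ) η ≡ lookup ((x - α) ∷ z) i * E w (Φ η)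
    eig zero η = trans (+-sub (Y α zero (E w ∘ Φ) η) (α * E w (Φ η))) (trans (cong (_- α * E w (Φ η))
        (trans (sym (Y-Φ-last α (E w) η)) (trans (E-eigen w (fromℕ m) (Φ η)) (cong (_* E w (Φ η)) (lookup-∷ʳ-last z x)))))
        (lem₂ x α (E w (Φ η))))
      where
      lem₂ : ∀ x a e → x * e - a * e ≡ (x - a) * e
      lem₂ = solve-∀ ring
    eig (suc i) η = trans (sym (Y-Φ-inject₁ α i (E w) η)) (trans (E-eigen w (inject₁ i) (Φ η)) (cong (_* E w (Φ η)) (lookup-∷ʳ-inject₁ z x i)))

-- Ranks of the entries of a composition

ind : ℕ → ℕ → ℕ
ind a b = if a ℕ.≤ᵇ b then 1 else 0

ind-yes : ∀ {a b} → a ℕ.≤ b → ind a b ≡ 1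
ind-yes {a} {b} h with a ℕ.≤ᵇ b | NP.≤⇒≤ᵇ h
... | true | _ = refl

ind-no : ∀ {a b} → b ℕ.< a → ind a b ≡ 0
ind-no {a} {b} h with a ℕ.≤ᵇ b in eq
... | false = refl
... | true = ⊥-elim (NP.<⇒≱ h (NP.≤ᵇ⇒≤ a b (subst Bool.T (sym eq) _)))

ind-suc : ∀ a b → ind (suc a) (suc b) ≡ ind a b
ind-suc zero b = refl
ind-suc (suc a) b = refl

ind-≢ : ∀ {e x y} → e ≡ 0 ⊎ e ≡ 1 → x ≢ y → ind (e ℕ.+ x) y ≡ ind x y
ind-≢ (inj₁ refl) x≢y = refl
ind-≢ {x = x} {y} (inj₂ refl) x≢y with x ℕ.≤? y
... | yes x≤y = trans (ind-yes (NP.≤∧≢⇒< x≤y x≢y)) (sym (ind-yes x≤y))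
... | no x≰y = trans (ind-no (NP.m≤n⇒m≤1+n (NP.≰⇒> x≰y))) (sym (ind-no (NP.≰⇒> x≰y)))

ind-diag : ∀ {e} x → e ≡ 0 ⊎ e ≡ 1 → ι (ind (e ℕ.+ x) x) ≡ 1ℚ - ι e
ind-diag x (inj₁ refl) rewrite ind-yes (NP.≤-refl {x}) = refl
ind-diag x (inj₂ refl) rewrite ind-no (NP.≤-refl {suc x}) = refl

ι-nonneg : ∀ n → 0ℚ ℚ.≤ ι n
ι-nonneg zero = QP.≤-refl
ι-nonneg (suc n) = QP.≤-trans (QP.nonNegative⁻¹ 1ℚ) (QP.≤-trans (QP.≤-reflexive (sym (QP.+-identityʳ 1ℚ))) (QP.+-monoʳ-≤ 1ℚ (ι-nonneg n)))

sum-mono : ∀ {n} (f g : Fin n → ℚ) → (∀ i → f i ℚ.≤ g i) → sum f ℚ.≤ sum g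
sum-mono {zero} f g h = QP.≤-refl
sum-mono {suc n} f g h = QP.+-mono-≤ (h zero) (sum-mono (f ∘ suc) (g ∘ suc) (h ∘ suc))

-- The number of indices that follow `i` when `γ` is stably sorted into a partition, hence the entry
-- of `w_γ(δ)` at `i`; see `δ-sortPos`.
ρ : ∀ {n} → Comp n → Fin n → ℚ
ρ γ i = sum (λ k → ι (ind (ε i k ℕ.+ lookup γ k) (lookup γ i)))

ρ-nonneg : ∀ {n} (γ : Comp n) i → 0ℚ ℚ.≤ ρ γ i
ρ-nonneg {n} γ i = QP.≤-trans (QP.≤-reflexive (sym (sum-0 {n} (λ _ → 0ℚ) (λ _ → refl))))
  (sum-mono (λ _ → 0ℚ) (λ k → ι (ind (ε i k ℕ.+ lookup γ k) (lookup γ i))) (λ k → ι-nonneg (ind (ε i k ℕ.+ lookup γ k) (lookup γ i))))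

ρ-mono : ∀ {n} (γ : Comp n) i j → lookup γ j ℕ.< lookup γ i → ρ γ j ℚ.≤ ρ γ i
ρ-mono γ i j h = sum-mono (λ k → ι (ind (ε j k ℕ.+ lookup γ k) (lookup γ j))) (λ k → ι (ind (ε i k ℕ.+ lookup γ k) (lookup γ i))) pointwise
  where
  ε≤1 : ∀ {e} → e ≡ 0 ⊎ e ≡ 1 → e ℕ.≤ 1
  ε≤1 (inj₁ refl) = z≤n
  ε≤1 (inj₂ refl) = s≤s z≤n
  also : ∀ k → ε j k ℕ.+ lookup γ k ℕ.≤ lookup γ j → ε i k ℕ.+ lookup γ k ℕ.≤ lookup γ i
  also k le = NP.≤-trans (NP.+-mono-≤ (ε≤1 (ε-01 i k)) (NP.≤-trans (NP.m≤n+m _ (ε j k)) le)) h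
  pointwise : ∀ k → ι (ind (ε j k ℕ.+ lookup γ k) (lookup γ j)) ℚ.≤ ι (ind (ε i k ℕ.+ lookup γ k) (lookup γ i))
  pointwise k with (ε j k ℕ.+ lookup γ k) ℕ.≤? lookup γ j
  ... | no ≰ rewrite ind-no (NP.≰⇒> ≰) = ι-nonneg (ind (ε i k ℕ.+ lookup γ k) (lookup γ i))
  ... | yes le rewrite ind-yes le | ind-yes (also k le) = QP.≤-refl

exchanged : ∀ {A : Set} {m} (s : Fin m) {j k} → π s j ≡ k → j ≢ k → (f : Fin (suc m) → A) → f (inject₁ s) ≢ f (suc s) → f j ≢ f k
exchanged s {j} refl j≢k f f≢ with π-cases s j
... | inj₁ refl rewrite π-inject₁ s = f≢
... | inj₂ (inj₁ refl) rewrite π-suc s = f≢ ∘ sym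
... | inj₂ (inj₂ (e , _)) = ⊥-elim (j≢k (sym e))

-- `ε` changes only between the two exchanged entries, and as these differ, a strict and a weak
-- comparison of them agree.
ρ-swap : ∀ {m} (s : Fin m) γ → lookup γ (inject₁ s) ≢ lookup γ (suc s) → ∀ j → ρ (swap s γ) j ≡ ρ γ (π s j)
ρ-swap s γ γ≢ j = trans (sum-cong-≗ (λ k → cong ι (pointwise k))) (sum-π s (λ k → ι (ind (ε (π s j) k ℕ.+ lookup γ k) (lookup γ (π s j)))))
  where
  pointwise : ∀ k → ind (ε j k ℕ.+ lookup (swap s γ) k) (lookup (swap s γ) j) ≡ ind (ε (π s j) (π s k) ℕ.+ lookup γ (π s k)) (lookup γ (π s j))
  pointwise k rewrite lookup-swap s γ k | lookup-swap s γ j with ε-π s j k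
  ... | inj₁ e rewrite e = refl
  ... | inj₂ (πj , πk , j≢k) = trans (ind-≢ (ε-01 j k) ne) (sym (ind-≢ (ε-01 (π s j) (π s k)) ne))
    where
    ne : lookup γ (π s k) ≢ lookup γ (π s j)
    ne rewrite πj | πk = exchanged s πj j≢k (lookup γ) γ≢

-- Among equal entries the order of the indices decides, so the earlier one has one more index after
-- it. The summands differ by `κ`, whose row sum is known.
ρ-tie : ∀ {m} (s : Fin m) γ → lookup γ (inject₁ s) ≡ lookup γ (suc s) → ρ γ (inject₁ s) ≡ 1ℚ + ρ γ (suc s)
ρ-tie s γ tie = trans (trans (sym (sum-π s f)) (l (sum (f ∘ π s)) (sum g))) (cong (_+ ρ γ (suc s))
    (trans (sym (sum-difference (f ∘ π s) g)) (trans (sum-cong-≗ pointwise) (trans (sum-*ʳ (κ s (suc s)) (- 1ℚ))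
      (trans (cong (_* - 1ℚ) (trans (sum-κ s (suc s)) (displ-suc s))) refl)))))
  where
  f g : Fin _ → ℚ
  f k = ι (ind (ε (inject₁ s) k ℕ.+ lookup γ k) (lookup γ (inject₁ s)))
  g k = ι (ind (ε (suc s) k ℕ.+ lookup γ k) (lookup γ (suc s)))
  l : ∀ a b → a ≡ a - b + b
  l = solve-∀ ring
  swap-tie : ∀ k → lookup γ (π s k) ≡ lookup γ k
  swap-tie k with π-cases s k
  ... | inj₁ refl = trans (cong (lookup γ) (π-inject₁ s)) (sym tie)
  ... | inj₂ (inj₁ refl) = trans (cong (lookup γ) (π-suc s)) tie
  ... | inj₂ (inj₂ (e , _)) = cong (lookup γ) e
  pointwise : ∀ k → f (π s k) - g k ≡ κ s (suc s) k * - 1ℚ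
  pointwise k = trans (cong₂ (λ i x → ι (ind (ε i (π s k) ℕ.+ x) (lookup γ (inject₁ s))) - g k) (sym (π-suc s)) (swap-tie k))
    (trans (cong (λ x → ι (ind (ε (π s (suc s)) (π s k) ℕ.+ lookup γ k) x) - g k) tie) rest)
    where
    rest : ι (ind (ε (π s (suc s)) (π s k) ℕ.+ lookup γ k) (lookup γ (suc s))) - g k ≡ κ s (suc s) k * - 1ℚ
    rest with ε-π s (suc s) k
    ... | inj₁ e rewrite e = l₁ (g k) (ι (ε (suc s) k))
      where
      l₁ : ∀ a b → a - a ≡ (b - b) * - 1ℚ
      l₁ = solve-∀ ring
    ... | inj₂ (e , e' , _) = trans (cong (λ x → ι (ind (ε (π s (suc s)) (π s k) ℕ.+ x) v) - ι (ind (ε (suc s) k ℕ.+ x) v)) γk)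
        (trans (cong₂ _-_ (ind-diag v (ε-01 (π s (suc s)) (π s k))) (ind-diag v (ε-01 (suc s) k)))
          (l₂ (ι (ε (π s (suc s)) (π s k))) (ι (ε (suc s) k))))
      where
      v = lookup γ (suc s)
      γk : lookup γ k ≡ v
      γk = trans (cong (lookup γ) (sym e)) (swap-tie (suc s))
      l₂ : ∀ a b → 1ℚ - a - (1ℚ - b) ≡ (a - b) * - 1ℚ
      l₂ = solve-∀ ring

ρ-last-0 : ∀ {m} (γ : Comp (suc m)) → lookup γ (fromℕ m) ≡ 0 → ρ γ (fromℕ m) ≡ 0ℚ
ρ-last-0 {m} γ e = sum-0 (λ k → ι (ind (ε (fromℕ m) k ℕ.+ lookup γ k) (lookup γ (fromℕ m)))) pointwise
  where
  pointwise : ∀ k → ι (ind (ε (fromℕ m) k ℕ.+ lookup γ k) (lookup γ (fromℕ m))) ≡ 0ℚ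
  pointwise k rewrite ε-last k | e = refl

ρ-Φ-inject₁ : ∀ {m} (γ : Comp (suc m)) i → ρ (Φ γ) (inject₁ i) ≡ ρ γ (suc i)
ρ-Φ-inject₁ {m} (b ∷ v) i = trans (sum-init-last f)
    (trans (cong₂ _+_ (sum-cong-≗ inner) outer) (QP.+-comm (sum (g ∘ suc)) (g zero)))
  where
  f g : Fin (suc m) → ℚ
  f k = ι (ind (ε (inject₁ i) k ℕ.+ lookup (v ∷ʳ suc b) k) (lookup (v ∷ʳ suc b) (inject₁ i)))
  g k = ι (ind (ε (suc i) k ℕ.+ lookup (b ∷ v) k) (lookup v i))
  inner : ∀ k → f (inject₁ k) ≡ g (suc k)
  inner k rewrite ε-inject₁ i k | lookup-∷ʳ-inject₁ v (suc b) i | lookup-∷ʳ-inject₁ v (suc b) k = refl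
  outer : f (fromℕ m) ≡ g zero
  outer rewrite ε-inject₁-last i | lookup-∷ʳ-inject₁ v (suc b) i | lookup-∷ʳ-last v (suc b) = refl

ρ-Φ-last : ∀ {m} (γ : Comp (suc m)) → ρ (Φ γ) (fromℕ m) ≡ ρ γ zero
ρ-Φ-last {m} (b ∷ v) = trans (sum-init-last f)
    (trans (cong₂ _+_ (sum-cong-≗ inner) outer) (QP.+-comm (sum (g ∘ suc)) (g zero)))
  where
  f g : Fin (suc m) → ℚ
  f k = ι (ind (ε (fromℕ m) k ℕ.+ lookup (v ∷ʳ suc b) k) (lookup (v ∷ʳ suc b) (fromℕ m)))
  g k = ι (ind (ε zero k ℕ.+ lookup (b ∷ v) k) b)
  inner : ∀ k → f (inject₁ k) ≡ g (suc k)
  inner k rewrite ε-last (inject₁ k) | lookup-∷ʳ-inject₁ v (suc b) k | lookup-∷ʳ-last v (suc b) = cong ι (ind-suc (lookup v k) b)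
  outer : f (fromℕ m) ≡ g zero
  outer rewrite ε-last (fromℕ m) | lookup-∷ʳ-last v (suc b) = cong ι (ind-suc (suc b) b)

ρ-∷ʳ0-inject₁ : ∀ {m} (γ : Comp m) i → ρ (γ ∷ʳ 0) (inject₁ i) ≡ 1ℚ + ρ γ i
ρ-∷ʳ0-inject₁ {m} γ i = trans (sum-init-last f)
    (trans (cong₂ _+_ (sum-cong-≗ inner) outer) (QP.+-comm (ρ γ i) 1ℚ))
  where
  f : Fin (suc m) → ℚ
  f k = ι (ind (ε (inject₁ i) k ℕ.+ lookup (γ ∷ʳ 0) k) (lookup (γ ∷ʳ 0) (inject₁ i)))
  inner : ∀ k → f (inject₁ k) ≡ ι (ind (ε i k ℕ.+ lookup γ k) (lookup γ i))
  inner k rewrite ε-inject₁ i k | lookup-∷ʳ-inject₁ γ 0 i | lookup-∷ʳ-inject₁ γ 0 k = refl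
  outer : f (fromℕ m) ≡ 1ℚ
  outer rewrite ε-inject₁-last i | lookup-∷ʳ-last γ 0 = refl

-- Counts the entries before position `j` that are at most `b`. When all entries from `j` on are
-- zero, this is the leg of the first box of a row of length `b + 1` inserted at `j`; see
-- `leg-first`.
below : ∀ {m} → Comp m → Fin (suc m) → ℕ → ℕ
below bs zero b = 0
below (x ∷ bs) (suc j) b = ind x b ℕ.+ below bs j b

below-suc : ∀ {m} (bs : Comp m) s b → below bs (suc s) b ≡ below bs (inject₁ s) b ℕ.+ ind (lookup bs s) b
below-suc (x ∷ bs) zero b = NP.+-comm (ind x b) 0
below-suc (x ∷ bs) (suc s) b = trans (cong (ind x b ℕ.+_) (below-suc bs s b)) (sym (NP.+-assoc (ind x b) _ _))

below-sum : ∀ {m} (bs : Comp m) s b → ι (below bs (suc s) b) ≡ sum (λ k → ι (ε s k ℕ.* ind (lookup bs k) b))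
below-sum {suc m} (x ∷ bs) zero b = trans (ι-+ (ind x b) 0) (cong₂ _+_ (cong ι (sym (NP.+-identityʳ (ind x b))))
  (sym (sum-0 {m} (λ k → ι (ε {suc m} zero (suc k) ℕ.* ind (lookup bs k) b)) (λ k → refl))))
below-sum (x ∷ bs) (suc s) b = trans (ι-+ (ind x b) (below bs (suc s) b)) (cong₂ _+_ (cong ι (sym (NP.+-identityʳ (ind x b)))) (below-sum bs s b))

punchIn-suc-self : ∀ {m} (s : Fin m) → punchIn (suc s) s ≡ inject₁ s
punchIn-suc-self zero = refl
punchIn-suc-self (suc s) = cong suc (punchIn-suc-self s)

ε-suc-punchIn : ∀ {m} (s k : Fin m) → ε (suc s) (punchIn (suc s) k) ≡ ε s k
ε-suc-punchIn zero zero = refl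
ε-suc-punchIn zero (suc k) = refl
ε-suc-punchIn (suc s) zero = refl
ε-suc-punchIn (suc s) (suc k) = ε-suc-punchIn s k

ε-inject₁-punchIn : ∀ {m} (s k : Fin m) → ε (inject₁ s) (punchIn (suc s) k) ≡ ε s k
ε-inject₁-punchIn zero zero = refl
ε-inject₁-punchIn zero (suc k) = refl
ε-inject₁-punchIn (suc s) zero = refl
ε-inject₁-punchIn (suc s) (suc k) = ε-inject₁-punchIn s k

-- The zeros after `s` are counted for both indices. Entries up to `s` are never counted for the
-- zero entry at `inject₁ s`, and are counted for the inserted entry when they are at most `b`.
ρ-insertAt : ∀ {m} (bs : Comp m) (s : Fin m) b → lookup bs s ≡ 0 → (∀ k → ε s k ≡ 0 → lookup bs k ≡ 0) →
  ρ (insertAt bs (suc s) (suc b)) (suc s) ≡ ρ (insertAt bs (suc s) (suc b)) (inject₁ s) + ι (below bs (suc s) b)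
ρ-insertAt {m} bs s b bs-s bs-k = trans (sum-punchIn f (suc s)) (trans (cong₂ _+_ f-self
    (trans (sum-cong-≗ pointwise) (∑-distrib-+ (λ k → g (punchIn (suc s) k)) (λ k → ι (ε s k ℕ.* ind (lookup bs k) b)))))
    (trans (sym (QP.+-assoc 0ℚ (sum (g ∘ punchIn (suc s))) (sum (λ k → ι (ε s k ℕ.* ind (lookup bs k) b))))) (cong₂ _+_ (sym (trans (sum-punchIn g (suc s)) (cong (_+ sum (g ∘ punchIn (suc s))) g-self))) (sym (below-sum bs s b)))))
  where
  ν = insertAt bs (suc s) (suc b)
  f g : Fin (suc m) → ℚ
  f k = ι (ind (ε (suc s) k ℕ.+ lookup ν k) (lookup ν (suc s)))
  g k = ι (ind (ε (inject₁ s) k ℕ.+ lookup ν k) (lookup ν (inject₁ s)))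
  ν-s : lookup ν (suc s) ≡ suc b
  ν-s = VP.insertAt-lookup bs (suc s) (suc b)
  ν-inj : lookup ν (inject₁ s) ≡ 0
  ν-inj = trans (cong (lookup ν) (sym (punchIn-suc-self s))) (trans (VP.insertAt-punchIn bs (suc s) (suc b) s) bs-s)
  f-self : f (suc s) ≡ 0ℚ
  f-self rewrite ν-s | ε-refl s = cong ι (ind-no {suc (suc b)} {suc b} NP.≤-refl)
  g-self : g (suc s) ≡ 0ℚ
  g-self rewrite ν-s | ν-inj = cong ι (ind-no {ε (inject₁ s) (suc s) ℕ.+ suc b} {0} (NP.≤-trans (s≤s z≤n) (NP.m≤n+m (suc b) (ε (inject₁ s) (suc s)))))
  pointwise : ∀ k → f (punchIn (suc s) k) ≡ g (punchIn (suc s) k) + ι (ε s k ℕ.* ind (lookup bs k) b)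
  pointwise k rewrite ε-suc-punchIn s k | ε-inject₁-punchIn s k | VP.insertAt-punchIn bs (suc s) (suc b) k | ν-s | ν-inj with ε-01 s k
  ... | inj₁ e rewrite e | bs-k k e = refl
  ... | inj₂ e rewrite e = trans (cong ι (trans (ind-suc (lookup bs k) b) (sym (NP.+-identityʳ (ind (lookup bs k) b))))) (sym (QP.+-identityˡ _))

-- Nonzero rationals, and the insertion of an enlarged first part

inverse : ∀ x → x ≢ 0ℚ → Σ ℚ λ u → u * x ≡ 1ℚ
inverse x x≢0 = ℚ.1/_ x {{ℚ.≢-nonZero x≢0}} , QP.*-inverseˡ x {{ℚ.≢-nonZero x≢0}}

cancel-nonzero : ∀ {x y} → x ≢ 0ℚ → x * y ≡ 0ℚ → y ≡ 0ℚ
cancel-nonzero {x} {y} x≢0 e with inverse x x≢0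
... | u , h = trans (sym (QP.*-identityˡ y)) (trans (cong (_* y) (sym h)) (trans (QP.*-assoc u x y) (trans (cong (u *_) e) (QP.*-zeroʳ u))))

pos⇒≢0 : ∀ {x} → 0ℚ ℚ.< x → x ≢ 0ℚ
pos⇒≢0 h refl = QP.<-irrefl refl h

fins : ∀ n → List (Fin n)
fins zero = []
fins (suc n) = zero ∷ L.map suc (fins n)

above : ∀ {n} → Fin n → List (Fin n)
above {suc n} zero = L.map suc (fins n)
above (suc j) = L.map suc (above j)

above-last : ∀ m → above (fromℕ m) ≡ []
above-last zero = refl
above-last (suc m) = cong (L.map suc) (above-last m)

above-inject₁ : ∀ {m} (s : Fin m) → above (inject₁ s) ≡ suc s ∷ above (suc s)
above-inject₁ {suc m} zero = refl
above-inject₁ (suc s) = cong (L.map suc) (above-inject₁ s)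

-- λ = A j μ moves the first part of μ, increased by one, to position j.
A : ∀ {m} → Fin (suc m) → Comp (suc m) → Comp (suc m)
A j (b ∷ v) = insertAt v j (suc b)

insertAt-swap : ∀ {X : Set} {m} (v : Vec X m) s x → insertAt v (inject₁ s) x ≡ swap s (insertAt v (suc s) x)
insertAt-swap (a ∷ v) zero x = refl
insertAt-swap (a ∷ v) (suc s) x = cong (a ∷_) (insertAt-swap v s x)

insertAt-last : ∀ {X : Set} {m} (v : Vec X m) x → insertAt v (fromℕ m) x ≡ v ∷ʳ x
insertAt-last [] x = refl
insertAt-last (a ∷ v) x = cong (a ∷_) (insertAt-last v x)

A-swap : ∀ {m} (s : Fin m) β → A (inject₁ s) β ≡ swap s (A (suc s) β)
A-swap s (b ∷ v) = insertAt-swap v s (suc b)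

A-last : ∀ {m} β → A (fromℕ m) β ≡ Φ β
A-last (b ∷ v) = insertAt-last v (suc b)

sum-A : ∀ {m} (j : Fin (suc m)) β → V.sum (A j β) ≡ suc (V.sum β)
sum-A j (b ∷ v) = go v j
  where
  go : ∀ {m} (v : Comp m) j → V.sum (insertAt v j (suc b)) ≡ suc (b ℕ.+ V.sum v)
  go v zero = refl
  go (a ∷ v) (suc j) = trans (cong (a ℕ.+_) (go v j)) (trans (NP.+-suc a _) (cong suc
    (trans (sym (NP.+-assoc a b _)) (trans (cong (ℕ._+ V.sum v) (NP.+-comm a b)) (NP.+-assoc b a _)))))

-- Interpolation points, and the bar monomials evaluated at them

module Points (α : ℚ) (α>0 : 0ℚ ℚ.< α) where

  -- α times the interpolation point of γ, in the notation of the statement.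
  ŷ : ∀ {n} → Comp n → Vec ℚ n
  ŷ γ = V.tabulate (λ i → α * ι (lookup γ i) + ρ γ i)

  lookup-ŷ : ∀ {n} (γ : Comp n) i → lookup (ŷ γ) i ≡ α * ι (lookup γ i) + ρ γ i
  lookup-ŷ γ i = VP.lookup∘tabulate (λ i → α * ι (lookup γ i) + ρ γ i) i

  instance
    α-nonneg : ℚ.NonNegative α
    α-nonneg = ℚ.nonNegative (QP.<⇒≤ α>0)

  α*-nonneg : ∀ k → 0ℚ ℚ.≤ α * ι k
  α*-nonneg k = QP.≤-trans (QP.≤-reflexive (sym (QP.*-zeroʳ α))) (QP.*-monoˡ-≤-nonNeg α (ι-nonneg k))

  positive-sum : ∀ {x y} → 0ℚ ℚ.< x → 0ℚ ℚ.≤ y → 0ℚ ℚ.< x + y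
  positive-sum {x} {y} hx hy = QP.<-≤-trans hx (QP.≤-trans (QP.≤-reflexive (sym (QP.+-identityʳ x))) (QP.+-monoʳ-≤ x hy))

  ŷ-mono : ∀ {n} (γ : Comp n) i j → lookup γ j ℕ.< lookup γ i → 0ℚ ℚ.< lookup (ŷ γ) i - lookup (ŷ γ) j
  ŷ-mono γ i j h with NP.m≤n⇒∃[o]m+o≡n {suc (lookup γ j)} {lookup γ i} h
  ... | d , eq = subst (0ℚ ℚ.<_) final (positive-sum {α} {α * ι d + (ρ γ i - ρ γ j)} α>0
        (QP.≤-trans (α*-nonneg d) (QP.≤-trans (QP.≤-reflexive (sym (QP.+-identityʳ (α * ι d)))) (QP.+-monoʳ-≤ (α * ι d) ρ≤))))
    where
    ρ≤ : 0ℚ ℚ.≤ ρ γ i - ρ γ j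
    ρ≤ = QP.≤-trans (QP.≤-reflexive (sym (QP.+-inverseʳ (ρ γ j)))) (QP.+-monoˡ-≤ (- ρ γ j) (ρ-mono γ i j h))
    lem : ∀ a x d r q → a + (a * d + (r - q)) ≡ a * (1ℚ + (x + d)) + r - (a * x + q)
    lem = solve-∀ ring
    final : α + (α * ι d + (ρ γ i - ρ γ j)) ≡ lookup (ŷ γ) i - lookup (ŷ γ) j
    final = trans (lem α (ι (lookup γ j)) (ι d) (ρ γ i) (ρ γ j)) (sym (cong₂ _-_ (trans (lookup-ŷ γ i)
      (cong (λ x → α * x + ρ γ i) (trans (cong ι (sym eq)) (cong (1ℚ +_) (ι-+ (lookup γ j) d))))) (lookup-ŷ γ j)))

  -- A larger entry has at least as large a rank, and `α > 0`. This supplies the inverse `u` that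
  -- `E-swap` requires.
  ŷ-distinct : ∀ {n} (γ : Comp n) i j → lookup γ i ≢ lookup γ j → lookup (ŷ γ) i - lookup (ŷ γ) j ≢ 0ℚ
  ŷ-distinct γ i j ne e with NP.<-cmp (lookup γ i) (lookup γ j)
  ... | tri≈ _ p _ = ne p
  ... | tri> _ _ gt = pos⇒≢0 (ŷ-mono γ i j gt) e
  ... | tri< lt _ _ = pos⇒≢0 (ŷ-mono γ j i lt) (trans (l (lookup (ŷ γ) i) (lookup (ŷ γ) j)) (cong -_ e))
    where
    l : ∀ a b → b - a ≡ - (a - b)
    l = solve-∀ ring

  ŷ-tie : ∀ {m} (s : Fin m) γ → lookup γ (inject₁ s) ≡ lookup γ (suc s) → lookup (ŷ γ) (inject₁ s) - lookup (ŷ γ) (suc s) ≡ 1ℚ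
  ŷ-tie s γ tie = trans (cong₂ _-_ (trans (lookup-ŷ γ (inject₁ s)) (cong₂ (λ x y → α * ι x + y) tie (ρ-tie s γ tie))) (lookup-ŷ γ (suc s)))
      (l (α * ι (lookup γ (suc s))) (ρ γ (suc s)))
    where
    l : ∀ a b → a + (1ℚ + b) - (a + b) ≡ 1ℚ
    l = solve-∀ ring

  ŷ-swap : ∀ {m} (s : Fin m) γ → lookup γ (inject₁ s) ≢ lookup γ (suc s) → ŷ (swap s γ) ≡ swap s (ŷ γ)
  ŷ-swap s γ ne = vec-ext λ k → trans (lookup-ŷ (swap s γ) k) (trans
    (cong₂ (λ x y → α * ι x + y) (lookup-swap s γ k) (ρ-swap s γ ne k))
    (sym (trans (lookup-swap s (ŷ γ) k) (lookup-ŷ γ (π s k)))))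

  ŷ-last-0 : ∀ {m} (γ : Comp (suc m)) → lookup γ (fromℕ m) ≡ 0 → lookup (ŷ γ) (fromℕ m) ≡ 0ℚ
  ŷ-last-0 {m} γ e = trans (lookup-ŷ γ (fromℕ m)) (trans (cong₂ (λ x y → α * ι x + y) e (ρ-last-0 γ e)) (l α))
    where
    l : ∀ a → a * 0ℚ + 0ℚ ≡ 0ℚ
    l = solve-∀ ring

  ŷ-Φ : ∀ {m} (γ : Comp (suc m)) → ŷ (Φ γ) ≡ V.tail (ŷ γ) ∷ʳ (V.head (ŷ γ) + α)
  ŷ-Φ {m} γ@(b ∷ v) = vec-ext (>-weakInduction _ at-last (λ i _ → at-inject₁ i))
    where
    w = V.tail (ŷ γ)
    x = V.head (ŷ γ) + α
    l : ∀ a i r → a * (1ℚ + i) + r ≡ a * i + r + a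
    l = solve-∀ ring
    at-last : lookup (ŷ (Φ γ)) (fromℕ m) ≡ lookup (w ∷ʳ x) (fromℕ m)
    at-last = trans (lookup-ŷ (Φ γ) (fromℕ m)) (trans (cong₂ (λ c y → α * ι c + y) (lookup-∷ʳ-last v (suc b)) (ρ-Φ-last γ))
      (trans (l α (ι b) (ρ γ zero)) (sym (lookup-∷ʳ-last w x))))
    at-inject₁ : ∀ i → lookup (ŷ (Φ γ)) (inject₁ i) ≡ lookup (w ∷ʳ x) (inject₁ i)
    at-inject₁ i = trans (lookup-ŷ (Φ γ) (inject₁ i)) (trans (cong₂ (λ c y → α * ι c + y) (lookup-∷ʳ-inject₁ v (suc b) i) (ρ-Φ-inject₁ γ i))
      (sym (trans (lookup-∷ʳ-inject₁ w x i) (lookup-ŷ γ (suc i)))))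

  -- An appended zero raises every other rank by one. The points with last entry 0 are thus shifted
  -- points in one variable fewer, as the induction for uniqueness requires.
  ŷ-∷ʳ0 : ∀ {m} (γ : Comp m) → ŷ (γ ∷ʳ 0) ≡ V.map (1ℚ +_) (ŷ γ) ∷ʳ 0ℚ
  ŷ-∷ʳ0 {m} γ = vec-ext (>-weakInduction _ at-last (λ i _ → at-inject₁ i))
    where
    w = V.map (1ℚ +_) (ŷ γ)
    l : ∀ a r → a + (1ℚ + r) ≡ 1ℚ + (a + r)
    l = solve-∀ ring
    at-last : lookup (ŷ (γ ∷ʳ 0)) (fromℕ m) ≡ lookup (w ∷ʳ 0ℚ) (fromℕ m)
    at-last = trans (ŷ-last-0 (γ ∷ʳ 0) (lookup-∷ʳ-last γ 0)) (sym (lookup-∷ʳ-last w 0ℚ))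
    at-inject₁ : ∀ i → lookup (ŷ (γ ∷ʳ 0)) (inject₁ i) ≡ lookup (w ∷ʳ 0ℚ) (inject₁ i)
    at-inject₁ i = trans (lookup-ŷ (γ ∷ʳ 0) (inject₁ i)) (trans (cong₂ (λ c y → α * ι c + y) (lookup-∷ʳ-inject₁ γ 0 i) (ρ-∷ʳ0-inject₁ γ i))
      (trans (l (α * ι (lookup γ i)) (ρ γ i)) (sym (trans (lookup-∷ʳ-inject₁ w 0ℚ i) (trans (VP.lookup-map i (1ℚ +_) (ŷ γ)) (cong (1ℚ +_) (lookup-ŷ γ i)))))))

  X : ∀ {m} → Comp (suc m) → Comp (suc m) → ℚ
  X β γ = E α (ŷ γ) β

  -- At a tie the coordinate difference is 1, so `u = 1` and the value at the swapped point, which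
  -- is not an interpolation point of the family, drops out.
  X-tie : ∀ {m} (s : Fin m) β γ → lookup γ (inject₁ s) ≡ lookup γ (suc s) → X (swap s β) γ ≡ X β γ
  X-tie s β γ tie = trans (E-swap α s (ŷ γ) 1ℚ (trans (QP.*-identityˡ _) (ŷ-tie s γ tie)) β) (l (X β γ) (E α (swap s (ŷ γ)) β))
    where
    l : ∀ a b → 1ℚ * a + (1ℚ - 1ℚ) * b ≡ a
    l = solve-∀ ring

  X-swap : ∀ {m} (s : Fin m) β γ u → lookup γ (inject₁ s) ≢ lookup γ (suc s) → u * (lookup (ŷ γ) (inject₁ s) - lookup (ŷ γ) (suc s)) ≡ 1ℚ →
    X (swap s β) γ ≡ u * X β γ + (1ℚ - u) * X β (swap s γ)
  X-swap s β γ u ne hu = trans (E-swap α s (ŷ γ) u hu β) (cong (λ z → u * X β γ + (1ℚ - u) * E α z β) (sym (ŷ-swap s γ ne)))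

  X-Φ-0 : ∀ {m} β (γ : Comp (suc m)) → lookup γ (fromℕ m) ≡ 0 → X (Φ β) γ ≡ 0ℚ
  X-Φ-0 {m} β γ e = trans (cong (λ z → E α z (Φ β)) (trans (unsnoc (ŷ γ)) (cong (V.init (ŷ γ) ∷ʳ_) (ŷ-last-0 γ e))))
    (trans (E-Φ α (V.init (ŷ γ)) 0ℚ β) (QP.*-zeroˡ (E α ((0ℚ - α) ∷ V.init (ŷ γ)) β)))

  -- Together with `X-Φ-0` this reduces zeros of the bar monomials for `Φ β` to zeros in degree one
  -- less.
  X-Φ-Φ : ∀ {m} β (γ : Comp (suc m)) → X (Φ β) (Φ γ) ≡ (V.head (ŷ γ) + α) * X β γ
  X-Φ-Φ β γ@(b ∷ v) = trans (cong (λ z → E α z (Φ β)) (ŷ-Φ γ)) (trans (E-Φ α (V.tail (ŷ γ)) (V.head (ŷ γ) + α) β)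
    (cong (λ x → (V.head (ŷ γ) + α) * E α (x ∷ V.tail (ŷ γ)) β) (l (V.head (ŷ γ)) α)))
    where
    l : ∀ x a → x + a - a ≡ x
    l = solve-∀ ring

  evN : List ℕ → ℚ
  evN [] = 0ℚ
  evN (b ∷ bs) = ι b + α * evN bs

  pair : ∀ {A : Set} → List (List ℕ × A) → (A → ℚ) → ℚ
  pair [] f = 0ℚ
  pair ((c , a) ∷ F) f = evN c * f a + pair F f

  pair-cong : ∀ {A : Set} (F : List (List ℕ × A)) {f g} → (∀ a → f a ≡ g a) → pair F f ≡ pair F g
  pair-cong [] h = refl
  pair-cong ((c , a) ∷ F) h = cong₂ (λ x y → evN c * x + y) (h a) (pair-cong F h)

  pair-linear : ∀ {A : Set} (F : List (List ℕ × A)) f g x y → pair F (λ a → x * f a + y * g a) ≡ x * pair F f + y * pair F g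
  pair-linear [] f g x y = l x y
    where
    l : ∀ x y → 0ℚ ≡ x * 0ℚ + y * 0ℚ
    l = solve-∀ ring
  pair-linear ((c , a) ∷ F) f g x y = trans (cong (evN c * (x * f a + y * g a) +_) (pair-linear F f g x y))
      (l (evN c) (f a) (g a) x y (pair F f) (pair F g))
    where
    l : ∀ c a b x y p q → c * (x * a + y * b) + (x * p + y * q) ≡ x * (c * a + p) + y * (c * b + q)
    l = solve-∀ ring

  pair-scaled : ∀ {A : Set} (F : List (List ℕ × A)) f x → pair F (λ a → x * f a) ≡ x * pair F f
  pair-scaled [] f x = sym (QP.*-zeroʳ x)
  pair-scaled ((c , a) ∷ F) f x = trans (cong (evN c * (x * f a) +_) (pair-scaled F f x)) (l (evN c) x (f a) (pair F f))
    where
    l : ∀ c x a p → c * (x * a) + x * p ≡ x * (c * a + p)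
    l = solve-∀ ring

  -- `F` stands for the expansion belonging to `b ∷ bs`, given only by its zeros. From it comes the
  -- expansion for the composition with `b + 1` inserted at `k₀`, a position from which on `bs` is
  -- zero.
  module Step {m : ℕ} (F : List (List ℕ × Comp (suc m))) (b : ℕ) (bs : Comp m) (k₀ : Fin (suc m))
      (bs-0 : ∀ k → toℕ k₀ ℕ.≤ toℕ k → lookup bs k ≡ 0)
      (F-vanish : ∀ γ → γ ≢ b ∷ bs → V.sum γ ℕ.≤ V.sum (b ∷ bs) → pair F (λ β → X β γ) ≡ 0ℚ) where

    μ = b ∷ bs

    small : Comp (suc m) → Set
    small γ = V.sum γ ℕ.≤ suc (V.sum μ)

    small-swap : ∀ s γ → small γ → small (swap s γ)
    small-swap s γ = subst (ℕ._≤ suc (V.sum μ)) (sym (sum-swap s γ))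

    h : Fin (suc m) → Comp (suc m) → ℚ
    h j γ = pair F (λ β → X (A j β) γ)

    -- At `k₀` this is the factor `α(a + 1) + l + 1` of the first box of the inserted row.
    c : Fin (suc m) → ℚ
    c j = α * ι (suc b) + ι (suc (below bs j b))

    R : Fin (suc m) → Comp (suc m) → ℚ
    R j γ = L.foldr (λ i s → h i γ + s) 0ℚ (above j)

    R-last : ∀ γ → R (fromℕ m) γ ≡ 0ℚ
    R-last γ rewrite above-last m = refl

    R-inject₁ : ∀ s γ → R (inject₁ s) γ ≡ h (suc s) γ + R (suc s) γ
    R-inject₁ s γ rewrite above-inject₁ s = refl

    h-tie : ∀ s γ → lookup γ (inject₁ s) ≡ lookup γ (suc s) → h (inject₁ s) γ ≡ h (suc s) γ
    h-tie s γ tie = pair-cong F (λ β → trans (cong (λ β → X β γ) (A-swap s β)) (X-tie s (A (suc s) β) γ tie))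

    h-swap : ∀ s γ u → lookup γ (inject₁ s) ≢ lookup γ (suc s) → u * (lookup (ŷ γ) (inject₁ s) - lookup (ŷ γ) (suc s)) ≡ 1ℚ →
      h (inject₁ s) γ ≡ u * h (suc s) γ + (1ℚ - u) * h (suc s) (swap s γ)
    h-swap s γ u ne hu = trans (pair-cong F (λ β → trans (cong (λ β → X β γ) (A-swap s β)) (X-swap s (A (suc s) β) γ u ne hu)))
      (pair-linear F (λ β → X (A (suc s) β) γ) (λ β → X (A (suc s) β) (swap s γ)) u (1ℚ - u))

    h-last-0 : ∀ γ → lookup γ (fromℕ m) ≡ 0 → h (fromℕ m) γ ≡ 0ℚ
    h-last-0 γ e = trans (pair-cong F {g = λ β → 0ℚ * X β γ} (λ β → trans (cong (λ β → X β γ) (A-last β)) (trans (X-Φ-0 β γ e) (sym (QP.*-zeroˡ (X β γ))))))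
      (trans (pair-scaled F (λ β → X β γ) 0ℚ) (QP.*-zeroˡ (pair F (λ β → X β γ))))

    h-last-Φ : ∀ γ → h (fromℕ m) (Φ γ) ≡ (V.head (ŷ γ) + α) * pair F (λ β → X β γ)
    h-last-Φ γ = trans (pair-cong F (λ β → trans (cong (λ β → X β (Φ γ)) (A-last β)) (X-Φ-Φ β γ))) (pair-scaled F (λ β → X β γ) (V.head (ŷ γ) + α))

    h-last : ∀ γ → γ ≢ Φ μ → small γ → h (fromℕ m) γ ≡ 0ℚ
    h-last γ ne sm with lookup γ (fromℕ m) in eq
    ... | zero = h-last-0 γ eq
    ... | suc a = trans (cong (h (fromℕ m)) γ≡) (trans (h-last-Φ γ') (trans (cong ((V.head (ŷ γ') + α) *_)
          (F-vanish γ' (λ e → ne (trans γ≡ (cong Φ e))) (NP.≤-pred (subst (ℕ._≤ suc (V.sum μ)) (trans (cong V.sum γ≡) (sum-Φ γ')) sm))))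
          (QP.*-zeroʳ (V.head (ŷ γ') + α))))
      where
      γ' = a ∷ V.init γ
      γ≡ : γ ≡ Φ γ'
      γ≡ = trans (unsnoc γ) (cong (V.init γ ∷ʳ_) eq)

    -- At the last index only `Φ μ` survives, and it is zero from `k₀` up to there. The
    -- transpositions used to descend to `j` act beyond `k` and leave its nonzero entry in place.
    h-support : ∀ j γ → small γ → ∀ k → toℕ k₀ ℕ.≤ toℕ k → toℕ k ℕ.< toℕ j → lookup γ k ≢ 0 → h j γ ≡ 0ℚ
    h-support = >-weakInduction _ at-last step
      where
      at-last : ∀ γ → small γ → ∀ k → toℕ k₀ ℕ.≤ toℕ k → toℕ k ℕ.< toℕ (fromℕ m) → lookup γ k ≢ 0 → h (fromℕ m) γ ≡ 0ℚ
      at-last γ sm k k₀≤k k< γk = h-last γ (λ { refl → γk (>-weakInduction (λ k → toℕ k₀ ℕ.≤ toℕ k → toℕ k ℕ.< toℕ (fromℕ m) → lookup (Φ μ) k ≡ 0)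
          (λ _ lt → ⊥-elim (NP.<-irrefl refl lt))
          (λ i _ le _ → trans (lookup-∷ʳ-inject₁ bs (suc b) i) (bs-0 i (subst (toℕ k₀ ℕ.≤_) (FP.toℕ-inject₁ i) le))) k k₀≤k k<) }) sm
      step : ∀ s → (∀ γ → small γ → ∀ k → toℕ k₀ ℕ.≤ toℕ k → toℕ k ℕ.< toℕ (suc s) → lookup γ k ≢ 0 → h (suc s) γ ≡ 0ℚ) →
        ∀ γ → small γ → ∀ k → toℕ k₀ ℕ.≤ toℕ k → toℕ k ℕ.< toℕ (inject₁ s) → lookup γ k ≢ 0 → h (inject₁ s) γ ≡ 0ℚ
      step s IH γ sm k k₀≤k k<s γk with lookup γ (inject₁ s) ℕ.≟ lookup γ (suc s)
      ... | yes tie = trans (h-tie s γ tie) (IH γ sm k k₀≤k k<s+1 γk)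
        where
        k<s+1 : toℕ k ℕ.< suc (toℕ s)
        k<s+1 = NP.m<n⇒m<1+n (subst (toℕ k ℕ.<_) (FP.toℕ-inject₁ s) k<s)
      ... | no ne with inverse _ (ŷ-distinct γ (inject₁ s) (suc s) ne)
      ... | u , hu = trans (h-swap s γ u ne hu) (trans (cong₂ (λ x y → u * x + (1ℚ - u) * y) (IH γ sm k k₀≤k k<s+1 γk)
              (IH (swap s γ) (small-swap s γ sm) k k₀≤k k<s+1 (γk ∘ trans (sym (trans (lookup-swap s γ k) (cong (lookup γ) fixed)))))) (l u))
        where
        k<s' : toℕ k ℕ.< toℕ s
        k<s' = subst (toℕ k ℕ.<_) (FP.toℕ-inject₁ s) k<s
        k<s+1 : toℕ k ℕ.< suc (toℕ s)
        k<s+1 = NP.m<n⇒m<1+n k<s'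
        l : ∀ u → u * 0ℚ + (1ℚ - u) * 0ℚ ≡ 0ℚ
        l = solve-∀ ring
        fixed : π s k ≡ k
        fixed with π-cases s k
        ... | inj₁ refl = ⊥-elim (NP.<-irrefl refl k<s)
        ... | inj₂ (inj₁ refl) = ⊥-elim (NP.<-irrefl refl (NP.<-trans k<s' (NP.n<1+n (toℕ s))))
        ... | inj₂ (inj₂ (e , _)) = e

    R-support : ∀ j γ → small γ → ∀ k → toℕ k₀ ℕ.≤ toℕ k → toℕ k ℕ.≤ toℕ j → lookup γ k ≢ 0 → R j γ ≡ 0ℚ
    R-support = >-weakInduction _ (λ γ _ _ _ _ _ → R-last γ) λ s IH γ sm k k₀≤k k≤s γk →
      let k≤s' = NP.m≤n⇒m≤1+n (subst (toℕ k ℕ.≤_) (FP.toℕ-inject₁ s) k≤s) in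
      trans (R-inject₁ s γ) (cong₂ _+_ (h-support (suc s) γ sm k k₀≤k (s≤s (subst (toℕ k ℕ.≤_) (FP.toℕ-inject₁ s) k≤s)) γk) (IH γ sm k k₀≤k k≤s' γk))

    c-nonzero : ∀ j → c j ≢ 0ℚ
    c-nonzero j = pos⇒≢0 (subst (0ℚ ℚ.<_) (QP.+-comm (ι (suc (below bs j b))) (α * ι (suc b)))
      (positive-sum (positive-sum (QP.positive⁻¹ 1ℚ) (ι-nonneg (below bs j b))) (α*-nonneg (suc b))))

    c-suc : ∀ s → toℕ k₀ ℕ.≤ toℕ s → c (suc s) ≡ c (inject₁ s) + 1ℚ
    c-suc s k₀≤s = trans (cong (λ x → α * ι (suc b) + (1ℚ + ι x)) (trans (below-suc bs s b) (cong (λ x → below bs (inject₁ s) b ℕ.+ ind x b) (bs-0 s k₀≤s))))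
      (trans (cong (λ x → α * ι (suc b) + (1ℚ + x)) (ι-+ (below bs (inject₁ s) b) 1)) (l (α * ι (suc b)) (ι (below bs (inject₁ s) b))))
      where
      l : ∀ a b → a + (1ℚ + (b + (1ℚ + 0ℚ))) ≡ a + (1ℚ + b) + 1ℚ
      l = solve-∀ ring

    ν : Fin (suc m) → Comp (suc m)
    ν j = A j μ

    ν-inject₁ : ∀ s → toℕ k₀ ℕ.≤ toℕ s → lookup (ν (suc s)) (inject₁ s) ≡ 0
    ν-inject₁ s k₀≤s = trans (cong (lookup (ν (suc s))) (sym (punchIn-suc-self s))) (trans (VP.insertAt-punchIn bs (suc s) (suc b) s) (bs-0 s k₀≤s))

    ε-0⇒> : ∀ {n} (s k : Fin n) → ε s k ≡ 0 → toℕ s ℕ.≤ toℕ k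
    ε-0⇒> zero (suc k) e = z≤n
    ε-0⇒> (suc s) (suc k) e = s≤s (ε-0⇒> s k e)

    -- The origin of the constants `c`: they are the gaps between the coordinate of the inserted row
    -- and that of the zero entry just before it.
    ŷ-ν : ∀ s → toℕ k₀ ℕ.≤ toℕ s → lookup (ŷ (ν (suc s))) (suc s) ≡ lookup (ŷ (ν (suc s))) (inject₁ s) + c (inject₁ s)
    ŷ-ν s k₀≤s = trans (lookup-ŷ (ν (suc s)) (suc s)) (trans (cong₂ (λ x y → α * ι x + y) (VP.insertAt-lookup bs (suc s) (suc b))
        (ρ-insertAt bs s b (bs-0 s k₀≤s) (λ k e → bs-0 k (NP.≤-trans k₀≤s (ε-0⇒> s k e)))))
        (trans (l₁ (α * ι (suc b)) (ρ (ν (suc s)) (inject₁ s)) (ι (below bs (suc s) b)))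
        (trans (cong₂ _+_ (trans (l₂ α (ρ (ν (suc s)) (inject₁ s))) (sym (trans (lookup-ŷ (ν (suc s)) (inject₁ s)) (cong (λ x → α * ι x + ρ (ν (suc s)) (inject₁ s)) (ν-inject₁ s k₀≤s)))))
          (trans (l₃ (α * ι (suc b)) (ι (below bs (suc s) b))) (trans (cong (_- 1ℚ) (c-suc s k₀≤s)) (l₄ (c (inject₁ s)))))) refl)))
      where
      l₁ : ∀ a r x → a + (r + x) ≡ r + (a + x)
      l₁ = solve-∀ ring
      l₂ : ∀ a r → r ≡ a * 0ℚ + r
      l₂ = solve-∀ ring
      l₃ : ∀ a x → a + x ≡ a + (1ℚ + x) - 1ℚ
      l₃ = solve-∀ ring
      l₄ : ∀ a → a + 1ℚ - 1ℚ ≡ a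
      l₄ = solve-∀ ring

    -- G j is the expansion for A j μ; at j = k₀ this is Knop and Sahi's recursion, while the
    -- intermediate j only serve the induction.
    G : Fin (suc m) → Comp (suc m) → ℚ
    G j γ = c j * h j γ + R j γ

    -- Downward induction on the index. At a tie `h` is unchanged, and the increment of `c` absorbs
    -- the new summand of `R`. Otherwise one of the two entries is nonzero, which kills `R (suc s)`,
    -- and `h-swap` leaves `(c u + 1) h`: the second factor is zero unless `γ` is `ν (suc s)`, and
    -- there the first one is.
    G-vanish : ∀ j → toℕ k₀ ℕ.≤ toℕ j → ∀ γ → γ ≢ ν j → small γ → G j γ ≡ 0ℚ
    G-vanish = >-weakInduction _ at-last step
      where
      at-last : toℕ k₀ ℕ.≤ toℕ (fromℕ m) → ∀ γ → γ ≢ ν (fromℕ m) → small γ → G (fromℕ m) γ ≡ 0ℚ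
      at-last _ γ ne sm = trans (cong₂ (λ x y → c (fromℕ m) * x + y) (h-last γ (λ e → ne (trans e (sym (A-last μ)))) sm) (R-last γ)) (l (c (fromℕ m)))
        where
        l : ∀ a → a * 0ℚ + 0ℚ ≡ 0ℚ
        l = solve-∀ ring
      step : ∀ s → (toℕ k₀ ℕ.≤ toℕ (suc s) → ∀ γ → γ ≢ ν (suc s) → small γ → G (suc s) γ ≡ 0ℚ) →
        toℕ k₀ ℕ.≤ toℕ (inject₁ s) → ∀ γ → γ ≢ ν (inject₁ s) → small γ → G (inject₁ s) γ ≡ 0ℚ
      step s IH k₀≤ γ ne sm with lookup γ (inject₁ s) ℕ.≟ lookup γ (suc s)
      ... | yes tie = trans (cong₂ (λ x y → c (inject₁ s) * x + y) (h-tie s γ tie) (R-inject₁ s γ))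
            (trans (l (c (inject₁ s)) (h (suc s) γ) (R (suc s) γ)) (trans (cong (λ x → x * h (suc s) γ + R (suc s) γ) (sym (c-suc s k₀≤s)))
              (IH (NP.m≤n⇒m≤1+n k₀≤s) γ not-ν sm)))
        where
        k₀≤s : toℕ k₀ ℕ.≤ toℕ s
        k₀≤s = subst (toℕ k₀ ℕ.≤_) (FP.toℕ-inject₁ s) k₀≤
        l : ∀ c h r → c * h + (h + r) ≡ (c + 1ℚ) * h + r
        l = solve-∀ ring
        not-ν : γ ≢ ν (suc s)
        not-ν refl with () ← trans (sym (ν-inject₁ s k₀≤s)) (trans tie (VP.insertAt-lookup bs (suc s) (suc b)))
      ... | no γ≢ with inverse _ (ŷ-distinct γ (inject₁ s) (suc s) γ≢)
      ... | u , hu = trans (cong₂ (λ x y → c (inject₁ s) * x + y) (trans (h-swap s γ u γ≢ hu) (cong (λ x → u * h (suc s) γ + (1ℚ - u) * x) h-swapped))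
              (trans (R-inject₁ s γ) (cong (h (suc s) γ +_) (R-0 γ sm γ≢))))
              (trans (l (c (inject₁ s)) u (h (suc s) γ)) final)
        where
        k₀≤s : toℕ k₀ ℕ.≤ toℕ s
        k₀≤s = subst (toℕ k₀ ℕ.≤_) (FP.toℕ-inject₁ s) k₀≤
        k₀≤s+1 = NP.m≤n⇒m≤1+n k₀≤s
        R-0 : ∀ γ → small γ → lookup γ (inject₁ s) ≢ lookup γ (suc s) → R (suc s) γ ≡ 0ℚ
        R-0 γ sm ne with lookup γ (suc s) ℕ.≟ 0
        ... | no γ≢0 = R-support (suc s) γ sm (suc s) k₀≤s+1 NP.≤-refl γ≢0
        ... | yes γ≡0 = R-support (suc s) γ sm (inject₁ s) k₀≤ (NP.≤-trans (NP.≤-reflexive (FP.toℕ-inject₁ s)) (NP.n≤1+n (toℕ s))) (λ e → ne (trans e (sym γ≡0)))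
        h-0 : ∀ γ → small γ → lookup γ (inject₁ s) ≢ lookup γ (suc s) → γ ≢ ν (suc s) → h (suc s) γ ≡ 0ℚ
        h-0 γ sm γ≢ ne = cancel-nonzero (c-nonzero (suc s)) (trans (sym (QP.+-identityʳ (c (suc s) * h (suc s) γ)))
          (trans (cong (c (suc s) * h (suc s) γ +_) (sym (R-0 γ sm γ≢))) (IH k₀≤s+1 γ ne sm)))
        h-swapped : h (suc s) (swap s γ) ≡ 0ℚ
        h-swapped = h-0 (swap s γ) (small-swap s γ sm) (λ e → γ≢ (trans (trans (cong (lookup γ) (sym (π-suc s))) (sym (lookup-swap s γ (suc s))))
            (trans (sym e) (trans (lookup-swap s γ (inject₁ s)) (cong (lookup γ) (π-inject₁ s))))))
          (λ e → ne (trans (sym (swap-involutive s γ)) (trans (cong (swap s) e) (sym (A-swap s μ)))))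
        l : ∀ c u h → c * (u * h + (1ℚ - u) * 0ℚ) + (h + 0ℚ) ≡ (c * u + 1ℚ) * h
        l = solve-∀ ring
        final : (c (inject₁ s) * u + 1ℚ) * h (suc s) γ ≡ 0ℚ
        final with VP.≡-dec NP._≟_ γ (ν (suc s))
        ... | no ne = trans (cong ((c (inject₁ s) * u + 1ℚ) *_) (h-0 γ sm γ≢ ne)) (QP.*-zeroʳ (c (inject₁ s) * u + 1ℚ))
        -- By `ŷ-ν` the coordinate difference is `- c (inject₁ s)`; as `u` is its inverse, `c u + 1`
        -- is zero.
        ... | yes refl = trans (cong (_* h (suc s) γ) (trans (l₁ (lookup (ŷ γ) (inject₁ s)) (c (inject₁ s)) u)
              (trans (cong (λ x → - (u * (lookup (ŷ γ) (inject₁ s) - x)) + 1ℚ) (sym (ŷ-ν s k₀≤s))) (trans (cong (λ x → - x + 1ℚ) hu) refl)))) (QP.*-zeroˡ (h (suc s) γ))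
          where
          l₁ : ∀ y c u → c * u + 1ℚ ≡ - (u * (y - (y + c))) + 1ℚ
          l₁ = solve-∀ ring

-- Formal combinations with coefficients in ℕ[α]

addN : List ℕ → List ℕ → List ℕ
addN [] q = q
addN (a ∷ p) [] = a ∷ p
addN (a ∷ p) (b ∷ q) = (a ℕ.+ b) ∷ addN p q

scaleN : ℕ → List ℕ → List ℕ
scaleN a = L.map (a ℕ.*_)

mulN : List ℕ → List ℕ → List ℕ
mulN [] q = []
mulN (a ∷ p) q = addN (scaleN a q) (0 ∷ mulN p q)

-- Keys may be repeated and are collected only by `coef`. Nonnegativity of the coefficients is built
-- into the type, so positivity needs no further proof once the expansion is identified.
Terms : Set → Set
Terms A = List (List ℕ × A)

mapT : ∀ {A B : Set} → (A → B) → Terms A → Terms B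
mapT f = L.map λ (c , a) → c , f a

scaleT : ∀ {A : Set} → List ℕ → Terms A → Terms A
scaleT p = L.map λ (c , a) → mulN p c , a

sumT : ∀ {A B : Set} → (A → Terms B) → List A → Terms B
sumT f [] = []
sumT f (a ∷ as) = f a ++ sumT f as

bindT : ∀ {A B : Set} → Terms A → (A → Terms B) → Terms B
bindT F K = sumT (λ (c , a) → scaleT c (K a)) F

range : ℕ → ℕ → List ℕ
range a zero = []
range a (suc n) = (a ℕ.+ n) ∷ range a n

-- Bar monomials and the expansion of F in them

-- The bar monomial of degree d and exponent β, with signs and powers of α removed.
barMon : ∀ {m} → ℕ → Comp (suc m) → Terms (Comp (suc m))
barMon zero β = ((1 ∷ []) , 0v) ∷ []
barMon {m} (suc d) β = mapT (λ μ → updateAt μ k suc) (barMon d η)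
    ++ scaleT (0 ∷ lookup η k ∷ []) (barMon d η)
    ++ sumT (λ j → sumT (λ l → barMon d (put k j l (lookup η k ℕ.+ lookup η j ∸ l) η))
        (range (ε k j ℕ.+ lookup η j) (suc (lookup η k) ∸ (ε k j ℕ.+ lookup η j)))) (fins (suc m))
  where
  k = firstMax β
  η = updateAt β k ℕ.pred

-- Defaults to `zero` on the zero composition, so an entry 0 at this index signals that all entries
-- are 0.
lastNonzero : ∀ {m} → Comp (suc m) → Fin (suc m)
lastNonzero (a ∷ []) = zero
lastNonzero (a ∷ b ∷ v) with lookup (b ∷ v) (lastNonzero (b ∷ v))
... | zero = zero
... | suc _ = suc (lastNonzero (b ∷ v))

lastNonzero-after : ∀ {m} (v : Comp (suc m)) k → toℕ (lastNonzero v) ℕ.< toℕ k → lookup v k ≡ 0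
lastNonzero-zero : ∀ {m} (v : Comp (suc m)) → lookup v (lastNonzero v) ≡ 0 → V.sum v ≡ 0
lastNonzero-after (a ∷ []) zero ()
lastNonzero-after (a ∷ b ∷ v) k h with lookup (b ∷ v) (lastNonzero (b ∷ v)) in eq
lastNonzero-after (a ∷ b ∷ v) (suc k) h | zero = trans (cong (λ u → lookup u k) (sum≡0 (b ∷ v) (lastNonzero-zero (b ∷ v) eq))) (lookup-0v k)
lastNonzero-after (a ∷ b ∷ v) (suc k) (s≤s h) | suc _ = lastNonzero-after (b ∷ v) k h
lastNonzero-zero (zero ∷ []) h = refl
lastNonzero-zero (a ∷ b ∷ v) h with lookup (b ∷ v) (lastNonzero (b ∷ v)) in eq
lastNonzero-zero (zero ∷ b ∷ v) h | zero = lastNonzero-zero (b ∷ v) eq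
lastNonzero-zero (a ∷ b ∷ v) h | suc _ with () ← trans (sym eq) h

lastNonzero-suc : ∀ {m} (v : Comp (suc m)) {d} → V.sum v ≡ suc d → suc (ℕ.pred (lookup v (lastNonzero v))) ≡ lookup v (lastNonzero v)
lastNonzero-suc v h with lookup v (lastNonzero v) in eq
... | suc a = refl
... | zero with () ← trans (sym h) (lastNonzero-zero v eq)

-- λ = A (lastNonzero λ) (star λ)
star : ∀ {m} → Comp (suc m) → Comp (suc m)
star v = ℕ.pred (lookup v (lastNonzero v)) ∷ removeAt v (lastNonzero v)

A-star : ∀ {m} (v : Comp (suc m)) {d} → V.sum v ≡ suc d → A (lastNonzero v) (star v) ≡ v
A-star v h = trans (cong (insertAt (removeAt v (lastNonzero v)) (lastNonzero v)) (lastNonzero-suc v h)) (VP.insertAt-removeAt v (lastNonzero v))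

sum-star : ∀ {m} (v : Comp (suc m)) {d} → V.sum v ≡ suc d → V.sum (star v) ≡ d
sum-star v h = NP.suc-injective (trans (sym (sum-A (lastNonzero v) (star v))) (trans (cong V.sum (A-star v h)) h))

punchIn-≥ : ∀ {m} (i : Fin (suc m)) (k : Fin m) → toℕ i ℕ.≤ toℕ k → toℕ i ℕ.< toℕ (punchIn i k)
punchIn-≥ zero k h = s≤s z≤n
punchIn-≥ (suc i) (suc k) (s≤s h) = s≤s (punchIn-≥ i k h)

lookup-removeAt : ∀ {X : Set} {m} (v : Vec X (suc m)) i k → lookup (removeAt v i) k ≡ lookup v (punchIn i k)
lookup-removeAt v i k = trans (sym (VP.insertAt-punchIn (removeAt v i) i (lookup v i) k)) (cong (λ u → lookup u (punchIn i k)) (VP.insertAt-removeAt v i))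

star-tail-0 : ∀ {m} (v : Comp (suc m)) k → toℕ (lastNonzero v) ℕ.≤ toℕ k → lookup (removeAt v (lastNonzero v)) k ≡ 0
star-tail-0 v k h = trans (lookup-removeAt v (lastNonzero v) k) (lastNonzero-after v (punchIn (lastNonzero v) k) (punchIn-≥ (lastNonzero v) k h))

-- The factor of `d_η(α)` at the first box of the last nonempty row, with the constant term first.
rowCoef : ∀ {m} → Comp (suc m) → List ℕ
rowCoef v = suc (below (removeAt v (lastNonzero v)) (lastNonzero v) b) ∷ suc b ∷ []
  where b = ℕ.pred (lookup v (lastNonzero v))

-- The expansion of F in bar monomials; it has the coefficients of the homogeneous (Jack) case.
jack : ∀ {m} → ℕ → Comp (suc m) → Terms (Comp (suc m))
jack zero v = ((1 ∷ []) , 0v) ∷ []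
jack (suc d) v = scaleT (rowCoef v) (mapT (A (lastNonzero v)) (jack d (star v)))
  ++ sumT (λ i → mapT (A i) (jack d (star v))) (above (lastNonzero v))

interp : ∀ {m} → Comp (suc m) → Terms (Comp (suc m))
interp v = bindT (jack (V.sum v) v) (barMon (V.sum v))

-- Monomials, signs and the extraction of coefficients

pw : ℚ → ℕ → ℚ
pw y zero = 1ℚ
pw y (suc k) = y * pw y k

mono : ∀ {n} → Vec ℚ n → Comp n → ℚ
mono [] [] = 1ℚ
mono (y ∷ ys) (k ∷ μ) = pw y k * mono ys μ

mono-inc : ∀ {n} (y : Vec ℚ n) μ k → mono y (updateAt μ k suc) ≡ lookup y k * mono y μ
mono-inc (y ∷ ys) (a ∷ μ) zero = QP.*-assoc y (pw y a) (mono ys μ)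
mono-inc (y ∷ ys) (a ∷ μ) (suc k) = trans (cong (pw y a *_) (mono-inc ys μ k)) (*-left-comm (pw y a) (lookup ys k) (mono ys μ))

mono-0v : ∀ {n} (y : Vec ℚ n) → mono y 0v ≡ 1ℚ
mono-0v [] = refl
mono-0v (y ∷ ys) = trans (QP.*-identityˡ (mono ys 0v)) (mono-0v ys)

sgn : ℕ → ℚ
sgn zero = 1ℚ
sgn (suc d) = - sgn d

-- As a functional of the second argument it extracts the coefficient of the monomial with exponent
-- `γ`.
δ₁ : ∀ {n} → Comp n → Comp n → ℚ
δ₁ γ a with VP.≡-dec NP._≟_ γ a
... | yes _ = 1ℚ
... | no _ = 0ℚ

δ₁-refl : ∀ {n} (γ : Comp n) → δ₁ γ γ ≡ 1ℚ
δ₁-refl γ with VP.≡-dec NP._≟_ γ γ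
... | yes _ = refl
... | no ne = ⊥-elim (ne refl)

δ₁-≢ : ∀ {n} {γ a : Comp n} → γ ≢ a → δ₁ γ a ≡ 0ℚ
δ₁-≢ {γ = γ} {a} ne with VP.≡-dec NP._≟_ γ a
... | yes e = ⊥-elim (ne e)
... | no _ = refl

ι-* : ∀ m n → ι (m ℕ.* n) ≡ ι m * ι n
ι-* zero n = sym (QP.*-zeroˡ (ι n))
ι-* (suc m) n = trans (ι-+ n (m ℕ.* n)) (trans (cong (ι n +_) (ι-* m n)) (l (ι m) (ι n)))
  where
  l : ∀ a b → b + a * b ≡ (1ℚ + a) * b
  l = solve-∀ ring

coef : ∀ {n} → Terms (Comp n) → Comp n → List ℕ
coef [] γ = []
coef ((c , a) ∷ F) γ with VP.≡-dec NP._≟_ γ a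
... | yes _ = addN c (coef F γ)
... | no _ = coef F γ

sumL : ∀ {A : Set} → (A → ℚ) → List A → ℚ
sumL f [] = 0ℚ
sumL f (a ∷ as) = f a + sumL f as

sumL-cong : ∀ {A : Set} {f g : A → ℚ} as → (∀ a → f a ≡ g a) → sumL f as ≡ sumL g as
sumL-cong [] h = refl
sumL-cong (a ∷ as) h = cong₂ _+_ (h a) (sumL-cong as h)

sumL-0 : ∀ {A : Set} (f : A → ℚ) as → (∀ a → f a ≡ 0ℚ) → sumL f as ≡ 0ℚ
sumL-0 f [] h = refl
sumL-0 f (a ∷ as) h = cong₂ _+_ (h a) (sumL-0 f as h)

sumL-scaled : ∀ {A : Set} (f : A → ℚ) c as → sumL (λ a → c * f a) as ≡ c * sumL f as
sumL-scaled f c [] = sym (QP.*-zeroʳ c)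
sumL-scaled f c (a ∷ as) = trans (cong (c * f a +_) (sumL-scaled f c as)) (sym (QP.*-distribˡ-+ c (f a) (sumL f as)))

sumL-map : ∀ {A B : Set} (f : B → ℚ) (g : A → B) as → sumL f (L.map g as) ≡ sumL (f ∘ g) as
sumL-map f g [] = refl
sumL-map f g (a ∷ as) = cong (f (g a) +_) (sumL-map f g as)

sumL-fins : ∀ n (f : Fin n → ℚ) → sumL f (fins n) ≡ sum f
sumL-fins zero f = refl
sumL-fins (suc n) f = cong (f zero +_) (trans (sumL-map f suc (fins n)) (sumL-fins n (f ∘ suc)))

sumL-range : ∀ f a n → sumL f (range a n) ≡ pre f (a ℕ.+ n) - pre f a
sumL-range f a zero = trans (sym (QP.+-inverseʳ (pre f a))) (cong (λ b → pre f b - pre f a) (sym (NP.+-identityʳ a)))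
sumL-range f a (suc n) = trans (cong (f (a ℕ.+ n) +_) (sumL-range f a n)) (trans (l (f (a ℕ.+ n)) (pre f (a ℕ.+ n)) (pre f a))
    (cong (λ b → pre f b - pre f a) (sym (NP.+-suc a n))))
  where
  l : ∀ a b c → a + (b - c) ≡ b + a - c
  l = solve-∀ ring

-- Degrees, leading terms and zeros of the expansions

module Eval (α : ℚ) (α>0 : 0ℚ ℚ.< α) where
  open Points α α>0

  evN-add : ∀ p q → evN (addN p q) ≡ evN p + evN q
  evN-add [] q = sym (QP.+-identityˡ (evN q))
  evN-add (a ∷ p) [] = sym (QP.+-identityʳ (evN (a ∷ p)))
  evN-add (a ∷ p) (b ∷ q) = trans (cong₂ (λ x y → x + α * y) (ι-+ a b) (evN-add p q)) (l (ι a) (ι b) α (evN p) (evN q))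
    where
    l : ∀ a b α p q → a + b + α * (p + q) ≡ a + α * p + (b + α * q)
    l = solve-∀ ring

  evN-scale : ∀ a p → evN (scaleN a p) ≡ ι a * evN p
  evN-scale a [] = sym (QP.*-zeroʳ (ι a))
  evN-scale a (b ∷ p) = trans (cong₂ (λ x y → x + α * y) (ι-* a b) (evN-scale a p)) (l (ι a) (ι b) α (evN p))
    where
    l : ∀ a b α p → a * b + α * (a * p) ≡ a * (b + α * p)
    l = solve-∀ ring

  evN-mul : ∀ p q → evN (mulN p q) ≡ evN p * evN q
  evN-mul [] q = sym (QP.*-zeroˡ (evN q))
  evN-mul (a ∷ p) q = trans (evN-add (scaleN a q) (0 ∷ mulN p q)) (trans (cong₂ (λ x y → x + (0ℚ + α * y)) (evN-scale a q) (evN-mul p q)) (l (ι a) (evN q) α (evN p)))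
    where
    l : ∀ a q α p → a * q + (0ℚ + α * (p * q)) ≡ (a + α * p) * q
    l = solve-∀ ring

  pair-++ : ∀ {A : Set} (F G : Terms A) f → pair (F ++ G) f ≡ pair F f + pair G f
  pair-++ [] G f = sym (QP.+-identityˡ (pair G f))
  pair-++ ((c , a) ∷ F) G f = trans (cong (evN c * f a +_) (pair-++ F G f)) (sym (QP.+-assoc (evN c * f a) (pair F f) (pair G f)))

  pair-map : ∀ {A B : Set} (F : Terms A) (g : A → B) f → pair (mapT g F) f ≡ pair F (f ∘ g)
  pair-map [] g f = refl
  pair-map ((c , a) ∷ F) g f = cong (evN c * f (g a) +_) (pair-map F g f)

  pair-scaleT : ∀ {A : Set} p (F : Terms A) f → pair (scaleT p F) f ≡ evN p * pair F f
  pair-scaleT p [] f = sym (QP.*-zeroʳ (evN p))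
  pair-scaleT p ((c , a) ∷ F) f = trans (cong₂ (λ x y → x * f a + y) (evN-mul p c) (pair-scaleT p F f)) (l (evN p) (evN c) (f a) (pair F f))
    where
    l : ∀ p c a q → p * c * a + p * q ≡ p * (c * a + q)
    l = solve-∀ ring

  pair-sumT : ∀ {A B : Set} (K : A → Terms B) as f → pair (sumT K as) f ≡ sumL (λ a → pair (K a) f) as
  pair-sumT K [] f = refl
  pair-sumT K (a ∷ as) f = trans (pair-++ (K a) (sumT K as) f) (cong (pair (K a) f +_) (pair-sumT K as f))

  pair-bindT : ∀ {A B : Set} (F : Terms A) (K : A → Terms B) f → pair (bindT F K) f ≡ pair F (λ a → pair (K a) f)
  pair-bindT [] K f = refl
  pair-bindT ((c , a) ∷ F) K f = trans (pair-++ (scaleT c (K a)) (bindT F K) f) (cong₂ _+_ (pair-scaleT c (K a) f) (pair-bindT F K f))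

  pair-coef : ∀ {n} (F : Terms (Comp n)) γ → evN (coef F γ) ≡ pair F (δ₁ γ)
  pair-coef [] γ = refl
  pair-coef ((c , a) ∷ F) γ with VP.≡-dec NP._≟_ γ a
  ... | yes _ = trans (evN-add c (coef F γ)) (cong₂ _+_ (sym (QP.*-identityʳ (evN c))) (pair-coef F γ))
  ... | no _ = trans (pair-coef F γ) (trans (sym (QP.+-identityˡ (pair F (δ₁ γ)))) (cong (_+ pair F (δ₁ γ)) (sym (QP.*-zeroʳ (evN c)))))

  module BarMon {m : ℕ} (d : ℕ) (β : Comp (suc m)) where
    k = firstMax β
    η = updateAt β k ℕ.pred
    lo hi : Fin (suc m) → ℕ
    lo j = ε k j ℕ.+ lookup η j
    hi j = suc (lookup η k) ∸ lo j
    moved : Fin (suc m) → ℕ → Comp (suc m)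
    moved j l = put k j l (lookup η k ℕ.+ lookup η j ∸ l) η

    pair-barMon : ∀ f → pair (barMon (suc d) β) f ≡ pair (barMon d η) (λ μ → f (updateAt μ k suc))
      + (α * ι (lookup η k) * pair (barMon d η) f + sum (λ j → sumL (λ l → pair (barMon d (moved j l)) f) (range (lo j) (hi j))))
    pair-barMon f = trans (pair-++ (mapT (λ μ → updateAt μ k suc) (barMon d η)) (scaleT (0 ∷ lookup η k ∷ []) (barMon d η) ++ sumT (λ j → sumT (λ l → barMon d (moved j l)) (range (lo j) (hi j))) (fins (suc m))) f)
      (cong₂ _+_ (pair-map (barMon d η) (λ μ → updateAt μ k suc) f)
        (trans (pair-++ (scaleT (0 ∷ lookup η k ∷ []) (barMon d η)) (sumT (λ j → sumT (λ l → barMon d (moved j l)) (range (lo j) (hi j))) (fins (suc m))) f)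
          (cong₂ _+_ (trans (pair-scaleT (0 ∷ lookup η k ∷ []) (barMon d η) f) (cong (_* pair (barMon d η) f) (l α (ι (lookup η k)))))
            (trans (pair-sumT (λ j → sumT (λ l → barMon d (moved j l)) (range (lo j) (hi j))) (fins (suc m)) f)
            (trans (sumL-fins (suc m) (λ j → pair (sumT (λ l → barMon d (moved j l)) (range (lo j) (hi j))) f))
              (sum-cong-≗ (λ j → pair-sumT (λ l → barMon d (moved j l)) (range (lo j) (hi j)) f)))))))
      where
      l : ∀ a x → 0ℚ + a * (x + a * 0ℚ) ≡ a * x
      l = solve-∀ ring

  -- The bound on the degree of the monomials is phrased by test functionals, as everywhere here, so
  -- that it applies both to evaluations and to coefficients.
  barMon-degree : ∀ {m} d (β : Comp (suc m)) f → (∀ a → V.sum a ℕ.≤ d → f a ≡ 0ℚ) → pair (barMon d β) f ≡ 0ℚ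
  barMon-degree {m} zero β f h = trans (cong (λ x → evN (1 ∷ []) * x + 0ℚ) (h 0v (NP.≤-reflexive (sum-0v {suc m})))) (trans (QP.+-identityʳ _) (QP.*-zeroʳ (evN (1 ∷ []))))
  barMon-degree (suc d) β f h = trans (pair-barMon f) (trans (cong₂ _+_
      (barMon-degree d η (λ μ → f (updateAt μ k suc)) (λ a le → h (updateAt a k suc) (NP.≤-trans (NP.≤-reflexive (sum-updateAt a k)) (s≤s le))))
      (cong₂ (λ x y → α * ι (lookup η k) * x + y) (lower η) (sum-0 _ (λ j → sumL-0 _ (range (lo j) (hi j)) (λ l → lower (moved j l))))))
      (l (α * ι (lookup η k))))
    where
    open BarMon d β
    lower : ∀ ν → pair (barMon d ν) f ≡ 0ℚ
    lower ν = barMon-degree d ν f (λ a le → h a (NP.m≤n⇒m≤1+n le))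
    l : ∀ a → 0ℚ + (a * 0ℚ + 0ℚ) ≡ 0ℚ
    l = solve-∀ ring

  -- Of the three groups of terms only the first raises the degree, so the top homogeneous part is
  -- the ordinary monomial.
  barMon-top : ∀ {m} d (β : Comp (suc m)) f → V.sum β ≡ d → (∀ a → V.sum a ℕ.< d → f a ≡ 0ℚ) → pair (barMon d β) f ≡ f β
  barMon-top zero β f e h = trans (cong (λ ν → evN (1 ∷ []) * f ν + 0ℚ) (sym (sum≡0 β e))) (l α (f β))
    where
    l : ∀ α x → (1ℚ + 0ℚ + α * 0ℚ) * x + 0ℚ ≡ x
    l = solve-∀ ring
  barMon-top (suc d) β f e h = trans (pair-barMon f) (trans (cong₂ _+_
      (trans (barMon-top d η (λ μ → f (updateAt μ k suc)) (NP.suc-injective (trans (sum-dec β k (proj₂ βk)) e))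
        (λ a lt → h (updateAt a k suc) (subst (ℕ._< suc d) (sym (sum-updateAt a k)) (s≤s lt)))) (cong f (inc-dec β k (proj₂ βk))))
      (cong₂ (λ x y → α * ι (lookup η k) * x + y) (lower η) (sum-0 _ (λ j → sumL-0 _ (range (lo j) (hi j)) (λ l → lower (moved j l))))))
      (l (f β) (α * ι (lookup η k))))
    where
    open BarMon d β
    βk = firstMax-positive α β e
    lower : ∀ ν → pair (barMon d ν) f ≡ 0ℚ
    lower ν = barMon-degree d ν f (λ a le → h a (s≤s le))
    l : ∀ x a → x + (a * 0ℚ + 0ℚ) ≡ x
    l = solve-∀ ring

  neg : ∀ {n} → Vec ℚ n → Vec ℚ n
  neg = V.map (-_)

  -- The coefficients are nonnegative because ξ k is a positive operator on a composition η
  -- for which k is the first maximum of η + e_k.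
  E-barMon : ∀ {m} (z : Vec ℚ (suc m)) d β → V.sum β ≡ d → E-go α z d β ≡ sgn d * pair (barMon d β) (mono (neg z))
  E-barMon z zero β e = trans (l α (1ℚ)) (cong (λ x → 1ℚ * (evN (1 ∷ []) * x + 0ℚ)) (sym (mono-0v (neg z))))
    where
    l : ∀ α x → x ≡ 1ℚ * ((1ℚ + 0ℚ + α * 0ℚ) * x + 0ℚ)
    l = solve-∀ ring
  E-barMon {m} z (suc d) β e = trans (cong₂ (λ x y → lookup z k * x - (α * ι (lookup η k) * x + y)) (IH η sum-η)
      (trans (sum-cong-≗ T-ev) (sym (*-distribˡ-sum (sgn d) S))))
      (trans (l (lookup z k) (sgn d) Q (α * ι (lookup η k)) (sum S)) (cong (- sgn d *_) (sym (trans (pair-barMon (mono (neg z)))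
        (cong (_+ (α * ι (lookup η k) * Q + sum S)) (trans (pair-cong (barMon d η) (λ μ → mono-inc (neg z) μ k))
          (trans (pair-scaled (barMon d η) (mono (neg z)) (lookup (neg z) k)) (cong (_* Q) (VP.lookup-map k -_ z)))))))))
    where
    open BarMon d β
    βk = firstMax-positive α β e
    sum-η : V.sum η ≡ d
    sum-η = NP.suc-injective (trans (sum-dec β k (proj₂ βk)) e)
    IH : ∀ ν → V.sum ν ≡ d → E-go α z d ν ≡ sgn d * pair (barMon d ν) (mono (neg z))
    IH ν = E-barMon z d ν
    Q = pair (barMon d η) (mono (neg z))
    S : Fin (suc m) → ℚ
    S j = sumL (λ l → pair (barMon d (moved j l)) (mono (neg z))) (range (lo j) (hi j))
    l : ∀ z s q a t → z * (s * q) - (a * (s * q) + s * t) ≡ - s * (- z * q + (a * q + t))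
    l = solve-∀ ring
    -- As `η` is `β` lowered at `k`, the right side is the maximum of `β`. Thus the truncated
    -- difference `hi j` is a true one, and the signed sum is an honest sum.
    lo≤ : ∀ j → lo j ℕ.≤ suc (lookup η k)
    lo≤ j with k FP.≟ j
    ... | yes refl rewrite ε-refl k = NP.≤-refl
    ... | no k≢j = subst₂ (λ x y → ε k j ℕ.+ x ℕ.≤ y) (sym (VP.lookup∘updateAt′ j k (k≢j ∘ sym) β))
          (sym (trans (cong suc (trans (VP.lookup∘updateAt k β) (cong ℕ.pred (proj₂ βk)))) (sym (proj₂ βk)))) (firstMax-strict β j (k≢j ∘ sym))
    T-ev : ∀ j → T k j (E-go α z d) η ≡ sgn d * S j
    T-ev j with k FP.≟ j
    ... | yes refl = trans (T-self k (E-go α z d) η) (sym (trans (cong (sgn d *_) (trans (cong (λ n → sumL (λ l → pair (barMon d (moved k l)) (mono (neg z))) (range (lo k) n)) hi-0) refl)) (QP.*-zeroʳ (sgn d))))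
      where
      hi-0 : hi k ≡ 0
      hi-0 rewrite ε-refl k = NP.n∸n≡0 (lookup η k)
    ... | no k≢j = trans (T-range {k = k} {j} {E-go α z d} {λ ν → sgn d * pair (barMon d ν) (mono (neg z))} {η}
            (λ l l≤ → IH (moved j l) (trans (sum-put k≢j η l≤) sum-η)))
        (trans (cong (λ b → pre f b - pre f (lo j)) (sym (NP.m+[n∸m]≡n (lo≤ j)))) (trans (sym (sumL-range f (lo j) (hi j)))
          (sumL-scaled (λ l → pair (barMon d (moved j l)) (mono (neg z))) (sgn d) (range (lo j) (hi j)))))
      where
      f : ℕ → ℚ
      f l = sgn d * pair (barMon d (moved j l)) (mono (neg z))

  module Jack {m : ℕ} (d : ℕ) (v : Comp (suc m)) where
    k₀ = lastNonzero v
    b = ℕ.pred (lookup v k₀)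
    bs = removeAt v k₀

    pair-jack : ∀ f → pair (jack (suc d) v) f ≡ (α * ι (suc b) + ι (suc (below bs k₀ b))) * pair (jack d (star v)) (f ∘ A k₀)
      + L.foldr (λ i s → pair (jack d (star v)) (f ∘ A i) + s) 0ℚ (above k₀)
    pair-jack f = trans (pair-++ (scaleT (rowCoef v) (mapT (A k₀) (jack d (star v)))) (sumT (λ i → mapT (A i) (jack d (star v))) (above k₀)) f)
      (cong₂ _+_ (trans (pair-scaleT (rowCoef v) (mapT (A k₀) (jack d (star v))) f)
          (cong₂ _*_ (l (ι (suc (below bs k₀ b))) α (ι (suc b))) (pair-map (jack d (star v)) (A k₀) f)))
        (go (above k₀)))
      where
      l : ∀ c α x → c + α * (x + α * 0ℚ) ≡ α * x + c
      l = solve-∀ ring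
      go : ∀ as → pair (sumT (λ i → mapT (A i) (jack d (star v))) as) f ≡ L.foldr (λ i s → pair (jack d (star v)) (f ∘ A i) + s) 0ℚ as
      go [] = refl
      go (i ∷ as) = trans (pair-++ (mapT (A i) (jack d (star v))) (sumT (λ i → mapT (A i) (jack d (star v))) as) f)
        (cong₂ _+_ (pair-map (jack d (star v)) (A i) f) (go as))

  jack-homogeneous : ∀ {m} d (v : Comp (suc m)) f g → (∀ a → V.sum a ≡ d → f a ≡ g a) → pair (jack d v) f ≡ pair (jack d v) g
  jack-homogeneous {m} zero v f g h = cong (λ x → evN (1 ∷ []) * x + 0ℚ) (h 0v (sum-0v {suc m}))
  jack-homogeneous (suc d) v f g h = trans (pair-jack f) (trans (cong₂ (λ x y → (α * ι (suc b) + ι (suc (below bs k₀ b))) * x + y) (IH k₀) (go (above k₀))) (sym (pair-jack g)))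
    where
    open Jack d v
    IH : ∀ i → pair (jack d (star v)) (f ∘ A i) ≡ pair (jack d (star v)) (g ∘ A i)
    IH i = jack-homogeneous d (star v) (f ∘ A i) (g ∘ A i) (λ a e → h (A i a) (trans (sum-A i a) (cong suc e)))
    go : ∀ as → L.foldr (λ i s → pair (jack d (star v)) (f ∘ A i) + s) 0ℚ as ≡ L.foldr (λ i s → pair (jack d (star v)) (g ∘ A i) + s) 0ℚ as
    go [] = refl
    go (i ∷ as) = cong₂ _+_ (IH i) (go as)

  jack-vanish : ∀ {m} d (v : Comp (suc m)) → V.sum v ≡ d → ∀ γ → γ ≢ v → V.sum γ ℕ.≤ d → pair (jack d v) (λ β → X β γ) ≡ 0ℚ
  jack-vanish zero v e γ ne le = ⊥-elim (ne (trans (sum≡0 γ (NP.n≤0⇒n≡0 le)) (sym (sum≡0 v e))))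
  jack-vanish (suc d) v e γ ne le = trans (pair-jack (λ β → X β γ)) (G-vanish k₀ NP.≤-refl γ
      (λ eq → ne (trans eq (A-star v e))) (NP.≤-trans le (s≤s (NP.≤-reflexive (sym (sum-star v e))))))
    where
    open Jack d v
    open Step (jack d (star v)) b bs k₀ (star-tail-0 v) (λ γ ne le → jack-vanish d (star v) (sum-star v e) γ ne (NP.≤-trans le (NP.≤-reflexive (sum-star v e))))

  -- The substitution of `-x` in the definition of `F` appears as evaluation at `neg (ŷ γ)`. All bar
  -- monomials involved have the same degree, so the signs form one common nonzero factor.
  interp-vanish : ∀ {m} (v : Comp (suc m)) γ → γ ≢ v → V.sum γ ℕ.≤ V.sum v → pair (interp v) (mono (neg (ŷ γ))) ≡ 0ℚ
  interp-vanish v γ ne le = cancel-nonzero (sgn≢0 (V.sum v)) (trans (cong (sgn (V.sum v) *_) (pair-bindT (jack (V.sum v) v) (barMon (V.sum v)) (mono (neg (ŷ γ)))))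
      (trans (sym (pair-scaled (jack (V.sum v) v) (λ β → pair (barMon (V.sum v) β) (mono (neg (ŷ γ)))) (sgn (V.sum v))))
      (trans (jack-homogeneous (V.sum v) v (λ β → sgn (V.sum v) * pair (barMon (V.sum v) β) (mono (neg (ŷ γ)))) (λ β → X β γ)
        (λ β e → trans (sym (E-barMon (ŷ γ) (V.sum v) β e)) (cong (λ d → E-go α (ŷ γ) d β) (sym e))))
        (jack-vanish (V.sum v) v refl γ ne le))))
    where
    sgn≢0 : ∀ d → sgn d ≢ 0ℚ
    sgn≢0 zero ()
    sgn≢0 (suc d) e = sgn≢0 d (trans (l (sgn d)) (cong -_ e))
      where
      l : ∀ x → x ≡ - - x
      l = solve-∀ ring

  interp-degree : ∀ {m} (v : Comp (suc m)) f → (∀ a → V.sum a ℕ.≤ V.sum v → f a ≡ 0ℚ) → pair (interp v) f ≡ 0ℚ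
  interp-degree v f h = trans (pair-bindT (jack (V.sum v) v) (barMon (V.sum v)) f)
    (trans (pair-cong (jack (V.sum v) v) {g = λ a → 0ℚ * 0ℚ} (λ β → barMon-degree (V.sum v) β f h))
      (trans (pair-scaled (jack (V.sum v) v) (λ _ → 0ℚ) 0ℚ) (QP.*-zeroˡ (pair (jack (V.sum v) v) (λ _ → 0ℚ)))))

  -- The product of the first-box factors along the chain `v`, `star v`, and so on, which removes
  -- one box at a time. By `dRows-lead` it is `d_η(α)`.
  lead : ∀ {m} → ℕ → Comp (suc m) → ℚ
  lead zero v = 1ℚ
  lead (suc d) v = (α * ι (suc b) + ι (suc (below bs k₀ b))) * lead d (star v)
    where open Jack d v

  above-> : ∀ {n} (j : Fin n) (f : Fin n → ℚ) → (∀ i → toℕ j ℕ.< toℕ i → f i ≡ 0ℚ) → L.foldr (λ i s → f i + s) 0ℚ (above j) ≡ 0ℚ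
  above-> {suc n} zero f h = trans (fold≡sumL (L.map suc (fins n))) (trans (sumL-map f suc (fins n)) (sumL-0 (f ∘ suc) (fins n) (λ i → h (suc i) (s≤s z≤n))))
    where
    fold≡sumL : ∀ as → L.foldr (λ i s → f i + s) 0ℚ as ≡ sumL f as
    fold≡sumL [] = refl
    fold≡sumL (a ∷ as) = cong (f a +_) (fold≡sumL as)
  above-> (suc j) f h = trans (fold-map (above j)) (above-> j (f ∘ suc) (λ i lt → h (suc i) (s≤s lt)))
    where
    fold-map : ∀ as → L.foldr (λ i s → f i + s) 0ℚ (L.map suc as) ≡ L.foldr (λ i s → f (suc i) + s) 0ℚ as
    fold-map [] = refl
    fold-map (a ∷ as) = cong (f (suc a) +_) (fold-map as)

  -- Insertion at an index beyond the last nonzero entry of `v` creates a positive entry there and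
  -- so never produces `v`. Only the first summand of the recursion contributes.
  jack-lead : ∀ {m} d (v : Comp (suc m)) → V.sum v ≡ d → pair (jack d v) (δ₁ v) ≡ lead d v
  jack-lead zero v e = trans (cong (λ x → evN (1 ∷ []) * x + 0ℚ) (trans (cong (δ₁ v) (sym (sum≡0 v e))) (δ₁-refl v))) (l α)
    where
    l : ∀ α → (1ℚ + 0ℚ + α * 0ℚ) * 1ℚ + 0ℚ ≡ 1ℚ
    l = solve-∀ ring
  jack-lead (suc d) v e = trans (pair-jack (δ₁ v)) (trans (cong₂ (λ x y → (α * ι (suc b) + ι (suc (below bs k₀ b))) * x + y)
      (trans (pair-cong (jack d (star v)) same) (jack-lead d (star v) (sum-star v e)))
      (above-> k₀ (λ i → pair (jack d (star v)) (δ₁ v ∘ A i)) none)) (QP.+-identityʳ ((α * ι (suc b) + ι (suc (below bs k₀ b))) * lead d (star v))))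
    where
    open Jack d v
    same : ∀ β → δ₁ v (A k₀ β) ≡ δ₁ (star v) β
    same β with VP.≡-dec NP._≟_ (star v) β
    ... | yes refl = trans (cong (δ₁ v) (A-star v e)) (δ₁-refl v)
    ... | no ne = δ₁-≢ (λ eq → ne (A-injective (trans (A-star v e) eq)))
      where
      A-injective : ∀ {β β'} → A k₀ β ≡ A k₀ β' → β ≡ β'
      A-injective {x ∷ xs} {y ∷ ys} eq = cong₂ _∷_
        (NP.suc-injective (trans (sym (VP.insertAt-lookup xs k₀ (suc x))) (trans (cong (λ u → lookup u k₀) eq) (VP.insertAt-lookup ys k₀ (suc y)))))
        (vec-ext (λ k → trans (sym (VP.insertAt-punchIn xs k₀ (suc x) k)) (trans (cong (λ u → lookup u (punchIn k₀ k)) eq) (VP.insertAt-punchIn ys k₀ (suc y) k))))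
    none : ∀ i → toℕ k₀ ℕ.< toℕ i → pair (jack d (star v)) (δ₁ v ∘ A i) ≡ 0ℚ
    none i lt = trans (pair-cong (jack d (star v)) {g = λ a → 0ℚ * 0ℚ} (λ β → δ₁-≢ (differs β)))
      (trans (pair-scaled (jack d (star v)) (λ _ → 0ℚ) 0ℚ) (QP.*-zeroˡ (pair (jack d (star v)) (λ _ → 0ℚ))))
      where
      differs : ∀ β → v ≢ A i β
      differs (x ∷ xs) eq with () ← trans (sym (lastNonzero-after v i lt)) (trans (cong (λ u → lookup u i) eq) (VP.insertAt-lookup xs i (suc x)))

  interp-lead : ∀ {m} (v : Comp (suc m)) → pair (interp v) (δ₁ v) ≡ lead (V.sum v) v
  interp-lead v = trans (pair-bindT (jack (V.sum v) v) (barMon (V.sum v)) (δ₁ v))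
    (trans (jack-homogeneous (V.sum v) v (λ β → pair (barMon (V.sum v) β) (δ₁ v)) (δ₁ v)
      (λ β e → barMon-top (V.sum v) β (δ₁ v) e (λ a lt → δ₁-≢ {γ = v} {a} (λ { refl → NP.<-irrefl refl lt }))))
      (jack-lead (V.sum v) v refl))

-- Polynomials over ℚ and uniqueness of interpolation

cop1 : ∀ n → C.Coprime n 1
cop1 n = C.sym (C.1-coprimeTo n)

ι-mkℚ : ∀ n → ι n ≡ mkℚ (ℤ.+ n) 0 (cop1 n)
ι-mkℚ zero = refl
ι-mkℚ (suc n) = trans (cong (1ℚ +_) (ι-mkℚ n)) (trans (cong (λ z → (ℤ.+ 1 ℤ.+ z) ℚ./ 1) (ZP.*-identityʳ (ℤ.+ n)))
  (QP.normalize-coprime (cop1 (suc n))))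

ι-normalize : ∀ n → ι n ≡ ℚ.normalize n 1
ι-normalize n = trans (ι-mkℚ n) (sym (QP.normalize-coprime (cop1 n)))

archimedean : ∀ q → Σ ℕ λ M → q ℚ.≤ ι M
archimedean q@(mkℚ n d c) = ℤ.∣ n ∣ , subst (q ℚ.≤_) (sym (ι-mkℚ ℤ.∣ n ∣)) (ℚ.*≤* (subst (ℤ._≤ (ℤ.+ ℤ.∣ n ∣) ℤ.* (ℤ.+ suc d)) (sym (ZP.*-identityʳ n))
  (ZP.≤-trans (i≤∣i∣ n) (ZP.≤-trans (ZP.≤-reflexive (sym (ZP.*-identityʳ (ℤ.+ ℤ.∣ n ∣)))) (ZP.*-monoˡ-≤-nonNeg (ℤ.+ ℤ.∣ n ∣) (ℤ.+≤+ (ℕ.s≤s ℕ.z≤n)))))))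
  where
  i≤∣i∣ : ∀ i → i ℤ.≤ ℤ.+ ℤ.∣ i ∣
  i≤∣i∣ (ℤ.+ n) = ZP.≤-refl
  i≤∣i∣ (ℤ.-[1+ n ]) = ℤ.-≤+

evP : List ℚ → ℚ → ℚ
evP [] y = 0ℚ
evP (a ∷ p) y = a + y * evP p y

-- A uniform lower bound `1/(N + 1)` for all `t` from `T` on. Positivity alone would not survive the
-- step from `f` to `a + t f`.
EventuallyPositive : (ℕ → ℚ) → Set
EventuallyPositive f = Σ ℕ λ T → Σ ℕ λ N → ∀ t → T ℕ.≤ t → 1ℚ ℚ.≤ ι (suc N) * f t

ι-positive : ∀ N → ℚ.Positive (ι (suc N))
ι-positive N = ℚ.positive (QP.<-≤-trans (QP.positive⁻¹ 1ℚ) (QP.≤-trans (QP.≤-reflexive (sym (QP.+-identityʳ 1ℚ))) (QP.+-monoʳ-≤ 1ℚ (ι-nonneg N))))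

ι-mono : ∀ {m n} → m ℕ.≤ n → ι m ℚ.≤ ι n
ι-mono {n = n} z≤n = ι-nonneg n
ι-mono (s≤s h) = QP.+-monoʳ-≤ 1ℚ (ι-mono h)

eventually-≢0 : ∀ {f} (h : EventuallyPositive f) t → proj₁ h ℕ.≤ t → f t ≢ 0ℚ
eventually-≢0 (T , N , h) t le e = QP.<-irrefl refl (QP.<-≤-trans (QP.positive⁻¹ 1ℚ) (QP.≤-trans (h t le) (QP.≤-reflexive (trans (cong (ι (suc N) *_) e) (QP.*-zeroʳ (ι (suc N)))))))

positive-constant : ∀ a → 0ℚ ℚ.< a → Σ ℕ λ N → 1ℚ ℚ.≤ ι (suc N) * a
positive-constant a a>0 with inverse a (pos⇒≢0 a>0)
... | u , h with archimedean u
... | M , u≤M = M , QP.≤-trans (QP.≤-reflexive (sym h)) (QP.*-monoʳ-≤-nonNeg a {{ℚ.nonNegative (QP.<⇒≤ a>0)}} (QP.≤-trans u≤M (ι-mono (NP.n≤1+n M))))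

eventually-step : ∀ a f → EventuallyPositive f → EventuallyPositive (λ t → a + ι t * f t)
eventually-step a f (T , N , h) with archimedean (- a)
-- From `t ≥ (N + 1)(M + 1)` follows `t f ≥ M + 1`, and `-a ≤ M` then gives `a + t f ≥ 1`; the old
-- `N` still serves.
... | M , -a≤M = T ℕ.⊔ (suc N ℕ.* suc M) , N , λ t le → QP.≤-trans (1≤ N) (QP.≤-trans (bound t (NP.≤-trans (NP.m≤n⊔m T (suc N ℕ.* suc M)) le) (h t (NP.≤-trans (NP.m≤m⊔n T (suc N ℕ.* suc M)) le)))
    (QP.≤-reflexive (l₂ (ι (suc N)) a (ι t) (f t))))
  where
  l₁ : ∀ n a M → n * (a + (1ℚ + M)) ≡ n * a + n * (1ℚ + M)
  l₁ = solve-∀ ring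
  l₂ : ∀ n a t f → n * a + t * (n * f) ≡ n * (a + t * f)
  l₂ = solve-∀ ring
  l₃ : ∀ a M → 1ℚ + (a + M) ≡ a + (1ℚ + M)
  l₃ = solve-∀ ring
  1≤ : ∀ N → 1ℚ ℚ.≤ ι (suc N)
  1≤ N = QP.≤-trans (QP.≤-reflexive (sym (QP.+-identityʳ 1ℚ))) (QP.+-monoʳ-≤ 1ℚ (ι-nonneg N))
  0≤a+M : 0ℚ ℚ.≤ a + ι M
  0≤a+M = QP.≤-trans (QP.≤-reflexive (sym (QP.+-inverseʳ a))) (QP.+-monoʳ-≤ a -a≤M)
  bound : ∀ t → suc N ℕ.* suc M ℕ.≤ t → 1ℚ ℚ.≤ ι (suc N) * f t → ι (suc N) ℚ.≤ ι (suc N) * a + ι t * (ι (suc N) * f t)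
  bound t le h = QP.≤-trans (QP.≤-reflexive (sym (QP.*-identityʳ (ι (suc N))))) (QP.≤-trans
    (QP.*-monoˡ-≤-nonNeg (ι (suc N)) {{QP.pos⇒nonNeg (ι (suc N)) {{ι-positive N}}}} (QP.≤-trans (QP.≤-reflexive (sym (QP.+-identityʳ 1ℚ))) (QP.≤-trans (QP.+-monoʳ-≤ 1ℚ 0≤a+M) (QP.≤-reflexive (l₃ a (ι M))))))
    (QP.≤-trans (QP.≤-reflexive (l₁ (ι (suc N)) a (ι M))) (QP.+-monoʳ-≤ (ι (suc N) * a) (QP.≤-trans (QP.≤-reflexive (sym (ι-* (suc N) (suc M)))) (QP.≤-trans (ι-mono le)
      (QP.≤-trans (QP.≤-reflexive (sym (QP.*-identityʳ (ι t)))) (QP.*-monoˡ-≤-nonNeg (ι t) {{ℚ.nonNegative (ι-nonneg t)}} h)))))))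

evP-zero : ∀ p → All (_≡ 0ℚ) p → ∀ y → evP p y ≡ 0ℚ
evP-zero [] [] y = refl
evP-zero (a ∷ p) (e ∷ es) y = trans (cong₂ (λ x z → x + y * z) e (evP-zero p es y)) (trans (QP.+-identityˡ (y * 0ℚ)) (QP.*-zeroʳ y))

eventually-cong : ∀ {f g} → (∀ t → f t ≡ g t) → EventuallyPositive f → EventuallyPositive g
eventually-cong f≡g (T , N , h) = T , N , λ t le → QP.≤-trans (h t le) (QP.≤-reflexive (cong (ι (suc N) *_) (f≡g t)))

eventually-constant : ∀ a → 0ℚ ℚ.< a → EventuallyPositive (λ _ → a)
eventually-constant a a>0 = 0 , proj₁ (positive-constant a a>0) , λ _ _ → proj₂ (positive-constant a a>0)

-- The sign for large arguments is that of the leading coefficient, which Horner's form brings to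
-- the surface last. This decides whether a polynomial is zero without counting roots.
polynomial-sign : ∀ p → All (_≡ 0ℚ) p ⊎ EventuallyPositive (λ t → evP p (ι t)) ⊎ EventuallyPositive (λ t → - evP p (ι t))
polynomial-sign [] = inj₁ []
polynomial-sign (a ∷ p) = step (polynomial-sign p)
  where
  l : ∀ a t e → - a + t * - e ≡ - (a + t * e)
  l = solve-∀ ring
  l₁ : ∀ a t → a ≡ a + t * 0ℚ
  l₁ = solve-∀ ring
  by-constant : All (_≡ 0ℚ) p → ∀ t → a ≡ a + ι t * evP p (ι t)
  by-constant z t = trans (l₁ a (ι t)) (cong (λ x → a + ι t * x) (sym (evP-zero p z (ι t))))
  constant-sign : All (_≡ 0ℚ) p → Tri (a ℚ.< 0ℚ) (a ≡ 0ℚ) (0ℚ ℚ.< a) →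
    All (_≡ 0ℚ) (a ∷ p) ⊎ EventuallyPositive (λ t → a + ι t * evP p (ι t)) ⊎ EventuallyPositive (λ t → - (a + ι t * evP p (ι t)))
  constant-sign z (tri≈ _ e _) = inj₁ (e ∷ z)
  constant-sign z (tri> _ _ gt) = inj₂ (inj₁ (eventually-cong {λ _ → a} (by-constant z) (eventually-constant a gt)))
  constant-sign z (tri< lt _ _) = inj₂ (inj₂ (eventually-cong {λ _ → - a} (λ t → cong -_ (by-constant z t)) (eventually-constant (- a) (QP.neg-antimono-< lt))))
  step : All (_≡ 0ℚ) p ⊎ EventuallyPositive (λ t → evP p (ι t)) ⊎ EventuallyPositive (λ t → - evP p (ι t)) →
    All (_≡ 0ℚ) (a ∷ p) ⊎ EventuallyPositive (λ t → a + ι t * evP p (ι t)) ⊎ EventuallyPositive (λ t → - (a + ι t * evP p (ι t)))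
  step (inj₁ z) = constant-sign z (QP.<-cmp a 0ℚ)
  step (inj₂ (inj₁ h)) = inj₂ (inj₁ (eventually-step a (λ t → evP p (ι t)) h))
  step (inj₂ (inj₂ h)) = inj₂ (inj₂ (eventually-cong {λ t → - a + ι t * - evP p (ι t)} (λ t → l a (ι t) (evP p (ι t))) (eventually-step (- a) (λ t → - evP p (ι t)) h)))

zero-polynomial : ∀ p T → (∀ t → T ℕ.≤ t → evP p (ι t) ≡ 0ℚ) → All (_≡ 0ℚ) p
zero-polynomial p T h with polynomial-sign p
... | inj₁ z = z
... | inj₂ (inj₁ g) = ⊥-elim (eventually-≢0 g (T ℕ.⊔ proj₁ g) (NP.m≤n⊔m T (proj₁ g)) (h (T ℕ.⊔ proj₁ g) (NP.m≤m⊔n T (proj₁ g))))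
... | inj₂ (inj₂ g) = ⊥-elim (eventually-≢0 g (T ℕ.⊔ proj₁ g) (NP.m≤n⊔m T (proj₁ g)) (cong -_ (h (T ℕ.⊔ proj₁ g) (NP.m≤m⊔n T (proj₁ g)))))

nonzero-polynomial : ∀ p → ¬ All (_≡ 0ℚ) p → Σ ℕ λ T → ∀ t → T ℕ.≤ t → evP p (ι t) ≢ 0ℚ
nonzero-polynomial p nz with polynomial-sign p
... | inj₁ z = ⊥-elim (nz z)
... | inj₂ (inj₁ g) = proj₁ g , eventually-≢0 g
... | inj₂ (inj₂ g) = proj₁ g , λ t le e → eventually-≢0 g t le (cong -_ e)

sumL-++ : ∀ {A : Set} (f : A → ℚ) as bs → sumL f (as ++ bs) ≡ sumL f as + sumL f bs
sumL-++ f [] bs = sym (QP.+-identityˡ (sumL f bs))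
sumL-++ f (a ∷ as) bs = trans (cong (f a +_) (sumL-++ f as bs)) (sym (QP.+-assoc (f a) (sumL f as) (sumL f bs)))

sumL-concatMap : ∀ {A B : Set} (f : B → ℚ) (g : A → List B) as → sumL f (L.concatMap g as) ≡ sumL (λ a → sumL f (g a)) as
sumL-concatMap f g [] = refl
sumL-concatMap f g (a ∷ as) = trans (sumL-++ f (g a) (L.concatMap g as)) (cong (sumL f (g a) +_) (sumL-concatMap f g as))

sumL-applyUpTo : ∀ {A : Set} (f : A → ℚ) g n → sumL f (L.applyUpTo g n) ≡ pre (f ∘ g) n
sumL-applyUpTo f g zero = refl
sumL-applyUpTo f g (suc n) = trans (cong (f (g 0) +_) (sumL-applyUpTo f (g ∘ suc) n)) (sym (pre-head (f ∘ g) n))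

sumL-comps : ∀ n d (f : Comp (suc n) → ℚ) → sumL f (comps (suc n) d) ≡ pre (λ k → sumL (f ∘ (k ∷_)) (comps n (d ∸ k))) (suc d)
sumL-comps n d f = trans (sumL-concatMap f (λ k → L.map (k ∷_) (comps n (d ∸ k))) (L.upTo (suc d)))
  (trans (sumL-cong (L.upTo (suc d)) (λ k → sumL-map f (k ∷_) (comps n (d ∸ k)))) (sumL-applyUpTo (λ k → sumL (f ∘ (k ∷_)) (comps n (d ∸ k))) id (suc d)))

pre-scaled : ∀ c f b → pre (λ l → c * f l) b ≡ c * pre f b
pre-scaled c f zero = sym (QP.*-zeroʳ c)
pre-scaled c f (suc b) = trans (cong (_+ c * f b) (pre-scaled c f b)) (sym (QP.*-distribˡ-+ c (pre f b) (f b)))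

evP-applyUpTo : ∀ a n y → evP (L.applyUpTo a n) y ≡ pre (λ k → pw y k * a k) n
evP-applyUpTo a zero y = refl
evP-applyUpTo a (suc n) y = trans (cong₂ _+_ (sym (QP.*-identityˡ (a 0))) (trans (cong (y *_) (evP-applyUpTo (a ∘ suc) n y))
    (trans (sym (pre-scaled y (λ k → pw y k * a (suc k)) n)) (pre-cong n (λ k _ → sym (QP.*-assoc y (pw y k) (a (suc k))))))))
  (sym (pre-head (λ k → pw y k * a k) n))

polyQ : ∀ n d → (Comp n → ℚ) → Vec ℚ n → ℚ
polyQ n d c y = sumL (λ β → c β * mono y β) (comps n d)

polyQ-suc : ∀ n d c y ys → polyQ (suc n) d c (y ∷ ys) ≡ pre (λ k → pw y k * polyQ n (d ∸ k) (c ∘ (k ∷_)) ys) (suc d)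
polyQ-suc n d c y ys = trans (sumL-comps n d (λ β → c β * mono (y ∷ ys) β)) (pre-cong (suc d) (λ k _ →
    trans (sumL-cong (comps n (d ∸ k)) (λ β → l (c (k ∷ β)) (pw y k) (mono ys β))) (sumL-scaled (λ β → c (k ∷ β) * mono ys β) (pw y k) (comps n (d ∸ k)))))
  where
  l : ∀ c p m → c * (p * m) ≡ p * (c * m)
  l = solve-∀ ring

-- With the other variables fixed, the function is a polynomial in the first variable that vanishes
-- at all natural numbers; its coefficients vanish for every choice of the others, and induction
-- applies to them.
polyQ-zero : ∀ n d c → (∀ y → polyQ n d c y ≡ 0ℚ) → ∀ β → V.sum β ℕ.≤ d → c β ≡ 0ℚ
polyQ-zero zero d c h [] le = trans (l (c [])) (h [])
  where
  l : ∀ x → x ≡ x * 1ℚ + 0ℚ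
  l = solve-∀ ring
polyQ-zero (suc n) d c h (k ∷ β) le = polyQ-zero n (d ∸ k) (c ∘ (k ∷_)) vanish β (subst (ℕ._≤ d ∸ k) (NP.m+n∸m≡n k (V.sum β)) (NP.∸-monoˡ-≤ k le))
  where
  vanish : ∀ ys → polyQ n (d ∸ k) (c ∘ (k ∷_)) ys ≡ 0ℚ
  vanish ys = AllP.applyUpTo⁻ (λ k → polyQ n (d ∸ k) (c ∘ (k ∷_)) ys) (suc d)
    (zero-polynomial _ 0 (λ t _ → trans (evP-applyUpTo (λ k → polyQ n (d ∸ k) (c ∘ (k ∷_)) ys) (suc d) (ι t)) (trans (sym (polyQ-suc n d c (ι t) ys)) (h (ι t ∷ ys)))))
    (s≤s (NP.≤-trans (NP.m≤m+n k (V.sum β)) le))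

-- Polynomials as syntax, with an upper bound for the degree as index: uniqueness needs affine
-- substitution and division by a variable, and the latter must lower the bound.
data Expr (n : ℕ) : ℕ → Set where
  con : ∀ {d} → ℚ → Expr n d
  _⊞_ : ∀ {d} → Expr n d → Expr n d → Expr n d
  var : ∀ {d} → Fin n → Expr n d → Expr n (suc d)

⟦_⟧ : ∀ {n d} → Expr n d → Vec ℚ n → ℚ
⟦ con c ⟧ x = c
⟦ e ⊞ f ⟧ x = ⟦ e ⟧ x + ⟦ f ⟧ x
⟦ var i e ⟧ x = lookup x i * ⟦ e ⟧ x

constant : ∀ {n} (e : Expr n 0) x y → ⟦ e ⟧ x ≡ ⟦ e ⟧ y
constant (con c) x y = refl
constant (e ⊞ f) x y = cong₂ _+_ (constant e x y) (constant f x y)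

weaken : ∀ {n d d'} → d ℕ.≤ d' → Expr n d → Expr n d'
weaken le (con c) = con c
weaken le (e ⊞ f) = weaken le e ⊞ weaken le f
weaken (s≤s le) (var i e) = var i (weaken le e)

⟦weaken⟧ : ∀ {n d d'} (le : d ℕ.≤ d') (e : Expr n d) x → ⟦ weaken le e ⟧ x ≡ ⟦ e ⟧ x
⟦weaken⟧ le (con c) x = refl
⟦weaken⟧ le (e ⊞ f) x = cong₂ _+_ (⟦weaken⟧ le e x) (⟦weaken⟧ le f x)
⟦weaken⟧ (s≤s le) (var i e) x = cong (lookup x i *_) (⟦weaken⟧ le e x)

scaleE : ∀ {n d} → ℚ → Expr n d → Expr n d
scaleE c (con a) = con (c * a)
scaleE c (e ⊞ f) = scaleE c e ⊞ scaleE c f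
scaleE c (var i e) = var i (scaleE c e)

⟦scaleE⟧ : ∀ {n d} c (e : Expr n d) x → ⟦ scaleE c e ⟧ x ≡ c * ⟦ e ⟧ x
⟦scaleE⟧ c (con a) x = refl
⟦scaleE⟧ c (e ⊞ f) x = trans (cong₂ _+_ (⟦scaleE⟧ c e x) (⟦scaleE⟧ c f x)) (sym (QP.*-distribˡ-+ c (⟦ e ⟧ x) (⟦ f ⟧ x)))
⟦scaleE⟧ c (var i e) x = trans (cong (lookup x i *_) (⟦scaleE⟧ c e x)) (*-left-comm (lookup x i) c (⟦ e ⟧ x))

-- the quotient by the last variable
quot : ∀ {n d} → Expr (suc n) d → Expr (suc n) (ℕ.pred d)
quot (con c) = con 0ℚ
quot (e ⊞ f) = quot e ⊞ quot f
quot {n} (var {d} i e) with i FP.≟ fromℕ n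
... | yes _ = e
quot {n} (var {zero} i e) | no _ = con 0ℚ
quot {n} (var {suc d} i e) | no _ = var i (quot e)

-- Division with remainder by the last variable, the remainder being the restriction to 0. Another
-- variable times an expression of bound 0 has quotient 0, as that expression is constant.
⟦quot⟧ : ∀ {n d} (e : Expr (suc n) d) v x → ⟦ e ⟧ (v ∷ʳ x) ≡ ⟦ e ⟧ (v ∷ʳ 0ℚ) + x * ⟦ quot e ⟧ (v ∷ʳ x)
⟦quot⟧ (con c) v x = l c x
  where
  l : ∀ c x → c ≡ c + x * 0ℚ
  l = solve-∀ ring
⟦quot⟧ (e ⊞ f) v x = trans (cong₂ _+_ (⟦quot⟧ e v x) (⟦quot⟧ f v x)) (l (⟦ e ⟧ (v ∷ʳ 0ℚ)) (⟦ f ⟧ (v ∷ʳ 0ℚ)) x (⟦ quot e ⟧ (v ∷ʳ x)) (⟦ quot f ⟧ (v ∷ʳ x)))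
  where
  l : ∀ a b x p q → a + x * p + (b + x * q) ≡ a + b + x * (p + q)
  l = solve-∀ ring
⟦quot⟧ {n} (var {d} i e) v x with i FP.≟ fromℕ n
... | yes refl rewrite lookup-∷ʳ-last v x | lookup-∷ʳ-last v 0ℚ = l x (⟦ e ⟧ (v ∷ʳ x)) (⟦ e ⟧ (v ∷ʳ 0ℚ))
  where
  l : ∀ x a b → x * a ≡ 0ℚ * b + x * a
  l = solve-∀ ring
⟦quot⟧ {n} (var {zero} i e) v x | no i≢ = trans (cong₂ _*_ (lookup-∷ʳ-not-last v x 0ℚ i i≢) (constant e (v ∷ʳ x) (v ∷ʳ 0ℚ))) (l (lookup (v ∷ʳ 0ℚ) i * ⟦ e ⟧ (v ∷ʳ 0ℚ)) x)
  where
  l : ∀ c x → c ≡ c + x * 0ℚ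
  l = solve-∀ ring
⟦quot⟧ {n} (var {suc d} i e) v x | no i≢ = trans (cong (lookup (v ∷ʳ x) i *_) (⟦quot⟧ e v x)) (trans
    (l (lookup (v ∷ʳ x) i) (⟦ e ⟧ (v ∷ʳ 0ℚ)) x (⟦ quot e ⟧ (v ∷ʳ x))) (cong (λ y → y * ⟦ e ⟧ (v ∷ʳ 0ℚ) + x * (lookup (v ∷ʳ x) i * ⟦ quot e ⟧ (v ∷ʳ x))) (lookup-∷ʳ-not-last v x 0ℚ i i≢)))
  where
  l : ∀ y a x q → y * (a + x * q) ≡ y * a + x * (y * q)
  l = solve-∀ ring

-- An affine form: a variable plus a constant, or a constant alone. Substituting such forms
-- preserves the degree bound.
Form : ℕ → Set
Form n = Maybe (Fin n) × ℚ

evF : ∀ {n} → Vec ℚ n → Form n → ℚ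
evF y (just j , b) = lookup y j + b
evF y (nothing , b) = b

substE : ∀ {n n' d} → Vec (Form n') n → Expr n d → Expr n' d
substE σ (con c) = con c
substE σ (e ⊞ f) = substE σ e ⊞ substE σ f
substE σ (var {d} i e) with lookup σ i
... | just j , b = var j (substE σ e) ⊞ weaken (NP.n≤1+n d) (scaleE b (substE σ e))
... | nothing , b = weaken (NP.n≤1+n d) (scaleE b (substE σ e))

⟦substE⟧ : ∀ {n n' d} (σ : Vec (Form n') n) (e : Expr n d) y → ⟦ substE σ e ⟧ y ≡ ⟦ e ⟧ (V.map (evF y) σ)
⟦substE⟧ σ (con c) y = refl
⟦substE⟧ σ (e ⊞ f) y = cong₂ _+_ (⟦substE⟧ σ e y) (⟦substE⟧ σ f y)
⟦substE⟧ σ (var {d} i e) y rewrite VP.lookup-map i (evF y) σ with lookup σ i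
... | just j , b = trans (cong (lookup y j * ⟦ substE σ e ⟧ y +_) (trans (⟦weaken⟧ (NP.n≤1+n d) (scaleE b (substE σ e)) y) (⟦scaleE⟧ b (substE σ e) y)))
    (trans (sym (QP.*-distribʳ-+ (⟦ substE σ e ⟧ y) (lookup y j) b)) (cong ((lookup y j + b) *_) (⟦substE⟧ σ e y)))
... | nothing , b = trans (⟦weaken⟧ (NP.n≤1+n d) (scaleE b (substE σ e)) y) (trans (⟦scaleE⟧ b (substE σ e) y) (cong (b *_) (⟦substE⟧ σ e y)))

-- Chosen to match `ŷ-∷ʳ0`, as `rotateAll` matches `ŷ-Φ`.
shiftAll : ∀ n → Vec (Form n) (suc n)
shiftAll n = V.tabulate (λ j → just j , 1ℚ) ∷ʳ (nothing , 0ℚ)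

evF-shiftAll : ∀ {n} (y : Vec ℚ n) → V.map (evF y) (shiftAll n) ≡ V.map (1ℚ +_) y ∷ʳ 0ℚ
evF-shiftAll {n} y = trans (VP.map-∷ʳ (evF y) (nothing , 0ℚ) (V.tabulate (λ j → just j , 1ℚ))) (cong (_∷ʳ 0ℚ) (vec-ext (λ k →
  trans (VP.lookup-map k (evF y) (V.tabulate (λ j → just j , 1ℚ))) (trans (cong (evF y) (VP.lookup∘tabulate (λ j → just j , 1ℚ) k))
    (trans (QP.+-comm (lookup y k) 1ℚ) (sym (VP.lookup-map k (1ℚ +_) y)))))))

rotateAll : ∀ n → ℚ → Vec (Form (suc n)) (suc n)
rotateAll n α = V.tabulate (λ j → just (suc j) , 0ℚ) ∷ʳ (just zero , α)

evF-rotateAll : ∀ {n} α x (y : Vec ℚ n) → V.map (evF (x ∷ y)) (rotateAll n α) ≡ y ∷ʳ (x + α)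
evF-rotateAll {n} α x y = trans (VP.map-∷ʳ (evF (x ∷ y)) (just zero , α) (V.tabulate (λ j → just (suc j) , 0ℚ))) (cong (_∷ʳ (x + α)) (vec-ext (λ k →
  trans (VP.lookup-map k (evF (x ∷ y)) (V.tabulate (λ j → just (suc j) , 0ℚ))) (trans (cong (evF (x ∷ y)) (VP.lookup∘tabulate (λ j → just (suc j) , 0ℚ) k))
    (QP.+-identityʳ (lookup y k))))))

powE : ∀ {n d} → Fin n → ∀ k → Expr n d → Expr n (k ℕ.+ d)
powE i zero e = e
powE i (suc k) e = var i (powE i k e)

⟦powE⟧ : ∀ {n d} i k (e : Expr n d) x → ⟦ powE i k e ⟧ x ≡ pw (lookup x i) k * ⟦ e ⟧ x
⟦powE⟧ i zero e x = sym (QP.*-identityˡ (⟦ e ⟧ x))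
⟦powE⟧ i (suc k) e x = trans (cong (lookup x i *_) (⟦powE⟧ i k e x)) (sym (QP.*-assoc (lookup x i) (pw (lookup x i) k) (⟦ e ⟧ x)))

monoE : ∀ {n N} → (Fin n → Fin N) → (β : Comp n) → Expr N (V.sum β)
monoE f [] = con 1ℚ
monoE f (b ∷ β) = powE (f zero) b (monoE (f ∘ suc) β)

⟦monoE⟧ : ∀ {n N} (f : Fin n → Fin N) β x y → (∀ k → lookup x (f k) ≡ lookup y k) → ⟦ monoE f β ⟧ x ≡ mono y β
⟦monoE⟧ f [] x [] h = refl
⟦monoE⟧ f (b ∷ β) x (y ∷ ys) h = trans (⟦powE⟧ (f zero) b (monoE (f ∘ suc) β) x) (cong₂ (λ z w → pw z b * w) (h zero) (⟦monoE⟧ (f ∘ suc) β x ys (h ∘ suc)))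

comps-degree : ∀ n d → All (λ β → V.sum β ℕ.≤ d) (comps n d)
comps-degree zero d = z≤n ∷ []
comps-degree (suc n) d = AllP.concat⁺ (AllP.map⁺ (AllP.applyUpTo⁺₁ id (suc d) (λ {k} k<d → AllP.map⁺ (All.map (λ {β} le →
  NP.≤-trans (NP.+-monoʳ-≤ k le) (NP.≤-reflexive (NP.m+[n∸m]≡n (NP.≤-pred k<d)))) (comps-degree n (d ∸ k))))))

polyE : ∀ {n d} (c : Comp n → ℚ) {βs : List (Comp n)} → All (λ β → V.sum β ℕ.≤ d) βs → Σ (Expr n d) λ e → ∀ x → ⟦ e ⟧ x ≡ sumL (λ β → c β * mono x β) βs
polyE c [] = con 0ℚ , λ x → refl
polyE c (_∷_ {β} le les) with polyE c les
... | e , h = weaken le (scaleE (c β) (monoE id β)) ⊞ e , λ x → cong₂ _+_ (trans (⟦weaken⟧ le (scaleE (c β) (monoE id β)) x)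
  (trans (⟦scaleE⟧ (c β) (monoE id β) x) (cong (c β *_) (⟦monoE⟧ id β x x (λ k → refl))))) (h x)

module Unique (α : ℚ) (α>0 : 0ℚ ℚ.< α) where
  open Points α α>0
  open Eval α α>0

  -- On the hyperplane where the last variable vanishes this is the case n - 1; the quotient by the
  -- last variable is, after rotation, the case d - 1.
  unique : ∀ n d (e : Expr n d) → (∀ γ → V.sum γ ℕ.≤ d → ⟦ e ⟧ (ŷ γ) ≡ 0ℚ) → ∀ x → ⟦ e ⟧ x ≡ 0ℚ
  unique-on-hyperplane : ∀ n d (e : Expr (suc n) d) → (∀ γ → V.sum γ ℕ.≤ d → ⟦ e ⟧ (ŷ γ) ≡ 0ℚ) → ∀ v → ⟦ e ⟧ (v ∷ʳ 0ℚ) ≡ 0ℚ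
  unique-on-hyperplane n d e h v = trans (cong (λ u → ⟦ e ⟧ (u ∷ʳ 0ℚ)) (sym shifted)) (trans (sym (value (V.map (- 1ℚ +_) v)))
      (unique n d (substE (shiftAll n) e) (λ γ le → trans (value (ŷ γ)) (trans (cong ⟦ e ⟧ (sym (ŷ-∷ʳ0 γ)))
        (h (γ ∷ʳ 0) (NP.≤-trans (NP.≤-reflexive (trans (sum-∷ʳ γ 0) (NP.+-identityʳ (V.sum γ)))) le)))) (V.map (- 1ℚ +_) v)))
    where
    value : ∀ y → ⟦ substE (shiftAll n) e ⟧ y ≡ ⟦ e ⟧ (V.map (1ℚ +_) y ∷ʳ 0ℚ)
    value y = trans (⟦substE⟧ (shiftAll n) e y) (cong ⟦ e ⟧ (evF-shiftAll y))
    l : ∀ a → 1ℚ + (- 1ℚ + a) ≡ a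
    l = solve-∀ ring
    shifted : V.map (1ℚ +_) (V.map (- 1ℚ +_) v) ≡ v
    shifted = vec-ext (λ k → trans (VP.lookup-map k (1ℚ +_) (V.map (- 1ℚ +_) v)) (trans (cong (1ℚ +_) (VP.lookup-map k (- 1ℚ +_) v)) (l (lookup v k))))
  unique zero d e h [] = h [] z≤n
  unique (suc n) zero e h x = trans (constant e x (V.init x ∷ʳ 0ℚ)) (unique-on-hyperplane n zero e h (V.init x))
  unique (suc n) (suc d) e h x = trans (cong ⟦ e ⟧ (unsnoc x)) (trans (factor (V.init x) (lookup x (fromℕ n)))
      (trans (cong (lookup x (fromℕ n) *_) (trans (cong (λ z → ⟦ g ⟧ (V.init x ∷ʳ z)) (l (lookup x (fromℕ n)) α)) (trans (sym (value (lookup x (fromℕ n) - α) (V.init x)))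
        (unique (suc n) d g' at-points ((lookup x (fromℕ n) - α) ∷ V.init x))))) (QP.*-zeroʳ (lookup x (fromℕ n)))))
    where
    g = quot e
    l : ∀ x a → x ≡ x - a + a
    l = solve-∀ ring
    factor : ∀ v z → ⟦ e ⟧ (v ∷ʳ z) ≡ z * ⟦ g ⟧ (v ∷ʳ z)
    factor v z = trans (⟦quot⟧ e v z) (trans (cong (_+ z * ⟦ g ⟧ (v ∷ʳ z)) (unique-on-hyperplane n (suc d) e h v)) (QP.+-identityˡ (z * ⟦ g ⟧ (v ∷ʳ z))))
    g' = substE (rotateAll n α) g
    value : ∀ z v → ⟦ g' ⟧ (z ∷ v) ≡ ⟦ g ⟧ (v ∷ʳ (z + α))
    value z v = trans (⟦substE⟧ (rotateAll n α) g (z ∷ v)) (cong ⟦ g ⟧ (evF-rotateAll α z v))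
    at-points : ∀ γ → V.sum γ ℕ.≤ d → ⟦ g' ⟧ (ŷ γ) ≡ 0ℚ
    at-points γ@(b ∷ v) le = trans (value (V.head (ŷ γ)) (V.tail (ŷ γ))) (cancel-nonzero nz (trans (sym (factor (V.tail (ŷ γ)) (V.head (ŷ γ) + α)))
        (trans (cong ⟦ e ⟧ (sym (ŷ-Φ γ))) (h (Φ γ) (NP.≤-trans (NP.≤-reflexive (sum-Φ γ)) (s≤s le))))))
      where
      -- The last coordinate of `ŷ (Φ γ)` is positive, so it can be cancelled from the
      -- factorisation.
      nz : V.head (ŷ γ) + α ≢ 0ℚ
      nz = pos⇒≢0 (subst (0ℚ ℚ.<_) (QP.+-comm α (V.head (ŷ γ))) (positive-sum {α} {V.head (ŷ γ)} α>0
        (QP.≤-trans (α*-nonneg b) (QP.≤-trans (QP.≤-reflexive (sym (QP.+-identityʳ (α * ι b)))) (QP.+-monoʳ-≤ (α * ι b) (ρ-nonneg γ zero))))))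

  polyQ-unique : ∀ n d c → (∀ γ → V.sum γ ℕ.≤ d → polyQ n d c (ŷ γ) ≡ 0ℚ) → ∀ β → V.sum β ℕ.≤ d → c β ≡ 0ℚ
  polyQ-unique n d c h with polyE c (comps-degree n d)
  ... | e , ev = polyQ-zero n d c (λ y → trans (sym (ev y)) (unique n d e (λ γ le → trans (ev (ŷ γ)) (h γ le)) y))

-- Comparison of coefficients at a fixed positive `α`

sgn-+ : ∀ a b → sgn (a ℕ.+ b) ≡ sgn a * sgn b
sgn-+ zero b = sym (QP.*-identityˡ (sgn b))
sgn-+ (suc a) b = trans (cong -_ (sgn-+ a b)) (l (sgn a) (sgn b))
  where
  l : ∀ a b → - (a * b) ≡ - a * b
  l = solve-∀ ring

sgn-square : ∀ a → sgn a * sgn a ≡ 1ℚ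
sgn-square zero = refl
sgn-square (suc a) = trans (l (sgn a)) (sgn-square a)
  where
  l : ∀ a → - a * - a ≡ a * a
  l = solve-∀ ring

mono-neg : ∀ {n} (y : Vec ℚ n) μ → mono (V.map -_ y) μ ≡ sgn (V.sum μ) * mono y μ
mono-neg [] [] = refl
mono-neg (y ∷ ys) (k ∷ μ) = trans (cong₂ _*_ (pw-neg k) (mono-neg ys μ)) (trans (l (sgn k) (pw y k) (sgn (V.sum μ)) (mono ys μ))
    (cong (_* (pw y k * mono ys μ)) (sym (sgn-+ k (V.sum μ)))))
  where
  l : ∀ a b c d → a * b * (c * d) ≡ a * c * (b * d)
  l = solve-∀ ring
  l₁ : ∀ a b c → - a * (b * c) ≡ - b * (a * c)
  l₁ = solve-∀ ring
  pw-neg : ∀ k → pw (- y) k ≡ sgn k * pw y k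
  pw-neg zero = refl
  pw-neg (suc k) = trans (cong (- y *_) (pw-neg k)) (l₁ y (sgn k) (pw y k))

sumL-+ : ∀ {A : Set} (f g : A → ℚ) as → sumL (λ a → f a + g a) as ≡ sumL f as + sumL g as
sumL-+ f g [] = refl
sumL-+ f g (a ∷ as) = trans (cong (f a + g a +_) (sumL-+ f g as)) (l (f a) (g a) (sumL f as) (sumL g as))
  where
  l : ∀ a b c d → a + b + (c + d) ≡ a + c + (b + d)
  l = solve-∀ ring

pre-0 : ∀ f b → (∀ l → l ℕ.< b → f l ≡ 0ℚ) → pre f b ≡ 0ℚ
pre-0 f zero h = refl
pre-0 f (suc b) h = cong₂ _+_ (pre-0 f b (λ l lt → h l (NP.m<n⇒m<1+n lt))) (h b NP.≤-refl)

pre-single : ∀ f k b → k ℕ.< b → (∀ l → l ≢ k → f l ≡ 0ℚ) → pre f b ≡ f k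
pre-single f k (suc b) (s≤s k≤b) h with k ℕ.≟ b
... | yes refl = trans (cong (_+ f k) (pre-0 f k (λ l lt → h l (λ { refl → NP.<-irrefl refl lt })))) (QP.+-identityˡ (f k))
... | no k≢b = trans (cong₂ _+_ (pre-single f k b (NP.≤∧≢⇒< k≤b k≢b) h) (h b (k≢b ∘ sym))) (QP.+-identityʳ (f k))

δ₁-∷ : ∀ {n} k (β a : Comp n) → δ₁ (k ∷ β) (k ∷ a) ≡ δ₁ β a
δ₁-∷ k β a = go (VP.≡-dec NP._≟_ β a)
  where
  go : Dec (β ≡ a) → δ₁ (k ∷ β) (k ∷ a) ≡ δ₁ β a
  go (yes refl) = trans (δ₁-refl (k ∷ β)) (sym (δ₁-refl β))
  go (no ne) = trans (δ₁-≢ {γ = k ∷ β} {k ∷ a} (ne ∘ VP.∷-injectiveʳ)) (sym (δ₁-≢ {γ = β} {a} ne))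

-- It holds because `comps n d` lists every composition of degree at most `d` exactly once.
sum-δ₁ : ∀ n d a (h : Comp n → ℚ) → V.sum a ℕ.≤ d → sumL (λ β → δ₁ β a * h β) (comps n d) ≡ h a
sum-δ₁ zero d [] h le = l (h [])
  where
  l : ∀ x → 1ℚ * x + 0ℚ ≡ x
  l = solve-∀ ring
sum-δ₁ (suc n) d (k ∷ a) h le = trans (sumL-comps n d (λ β → δ₁ β (k ∷ a) * h β)) (trans
    (pre-single (λ l → sumL (λ β → δ₁ (l ∷ β) (k ∷ a) * h (l ∷ β)) (comps n (d ∸ l))) k (suc d) (s≤s (NP.≤-trans (NP.m≤m+n k (V.sum a)) le))
      (λ l l≢k → sumL-0 (λ β → δ₁ (l ∷ β) (k ∷ a) * h (l ∷ β)) (comps n (d ∸ l)) (λ β → trans (cong (_* h (l ∷ β)) (δ₁-≢ {γ = l ∷ β} {k ∷ a} (l≢k ∘ VP.∷-injectiveˡ))) (QP.*-zeroˡ (h (l ∷ β))))))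
    (trans (sumL-cong (comps n (d ∸ k)) (λ β → cong (_* h (k ∷ β)) (δ₁-∷ k β a)))
      (sum-δ₁ n (d ∸ k) a (h ∘ (k ∷_)) (subst (ℕ._≤ d ∸ k) (NP.m+n∸m≡n k (V.sum a)) (NP.∸-monoˡ-≤ k le)))))

polyQ-linear : ∀ n d f g x z y → polyQ n d (λ β → x * f β + z * g β) y ≡ x * polyQ n d f y + z * polyQ n d g y
polyQ-linear n d f g x z y = trans (sumL-cong (comps n d) (λ β → l x (f β) z (g β) (mono y β)))
  (trans (sumL-+ (λ β → x * (f β * mono y β)) (λ β → z * (g β * mono y β)) (comps n d))
    (cong₂ _+_ (sumL-scaled (λ β → f β * mono y β) x (comps n d)) (sumL-scaled (λ β → g β * mono y β) z (comps n d))))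
  where
  l : ∀ x f z g m → (x * f + z * g) * m ≡ x * (f * m) + z * (g * m)
  l = solve-∀ ring

module Main (α : ℚ) (α>0 : 0ℚ ℚ.< α) where
  open Points α α>0
  open Eval α α>0
  open Unique α α>0

  pair-polyQ : ∀ n d (F : Terms (Comp n)) (s : Comp n → ℚ) y → polyQ n d (λ γ → pair F (δ₁ γ) * s γ) y ≡ pair F (λ a → sumL (λ β → δ₁ β a * (s β * mono y β)) (comps n d))
  pair-polyQ n d [] s y = sumL-0 (λ β → 0ℚ * s β * mono y β) (comps n d) (λ β → l (s β) (mono y β))
    where
    l : ∀ a b → 0ℚ * a * b ≡ 0ℚ
    l = solve-∀ ring
  pair-polyQ n d ((c , a) ∷ F) s y = trans (sumL-cong (comps n d) (λ β → l (evN c) (δ₁ β a) (pair F (δ₁ β)) (s β) (mono y β)))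
      (trans (sumL-+ (λ β → evN c * (δ₁ β a * (s β * mono y β))) (λ β → pair F (δ₁ β) * s β * mono y β) (comps n d))
        (cong₂ _+_ (sumL-scaled (λ β → δ₁ β a * (s β * mono y β)) (evN c) (comps n d)) (pair-polyQ n d F s y)))
    where
    l : ∀ c δ p s m → (c * δ + p) * s * m ≡ c * (δ * (s * m)) + p * s * m
    l = solve-∀ ring

  interp-agree : ∀ {m} (v : Comp (suc m)) (f g : Comp (suc m) → ℚ) → (∀ a → V.sum a ℕ.≤ V.sum v → f a ≡ g a) → pair (interp v) f ≡ pair (interp v) g
  interp-agree v f g h = trans (l (pair (interp v) f) (pair (interp v) g)) (trans (cong (_+ pair (interp v) g)
      (trans (sym (pair-linear (interp v) f g 1ℚ (- 1ℚ))) (interp-degree v (λ a → 1ℚ * f a + - 1ℚ * g a) (λ a le → trans (cong (λ x → 1ℚ * x + - 1ℚ * g a) (h a le)) (l₁ (g a))))))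
      (QP.+-identityˡ (pair (interp v) g)))
    where
    l : ∀ a b → a ≡ 1ℚ * a + - 1ℚ * b + b
    l = solve-∀ ring
    l₁ : ∀ a → 1ℚ * a + - 1ℚ * a ≡ 0ℚ
    l₁ = solve-∀ ring

  module _ {m : ℕ} (v : Comp (suc m)) (c : Comp (suc m) → ℚ) (monic : c v ≡ 1ℚ)
      (vanishes : ∀ γ → γ ≢ v → V.sum γ ℕ.≤ V.sum v → polyQ (suc m) (V.sum v) c (ŷ γ) ≡ 0ℚ) where
    private
      d = V.sum v
      K = lead d v

    K≢0 : ∀ d (v : Comp (suc m)) → lead d v ≢ 0ℚ
    K≢0 zero v ()
    K≢0 (suc d) v e = K≢0 d (star v) (cancel-nonzero (pos⇒≢0 (subst (0ℚ ℚ.<_) (QP.+-comm (ι (suc (below bs k₀ b))) (α * ι (suc b)))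
        (positive-sum {ι (suc (below bs k₀ b))} {α * ι (suc b)} (QP.positive⁻¹ (ι (suc (below bs k₀ b))) {{ι-positive (below bs k₀ b)}}) (α*-nonneg (suc b))))) e)
      where open Jack d v

    -- The signs in `g` undo the passage from `x` to `-x`. The aim is that `h` vanishes; its value
    -- at `ŷ v` is not given, only its coefficient at `v`, so uniqueness cannot be applied to it
    -- directly.
    g h : Comp (suc m) → ℚ
    g γ = pair (interp v) (δ₁ γ) * (sgn d * sgn (V.sum γ))
    h γ = 1ℚ * g γ + - K * c γ

    g-vanish : ∀ γ → γ ≢ v → V.sum γ ℕ.≤ d → polyQ (suc m) d g (ŷ γ) ≡ 0ℚ
    g-vanish γ ne le = trans (pair-polyQ (suc m) d (interp v) (λ γ → sgn d * sgn (V.sum γ)) (ŷ γ))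
      (trans (interp-agree v (λ a → sumL (λ β → δ₁ β a * (sgn d * sgn (V.sum β) * mono (ŷ γ) β)) (comps (suc m) d)) (λ a → sgn d * mono (neg (ŷ γ)) a)
        (λ a le → trans (sum-δ₁ (suc m) d a (λ β → sgn d * sgn (V.sum β) * mono (ŷ γ) β) le) (trans (QP.*-assoc (sgn d) (sgn (V.sum a)) (mono (ŷ γ) a)) (cong (sgn d *_) (sym (mono-neg (ŷ γ) a))))))
      (trans (pair-scaled (interp v) (mono (neg (ŷ γ))) (sgn d)) (trans (cong (sgn d *_) (interp-vanish v γ ne le)) (QP.*-zeroʳ (sgn d)))))

    g-v : g v ≡ K
    g-v = trans (cong₂ _*_ (interp-lead v) (sgn-square d)) (QP.*-identityʳ K)

    h-v : h v ≡ 0ℚ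
    h-v = trans (cong₂ (λ x y → 1ℚ * x + - K * y) g-v monic) (l K)
      where
      l : ∀ a → 1ℚ * a + - a * 1ℚ ≡ 0ℚ
      l = solve-∀ ring

    h-vanish : ∀ γ → γ ≢ v → V.sum γ ℕ.≤ d → polyQ (suc m) d h (ŷ γ) ≡ 0ℚ
    h-vanish γ ne le = trans (polyQ-linear (suc m) d g c 1ℚ (- K) (ŷ γ)) (trans (cong₂ (λ x y → 1ℚ * x + - K * y) (g-vanish γ ne le) (vanishes γ ne le)) (l K))
      where
      l : ∀ a → 1ℚ * 0ℚ + - a * 0ℚ ≡ 0ℚ
      l = solve-∀ ring

    hv gv : ℚ
    hv = polyQ (suc m) d h (ŷ v)
    gv = polyQ (suc m) d g (ŷ v)

    -- gv·h − hv·g vanishes at every point, and its coefficient at v is − hv·K.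
    combination : ∀ γ → V.sum γ ℕ.≤ d → polyQ (suc m) d (λ β → gv * h β + - hv * g β) (ŷ γ) ≡ 0ℚ
    combination γ le with VP.≡-dec NP._≟_ γ v
    ... | yes refl = trans (polyQ-linear (suc m) d h g gv (- hv) (ŷ v)) (l gv hv)
      where
      l : ∀ a b → a * b + - b * a ≡ 0ℚ
      l = solve-∀ ring
    ... | no ne = trans (polyQ-linear (suc m) d h g gv (- hv) (ŷ γ)) (trans (cong₂ (λ x y → gv * x + - hv * y) (h-vanish γ ne le) (g-vanish γ ne le)) (l gv hv))
      where
      l : ∀ a b → a * 0ℚ + - b * 0ℚ ≡ 0ℚ
      l = solve-∀ ring

    hv≡0 : hv ≡ 0ℚ
    hv≡0 = cancel-nonzero (K≢0 d v) (trans (l gv K hv) (cong -_ (trans (sym (cong₂ (λ x y → gv * x + - hv * y) h-v g-v))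
        (polyQ-unique (suc m) d (λ β → gv * h β + - hv * g β) combination v NP.≤-refl))))
      where
      l : ∀ a k h → k * h ≡ - (a * 0ℚ + - h * k)
      l = solve-∀ ring

    h≡0 : ∀ γ → V.sum γ ℕ.≤ d → h γ ≡ 0ℚ
    h≡0 = polyQ-unique (suc m) d h at-points
      where
      at-points : ∀ γ → V.sum γ ℕ.≤ d → polyQ (suc m) d h (ŷ γ) ≡ 0ℚ
      at-points γ le with VP.≡-dec NP._≟_ γ v
      ... | yes refl = hv≡0
      ... | no ne = h-vanish γ ne le

    coefficients : ∀ γ → V.sum γ ℕ.≤ d → sgn (d ℕ.+ V.sum γ) * (K * c γ) ≡ evN (coef (interp v) γ)
    coefficients γ le = trans (cong₂ _*_ (sgn-+ d (V.sum γ)) (trans (l₁ (g γ) K (c γ)) (cong (λ x → g γ - x) (h≡0 γ le))))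
        (trans (l₂ (sgn d) (sgn (V.sum γ)) (pair (interp v) (δ₁ γ))) (trans (cong₂ (λ x y → pair (interp v) (δ₁ γ) * (x * y)) (sgn-square d) (sgn-square (V.sum γ)))
          (trans (QP.*-identityʳ (pair (interp v) (δ₁ γ))) (sym (pair-coef (interp v) γ)))))
      where
      l₁ : ∀ g k c → k * c ≡ g - (1ℚ * g + - k * c)
      l₁ = solve-∀ ring
      l₂ : ∀ a b p → a * b * (p * (a * b) - 0ℚ) ≡ p * (a * a * (b * b))
      l₂ = solve-∀ ring

-- Legs, box products and sorting positions as defined in the statement

bit : Bool → ℕ
bit true = 1
bit false = 0

ι-count : ∀ {n} (p : Fin n → Bool) → ι (count p) ≡ sum (λ k → ι (bit (p k)))
ι-count {n} p = go id
  where
  go : ∀ {k} (f : Fin k → Fin n) → ι (L.length (L.filter (λ i → BP._≟_ (p i) true) (L.tabulate f))) ≡ sum (λ k → ι (bit (p (f k))))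
  go {zero} f = refl
  go {suc k} f with p (f zero)
  ... | true = cong (1ℚ +_) (go (f ∘ suc))
  ... | false = trans (go (f ∘ suc)) (sym (QP.+-identityˡ _))

≤ᵇ-suc : ∀ m n → (suc m ℕ.≤ᵇ suc n) ≡ (m ℕ.≤ᵇ n)
≤ᵇ-suc zero n = refl
≤ᵇ-suc (suc m) n = refl

<ᵇ-true : ∀ {m n} → m ℕ.< n → (m ℕ.<ᵇ n) ≡ true
<ᵇ-true {m} {n} h with m ℕ.<ᵇ n | NP.<⇒<ᵇ h
... | true | _ = refl

<ᵇ-false : ∀ {m n} → n ℕ.≤ m → (m ℕ.<ᵇ n) ≡ false
<ᵇ-false {m} {n} h with m ℕ.<ᵇ n in eq
... | false = refl
... | true = ⊥-elim (NP.<⇒≱ (NP.<ᵇ⇒< m n (subst Bool.T (sym eq) _)) h)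

bit-ind : ∀ a b → bit (a ℕ.≤ᵇ b) ≡ ind a b
bit-ind a b with a ℕ.≤ᵇ b
... | true = refl
... | false = refl

punchIn-<ᵇ : ∀ {m} (i : Fin (suc m)) j k → (toℕ (punchIn i j) ℕ.<ᵇ toℕ (punchIn i k)) ≡ (toℕ j ℕ.<ᵇ toℕ k)
punchIn-<ᵇ zero j k = refl
punchIn-<ᵇ (suc i) zero zero = refl
punchIn-<ᵇ (suc i) zero (suc k) = refl
punchIn-<ᵇ (suc i) (suc j) zero = refl
punchIn-<ᵇ (suc i) (suc j) (suc k) = punchIn-<ᵇ i j k

punchIn-<ᵇ-self : ∀ {m} (i : Fin (suc m)) j → (toℕ (punchIn i j) ℕ.<ᵇ toℕ i) ≡ (toℕ j ℕ.<ᵇ toℕ i)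
punchIn-<ᵇ-self zero j = refl
punchIn-<ᵇ-self (suc i) zero = refl
punchIn-<ᵇ-self (suc i) (suc j) = punchIn-<ᵇ-self i j

self-<ᵇ-punchIn : ∀ {m} (i : Fin (suc m)) (j : Fin m) → toℕ j ℕ.< toℕ i → (toℕ i ℕ.<ᵇ toℕ (punchIn i j)) ≡ false
self-<ᵇ-punchIn (suc i) zero h = refl
self-<ᵇ-punchIn (suc i) (suc j) (s≤s h) = self-<ᵇ-punchIn i j h

legAbove legBelow : ∀ {n} → Comp n → Fin n → ℕ → Fin n → Bool
legAbove η i j k = (toℕ i ℕ.<ᵇ toℕ k) ∧ ((j ℕ.≤ᵇ lookup η k) ∧ (lookup η k ℕ.≤ᵇ lookup η i))
legBelow η i j k = (toℕ k ℕ.<ᵇ toℕ i) ∧ ((j ℕ.≤ᵇ suc (lookup η k)) ∧ (suc (lookup η k) ℕ.≤ᵇ lookup η i))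

ι-leg : ∀ {n} (η : Comp n) i j → ι (leg η i j) ≡ sum (λ k → ι (bit (legAbove η i j k))) + sum (λ k → ι (bit (legBelow η i j k)))
ι-leg η i j = trans (ι-+ (count (legAbove η i j)) (count (legBelow η i j))) (cong₂ _+_ (ι-count (legAbove η i j)) (ι-count (legBelow η i j)))

-- Without the first box of the row at `k₀`, the boxes of `η` correspond to those of `μ`: the row
-- moves to the front with its columns shifted by one, and the other rows keep theirs.
module Legs {m : ℕ} (b : ℕ) (bs : Comp m) (k₀ : Fin (suc m)) (bs-0 : ∀ k → toℕ k₀ ℕ.≤ toℕ k → lookup bs k ≡ 0) where
  η = insertAt bs k₀ (suc b)
  μ = b ∷ bs
  S : (Fin (suc m) → Bool) → ℚ
  S p = sum (λ k → ι (bit (p k)))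
  S-remove : ∀ p → S p ≡ ι (bit (p k₀)) + sum (λ k → ι (bit (p (punchIn k₀ k))))
  S-remove p = sum-punchIn (λ k → ι (bit (p k))) k₀

  η-self : lookup η k₀ ≡ suc b
  η-self = VP.insertAt-lookup bs k₀ (suc b)
  η-other : ∀ k → lookup η (punchIn k₀ k) ≡ lookup bs k
  η-other = VP.insertAt-punchIn bs k₀ (suc b)

  <ᵇ-irrefl : ∀ n → (n ℕ.<ᵇ n) ≡ false
  <ᵇ-irrefl n = <ᵇ-false {n} NP.≤-refl

  rowAbove-0 : ∀ j → S (legAbove η k₀ (suc j)) ≡ 0ℚ
  rowAbove-0 j = trans (S-remove (legAbove η k₀ (suc j))) (cong₂ _+_ self (sum-0 _ other))
    where
    self : ι (bit (legAbove η k₀ (suc j) k₀)) ≡ 0ℚ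
    self rewrite <ᵇ-irrefl (toℕ k₀) = refl
    other : ∀ k → ι (bit (legAbove η k₀ (suc j) (punchIn k₀ k))) ≡ 0ℚ
    other k rewrite η-other k with toℕ k ℕ.<? toℕ k₀
    ... | yes lt rewrite self-<ᵇ-punchIn k₀ k lt = refl
    ... | no ≮ rewrite bs-0 k (NP.≮⇒≥ ≮) = cong (ι ∘ bit) (BP.∧-zeroʳ (toℕ k₀ ℕ.<ᵇ toℕ (punchIn k₀ k)))

  S-below : ∀ j → S (legBelow η k₀ j) ≡ sum (λ k → ι (bit ((toℕ k ℕ.<ᵇ toℕ k₀) ∧ ((j ℕ.≤ᵇ suc (lookup bs k)) ∧ (suc (lookup bs k) ℕ.≤ᵇ suc b)))))
  S-below j = trans (S-remove (legBelow η k₀ j)) (trans (cong₂ _+_ self (sum-cong-≗ other)) (QP.+-identityˡ _))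
    where
    self : ι (bit (legBelow η k₀ j k₀)) ≡ 0ℚ
    self rewrite <ᵇ-irrefl (toℕ k₀) = refl
    other : ∀ k → ι (bit (legBelow η k₀ j (punchIn k₀ k))) ≡ ι (bit ((toℕ k ℕ.<ᵇ toℕ k₀) ∧ ((j ℕ.≤ᵇ suc (lookup bs k)) ∧ (suc (lookup bs k) ℕ.≤ᵇ suc b))))
    other k rewrite η-other k | η-self | punchIn-<ᵇ-self k₀ k = refl

  below-bits : ∀ {m} (bs : Comp m) (j : Fin (suc m)) → sum (λ k → ι (bit ((toℕ k ℕ.<ᵇ toℕ j) ∧ (lookup bs k ℕ.≤ᵇ b)))) ≡ ι (below bs j b)
  below-bits {m} bs zero = sum-0 (λ k → ι (bit ((toℕ k ℕ.<ᵇ toℕ (zero {n = m})) ∧ (lookup bs k ℕ.≤ᵇ b)))) (λ k → refl)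
  below-bits (x ∷ bs) (suc j) = trans (cong₂ _+_ (cong ι (bit-ind x b)) (below-bits bs j)) (sym (ι-+ (ind x b) (below bs j b)))

  leg-first : ι (leg η k₀ 1) ≡ ι (below bs k₀ b)
  leg-first = trans (ι-leg η k₀ 1) (trans (cong₂ _+_ (rowAbove-0 0) (trans (S-below 1) (trans (sum-cong-≗ (λ k → cong (λ x → ι (bit ((toℕ k ℕ.<ᵇ toℕ k₀) ∧ x))) (≤ᵇ-suc (lookup bs k) b))) (below-bits bs k₀))))
    (QP.+-identityˡ (ι (below bs k₀ b))))

  -- The other nonempty rows precede the row in `η` and follow it in `μ`. Lowering the column and
  -- the row length by one turns the condition of `legBelow` into that of `legAbove`.
  leg-row : ∀ j → ι (leg η k₀ (suc (suc j))) ≡ ι (leg μ zero (suc j))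
  leg-row j = trans (ι-leg η k₀ (suc (suc j))) (trans (cong₂ _+_ (rowAbove-0 (suc j)) (trans (S-below (suc (suc j))) (sum-cong-≗ same)))
      (trans (trans (l P) (cong (0ℚ + P +_) (sym (sum-0 (λ k → ι (bit (legBelow μ zero (suc j) k))) (λ k → refl))))) (sym (ι-leg μ zero (suc j)))))
    where
    P = sum (λ k → ι (bit (legAbove μ zero (suc j) (suc k))))
    l : ∀ a → 0ℚ + a ≡ 0ℚ + a + 0ℚ
    l = solve-∀ ring
    same : ∀ k → ι (bit ((toℕ k ℕ.<ᵇ toℕ k₀) ∧ ((suc (suc j) ℕ.≤ᵇ suc (lookup bs k)) ∧ (suc (lookup bs k) ℕ.≤ᵇ suc b)))) ≡ ι (bit (legAbove μ zero (suc j) (suc k)))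
    same k with toℕ k ℕ.<? toℕ k₀
    ... | yes lt rewrite <ᵇ-true lt | ≤ᵇ-suc (lookup bs k) b = refl
    ... | no ≮ rewrite bs-0 k (NP.≮⇒≥ ≮) = cong (ι ∘ bit) (BP.∧-zeroʳ (toℕ k ℕ.<ᵇ toℕ k₀))

  -- A nonempty row lies before `k₀`. The moved row is counted after it with length `suc b` in `η`,
  -- and before it with length `b` in `μ`; the `suc` in `legBelow` makes both conditions equal to
  -- `C`.
  leg-other : ∀ i j → j ℕ.< lookup bs i → ι (leg η (punchIn k₀ i) (suc j)) ≡ ι (leg μ (suc i) (suc j))
  leg-other i j j< = trans (ι-leg η (punchIn k₀ i) (suc j)) (trans (cong₂ _+_
      (trans (S-remove (legAbove η (punchIn k₀ i) (suc j))) (cong₂ _+_ above-self (sum-cong-≗ above-other)))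
      (trans (S-remove (legBelow η (punchIn k₀ i) (suc j))) (cong₂ _+_ below-self (sum-cong-≗ below-other))))
      (trans (l C P B) (sym (ι-leg μ (suc i) (suc j)))))
    where
    i<k₀ : toℕ i ℕ.< toℕ k₀
    i<k₀ with toℕ i ℕ.<? toℕ k₀
    ... | yes lt = lt
    ... | no ≮ with () ← subst (j ℕ.<_) (bs-0 i (NP.≮⇒≥ ≮)) j<
    P = sum (λ k → ι (bit (legAbove μ (suc i) (suc j) (suc k))))
    B = sum (λ k → ι (bit (legBelow μ (suc i) (suc j) (suc k))))
    C = ι (bit ((suc j ℕ.≤ᵇ suc b) ∧ (suc b ℕ.≤ᵇ lookup bs i)))
    l : ∀ c a b → c + a + (0ℚ + b) ≡ 0ℚ + a + (c + b)
    l = solve-∀ ring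
    above-self : ι (bit (legAbove η (punchIn k₀ i) (suc j) k₀)) ≡ C
    above-self rewrite η-self | η-other i | punchIn-<ᵇ-self k₀ i | <ᵇ-true i<k₀ = refl
    below-self : ι (bit (legBelow η (punchIn k₀ i) (suc j) k₀)) ≡ 0ℚ
    below-self rewrite self-<ᵇ-punchIn k₀ i i<k₀ = refl
    above-other : ∀ k → ι (bit (legAbove η (punchIn k₀ i) (suc j) (punchIn k₀ k))) ≡ ι (bit (legAbove μ (suc i) (suc j) (suc k)))
    above-other k rewrite η-other k | η-other i | punchIn-<ᵇ k₀ i k = refl
    below-other : ∀ k → ι (bit (legBelow η (punchIn k₀ i) (suc j) (punchIn k₀ k))) ≡ ι (bit (legBelow μ (suc i) (suc j) (suc k)))
    below-other k rewrite η-other k | η-other i | punchIn-<ᵇ k₀ k i = refl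

ε-<ᵇ : ∀ {n} (j k : Fin n) → k ≢ j → ε j k ≡ bit (toℕ k ℕ.<ᵇ toℕ j)
ε-<ᵇ zero zero ne = ⊥-elim (ne refl)
ε-<ᵇ (suc j) zero ne = refl
ε-<ᵇ zero (suc k) ne = refl
ε-<ᵇ (suc j) (suc k) ne = ε-<ᵇ j k (ne ∘ cong suc)

ι-injective : ∀ m n → ι m ≡ ι n → m ≡ n
ι-injective zero zero e = refl
ι-injective zero (suc n) e = ⊥-elim (pos⇒≢0 (QP.positive⁻¹ (ι (suc n)) {{ι-positive n}}) (sym e))
ι-injective (suc m) zero e = ⊥-elim (pos⇒≢0 (QP.positive⁻¹ (ι (suc m)) {{ι-positive m}}) e)
ι-injective (suc m) (suc n) e = cong suc (ι-injective m n (trans (l (ι m)) (trans (cong (_- 1ℚ) e) (sym (l (ι n))))))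
  where
  l : ∀ a → a ≡ 1ℚ + a - 1ℚ
  l = solve-∀ ring

ι-sum : ∀ {n} (f : Fin n → ℕ) → Σ ℕ λ r → sum (λ k → ι (f k)) ≡ ι r
ι-sum {zero} f = 0 , refl
ι-sum {suc n} f with ι-sum (f ∘ suc)
... | r , e = f zero ℕ.+ r , trans (cong (ι (f zero) +_) e) (sym (ι-+ (f zero) r))

sum-1 : ∀ m → sum {m} (λ _ → 1ℚ) ≡ ι m
sum-1 zero = refl
sum-1 (suc m) = cong (1ℚ +_) (sum-1 m)

-- Each index other than `j` is sorted either before or after it: `sortPos` counts the former and
-- `ρ` the latter.
sortPos-ρ : ∀ {m} (γ : Comp (suc m)) j → ι (sortPos γ j) + ρ γ j ≡ ι m
sortPos-ρ {m} γ j = trans (cong (_+ ρ γ j) (trans (ι-+ (count larger) (count earlier)) (cong₂ _+_ (ι-count larger) (ι-count earlier))))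
    (trans (cong₂ _+_ (sym (∑-distrib-+ (λ k → ι (bit (larger k))) (λ k → ι (bit (earlier k))))) refl)
    (trans (sym (∑-distrib-+ (λ k → ι (bit (larger k)) + ι (bit (earlier k))) before))
    (trans (sum-punchIn all j) (trans (cong₂ _+_ self (trans (sum-cong-≗ (λ k → other (punchIn j k) (FP.punchInᵢ≢i j k))) (sum-1 m))) (QP.+-identityˡ (ι m))))))
  where
  larger earlier : Fin (suc m) → Bool
  larger k = lookup γ j ℕ.<ᵇ lookup γ k
  earlier k = (toℕ k ℕ.<ᵇ toℕ j) ∧ (lookup γ k ℕ.≡ᵇ lookup γ j)
  before all : Fin (suc m) → ℚ
  before k = ι (ind (ε j k ℕ.+ lookup γ k) (lookup γ j))
  all k = ι (bit (larger k)) + ι (bit (earlier k)) + before k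
  self : all j ≡ 0ℚ
  self rewrite <ᵇ-false {lookup γ j} NP.≤-refl | <ᵇ-false {toℕ j} NP.≤-refl | ε-refl j | ind-no (NP.≤-refl {suc (lookup γ j)}) = refl
  ≡ᵇ-false : ∀ {a b} → a ≢ b → (a ℕ.≡ᵇ b) ≡ false
  ≡ᵇ-false {a} {b} ne with a ℕ.≡ᵇ b in eq
  ... | false = refl
  ... | true = ⊥-elim (ne (NP.≡ᵇ⇒≡ a b (subst Bool.T (sym eq) _)))
  ≡ᵇ-refl : ∀ a → (a ℕ.≡ᵇ a) ≡ true
  ≡ᵇ-refl zero = refl
  ≡ᵇ-refl (suc a) = ≡ᵇ-refl a
  other : ∀ k → k ≢ j → all k ≡ 1ℚ
  other k ne with NP.<-cmp (lookup γ k) (lookup γ j)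
  ... | tri< lt γ≢ _ rewrite <ᵇ-false (NP.<⇒≤ lt) | ≡ᵇ-false γ≢ | BP.∧-zeroʳ (toℕ k ℕ.<ᵇ toℕ j)
        | ind-≢ {ε j k} {lookup γ k} {lookup γ j} (ε-01 j k) γ≢ | ind-yes (NP.<⇒≤ lt) = refl
  ... | tri> _ γ≢ gt rewrite <ᵇ-true gt | ≡ᵇ-false γ≢ | BP.∧-zeroʳ (toℕ k ℕ.<ᵇ toℕ j)
        | ind-≢ {ε j k} {lookup γ k} {lookup γ j} (ε-01 j k) γ≢ | ind-no gt = refl
  ... | tri≈ _ e _ rewrite e | <ᵇ-false {lookup γ j} NP.≤-refl | ≡ᵇ-refl (lookup γ j) | BP.∧-identityʳ (toℕ k ℕ.<ᵇ toℕ j)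
        | ind-diag (lookup γ j) (ε-01 j k) | ε-<ᵇ j k ne = l (ι (bit (toℕ k ℕ.<ᵇ toℕ j)))
    where
    l : ∀ a → 0ℚ + a + (1ℚ - a) ≡ 1ℚ
    l = solve-∀ ring

δ-sortPos : ∀ {m} (γ : Comp (suc m)) j → ι (δ (suc m) (sortPos γ j)) ≡ ρ γ j
δ-sortPos {m} γ j with ι-sum (λ k → ind (ε j k ℕ.+ lookup γ k) (lookup γ j))
... | r , e = trans (cong ι (trans (cong (_∸ sortPos γ j) (sym total)) (NP.m+n∸m≡n (sortPos γ j) r))) (sym e)
  where
  total : sortPos γ j ℕ.+ r ≡ m
  total = ι-injective _ _ (trans (ι-+ (sortPos γ j) r) (trans (cong (ι (sortPos γ j) +_) (sym e)) (sortPos-ρ γ j)))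

preP : (ℕ → ℚ) → ℕ → ℚ
preP f zero = 1ℚ
preP f (suc b) = f 0 * preP (f ∘ suc) b

preP-cong : ∀ {f g} b → (∀ l → l ℕ.< b → f l ≡ g l) → preP f b ≡ preP g b
preP-cong zero h = refl
preP-cong (suc b) h = cong₂ _*_ (h 0 (s≤s z≤n)) (preP-cong b (λ l lt → h (suc l) (s≤s lt)))

prodL : ∀ {A : Set} → (A → ℚ) → List A → ℚ
prodL f [] = 1ℚ
prodL f (a ∷ as) = f a * prodL f as

prodL-++ : ∀ {A : Set} (f : A → ℚ) as bs → prodL f (as ++ bs) ≡ prodL f as * prodL f bs
prodL-++ f [] bs = sym (QP.*-identityˡ (prodL f bs))
prodL-++ f (a ∷ as) bs = trans (cong (f a *_) (prodL-++ f as bs)) (sym (QP.*-assoc (f a) (prodL f as) (prodL f bs)))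

prodL-applyUpTo : ∀ {A : Set} (f : A → ℚ) g n → prodL f (L.applyUpTo g n) ≡ preP (f ∘ g) n
prodL-applyUpTo f g zero = refl
prodL-applyUpTo f g (suc n) = cong (f (g 0) *_) (prodL-applyUpTo f (g ∘ suc) n)

module Weights (α : ℚ) (α>0 : 0ℚ ℚ.< α) where
  open Points α α>0
  open Eval α α>0

  weight : ∀ {n} → Comp n → Fin n × ℕ → ℚ
  weight η (i , j) = α * ι (suc (arm η i j)) + ι (suc (leg η i j))

  dQ : ∀ {n} → Comp n → ℚ
  dQ η = prodL (weight η) (boxes η)

  dRows : ∀ {n} → Comp n → ℚ
  dRows η = prod (λ i → preP (λ j → weight η (i , suc j)) (lookup η i))

  dQ≡dRows : ∀ {n} (η : Comp n) → dQ η ≡ dRows η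
  dQ≡dRows {n} η = go id
    where
    row : Fin n → List (Fin n × ℕ)
    row i = L.map (λ j → i , suc j) (L.upTo (lookup η i))
    go : ∀ {k} (f : Fin k → Fin n) → prodL (weight η) (L.concatMap row (L.tabulate f)) ≡ prod (λ k → preP (λ j → weight η (f k , suc j)) (lookup η (f k)))
    go {zero} f = refl
    go {suc k} f = trans (prodL-++ (weight η) (row (f zero)) (L.concatMap row (L.tabulate (f ∘ suc)))) (cong₂ _*_
      (trans (cong (prodL (weight η)) (LP.map-upTo (λ j → f zero , suc j) (lookup η (f zero)))) (prodL-applyUpTo (weight η) (λ j → f zero , suc j) (lookup η (f zero))))
      (go (f ∘ suc)))

  -- The first box of the inserted row gives the new factor; every other box has the arm and the leg
  -- of its counterpart in `b ∷ bs`.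
  dRows-insertAt : ∀ {m} b (bs : Comp m) k₀ → (∀ k → toℕ k₀ ℕ.≤ toℕ k → lookup bs k ≡ 0) →
    dRows (insertAt bs k₀ (suc b)) ≡ (α * ι (suc b) + ι (suc (below bs k₀ b))) * dRows (b ∷ bs)
  dRows-insertAt {m} b bs k₀ bs-0 = trans (prod-remove {i = k₀} row) (trans (cong₂ _*_ row-self (prod-cong row-other))
      (QP.*-assoc (α * ι (suc b) + ι (suc (below bs k₀ b))) (row′ zero) (prod (row′ ∘ suc))))
    where
    open Legs b bs k₀ bs-0
    row row′ : Fin (suc m) → ℚ
    row i = preP (λ j → weight η (i , suc j)) (lookup η i)
    row′ i = preP (λ j → weight μ (i , suc j)) (lookup μ i)
    row-self : row k₀ ≡ (α * ι (suc b) + ι (suc (below bs k₀ b))) * row′ zero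
    row-self = trans (cong (preP (λ j → weight η (k₀ , suc j))) η-self) (cong₂ _*_
      (cong₂ (λ x y → α * ι (suc (x ∸ 1)) + (1ℚ + y)) η-self leg-first)
      (preP-cong b (λ j _ → cong₂ (λ x y → α * ι (suc (x ∸ suc (suc j))) + (1ℚ + y)) η-self (leg-row j))))
    row-other : ∀ i → row (punchIn k₀ i) ≡ row′ (suc i)
    row-other i = trans (cong (preP (λ j → weight η (punchIn k₀ i , suc j))) (η-other i))
      (preP-cong (lookup bs i) (λ j lt → cong₂ (λ x y → α * ι (suc (x ∸ suc j)) + (1ℚ + y)) (η-other i) (leg-other i j lt)))

  dRows-lead : ∀ {m} d (v : Comp (suc m)) → V.sum v ≡ d → dRows v ≡ lead d v
  dRows-lead {m} zero v e = trans (prod-cong (λ i → cong (preP (λ j → weight v (i , suc j))) (trans (cong (λ u → lookup u i) (sum≡0 v e)) (lookup-0v i)))) (prod-replicate-1 (suc m))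
  dRows-lead (suc d) v e = trans (cong dRows (sym (A-star v e))) (trans (dRows-insertAt b bs k₀ (star-tail-0 v)) (cong ((α * ι (suc b) + ι (suc (below bs k₀ b))) *_) (dRows-lead d (star v) (sum-star v e))))
    where open Jack d v

-- Specialisation of r at large natural numbers

evP-⊕ : ∀ p q y → evP (p ⊕ q) y ≡ evP p y + evP q y
evP-⊕ [] q y = sym (QP.+-identityˡ (evP q y))
evP-⊕ (a ∷ p) [] y = sym (QP.+-identityʳ (evP (a ∷ p) y))
evP-⊕ (a ∷ p) (b ∷ q) y = trans (cong (λ x → a + b + y * x) (evP-⊕ p q y)) (l a b y (evP p y) (evP q y))
  where
  l : ∀ a b y p q → a + b + y * (p + q) ≡ a + y * p + (b + y * q)
  l = solve-∀ ring

evP-scale : ∀ c p y → evP (scale c p) y ≡ c * evP p y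
evP-scale c [] y = sym (QP.*-zeroʳ c)
evP-scale c (a ∷ p) y = trans (cong (λ x → c * a + y * x) (evP-scale c p y)) (l c a y (evP p y))
  where
  l : ∀ c a y p → c * a + y * (c * p) ≡ c * (a + y * p)
  l = solve-∀ ring

evP-⊛ : ∀ p q y → evP (p ⊛ q) y ≡ evP p y * evP q y
evP-⊛ [] q y = sym (QP.*-zeroˡ (evP q y))
evP-⊛ (a ∷ p) q y = trans (evP-⊕ (scale a q) (0ℚ ∷ (p ⊛ q)) y) (trans (cong₂ (λ x z → x + (0ℚ + y * z)) (evP-scale a q y) (evP-⊛ p q y)) (l a (evP q y) y (evP p y)))
  where
  l : ∀ a q y p → a * q + (0ℚ + y * (p * q)) ≡ (a + y * p) * q
  l = solve-∀ ring

evP-1 : ∀ y → evP (1ℚ ∷ []) y ≡ 1ℚ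
evP-1 y = trans (cong (1ℚ +_) (QP.*-zeroʳ y)) refl

*-nonzero : ∀ {x y} → x ≢ 0ℚ → y ≢ 0ℚ → x * y ≢ 0ℚ
*-nonzero x≢0 y≢0 e = y≢0 (cancel-nonzero x≢0 e)

cross : Pol → Pol → Pol → Pol → Pol
cross n d n' d' = (n ⊛ d') ⊕ negP (n' ⊛ d)

evP-cross : ∀ n d n' d' y → evP (cross n d n' d') y ≡ evP n y * evP d' y - evP n' y * evP d y
evP-cross n d n' d' y = trans (evP-⊕ (n ⊛ d') (negP (n' ⊛ d)) y) (cong₂ _+_ (evP-⊛ n d' y)
    (trans (evP-scale (- 1ℚ) (n' ⊛ d) y) (trans (cong (- 1ℚ *_) (evP-⊛ n' d y)) (l (evP n' y * evP d y)))))
  where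
  l : ∀ x → - 1ℚ * x ≡ - x
  l = solve-∀ ring

-- Evaluation is a relation because a fraction has a value only where its denominator is nonzero;
-- the product form avoids division.
record Value (y : ℚ) (x : QR) (v : ℚ) : Set where
  constructor value
  field
    den≢0 : evP (den x) y ≢ 0ℚ
    num≡ : evP (num x) y ≡ v * evP (den x) y
open Value

module Values (y : ℚ) where

  value-+ : ∀ {x x' v v'} → Value y x v → Value y x' v' → Value y (x +Q x') (v + v')
  value-+ {x} {x'} {v} {v'} (value d n) (value d' n') = value (λ e → *-nonzero d d' (trans (sym (evP-⊛ (den x) (den x') y)) e))
      (trans (evP-⊕ (num x ⊛ den x') (num x' ⊛ den x) y) (trans (cong₂ _+_ (trans (evP-⊛ (num x) (den x') y) (cong (_* evP (den x') y) n)) (trans (evP-⊛ (num x') (den x) y) (cong (_* evP (den x) y) n')))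
        (trans (l v v' (evP (den x) y) (evP (den x') y)) (cong ((v + v') *_) (sym (evP-⊛ (den x) (den x') y))))))
    where
    l : ∀ v w d e → v * d * e + w * e * d ≡ (v + w) * (d * e)
    l = solve-∀ ring

  value-* : ∀ {x x' v v'} → Value y x v → Value y x' v' → Value y (x *Q x') (v * v')
  value-* {x} {x'} {v} {v'} (value d n) (value d' n') = value (λ e → *-nonzero d d' (trans (sym (evP-⊛ (den x) (den x') y)) e))
      (trans (evP-⊛ (num x) (num x') y) (trans (cong₂ _*_ n n') (trans (l v v' (evP (den x) y) (evP (den x') y)) (cong (v * v' *_) (sym (evP-⊛ (den x) (den x') y))))))
    where
    l : ∀ v w d e → v * d * (w * e) ≡ v * w * (d * e)
    l = solve-∀ ring

  value-neg : ∀ {x v} → Value y x v → Value y (-Q x) (- v)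
  value-neg {x} {v} (value d n) = value d (trans (evP-scale (- 1ℚ) (num x) y) (trans (cong (- 1ℚ *_) n) (l v (evP (den x) y))))
    where
    l : ∀ v d → - 1ℚ * (v * d) ≡ - v * d
    l = solve-∀ ring

  one-den : evP (1ℚ ∷ []) y ≢ 0ℚ
  one-den e with () ← trans (sym (evP-1 y)) e

  value-const : ∀ q → Value y ((q ∷ []) // (1ℚ ∷ [])) q
  value-const q = value one-den (l q y)
    where
    l : ∀ q y → q + y * 0ℚ ≡ q * (1ℚ + y * 0ℚ)
    l = solve-∀ ring

  value-0 : Value y 0# 0ℚ
  value-0 = value one-den (sym (QP.*-zeroˡ (evP (1ℚ ∷ []) y)))

  value-nat : ∀ k → Value y (nat k) (ι k)
  value-nat k = subst (Value y (nat k)) (sym (ι-normalize k)) (value-const (ℚ.normalize k 1))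

  value-r : Value y r y
  value-r = value one-den (l y)
    where
    l : ∀ y → 0ℚ + y * (1ℚ + y * 0ℚ) ≡ y * (1ℚ + y * 0ℚ)
    l = solve-∀ ring

  value-α : ∀ {a} → a * y ≡ 1ℚ → Value y α a
  value-α {a} h = value (λ e → 1≢0 (trans (sym h) (trans (cong (a *_) (trans (sym (l y)) e)) (QP.*-zeroʳ a))))
      (trans (evP-1 y) (sym (trans (cong (a *_) (l y)) h)))
    where
    1≢0 : 1ℚ ≢ 0ℚ
    1≢0 ()
    l : ∀ y → 0ℚ + y * (1ℚ + y * 0ℚ) ≡ y
    l = solve-∀ ring

  value-≈ : ∀ {x x' v v'} → Value y x v → Value y x' v' → x ≈ x' → v ≡ v'
  value-≈ {x} {x'} {v} {v'} (value d n) (value d' n') eq = trans (l₁ v v') (trans (cong (_+ v') (cancel-nonzero (*-nonzero d d')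
      (trans (l₂ (evP (den x) y) (evP (den x') y) v v') (trans (sym (cong₂ (λ a b → a * evP (den x') y - b * evP (den x) y) n n'))
        (trans (sym (evP-cross (num x) (den x) (num x') (den x') y)) (evP-zero _ eq y)))))) (QP.+-identityˡ v'))
    where
    l₁ : ∀ a b → a ≡ a - b + b
    l₁ = solve-∀ ring
    l₂ : ∀ d e v w → d * e * (v - w) ≡ v * d * e - w * e * d
    l₂ = solve-∀ ring

  value-^ : ∀ {x v} → Value y x v → ∀ k → Value y (x ^Q k) (pw v k)
  value-^ h zero = value-const 1ℚ
  value-^ h (suc k) = value-* h (value-^ h k)

  value-negPow : ∀ k → Value y (negPow k) (sgn k)
  value-negPow zero = value-const 1ℚ
  value-negPow (suc k) = value-neg (value-negPow k)

  value-sum : ∀ {A : Set} (f : A → QR) (g : A → ℚ) {as} → All (λ a → Value y (f a) (g a)) as → Value y (sumQ (L.map f as)) (sumL g as)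
  value-sum f g [] = value-0
  value-sum f g (h ∷ hs) = value-+ h (value-sum f g hs)

  value-prod : ∀ {A : Set} (f : A → QR) (g : A → ℚ) → (∀ a → Value y (f a) (g a)) → ∀ as → Value y (prodQ (L.map f as)) (prodL g as)
  value-prod f g h [] = value-const 1ℚ
  value-prod f g h (a ∷ as) = value-* (h a) (value-prod f g h as)

  value-monomial : ∀ {n} (pt : Vec QR n) (z : Vec ℚ n) → (∀ k → Value y (lookup pt k) (lookup z k)) → ∀ β → Value y (monomial pt β) (mono z β)
  value-monomial [] [] h [] = value-const 1ℚ
  value-monomial (p ∷ pt) (x ∷ z) h (k ∷ β) = value-* (value-^ (h zero) k) (value-monomial pt z (h ∘ suc) β)

  value-evalPoly : ∀ {n} d (c : Vec ℕ n → QR) cv → All (λ β → Value y (c β) (cv β)) (comps n d) → ∀ pt z → (∀ k → Value y (lookup pt k) (lookup z k)) →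
    Value y (evalPoly n d c pt) (polyQ n d cv z)
  value-evalPoly d c cv hs pt z hz = value-sum (λ β → c β *Q monomial pt β) (λ β → cv β * mono z β) (All.map (λ {β} h → value-* h (value-monomial pt z hz β)) hs)

pw-pos : ∀ {a b} k → a * b ≡ 1ℚ → pw a k * pw b k ≡ 1ℚ
pw-pos zero h = refl
pw-pos {a} {b} (suc k) h = trans (l a b (pw a k) (pw b k)) (trans (cong₂ _*_ h (pw-pos k h)) refl)
  where
  l : ∀ a b c d → a * c * (b * d) ≡ a * b * (c * d)
  l = solve-∀ ring

pw-+ : ∀ y a b → pw y (a ℕ.+ b) ≡ pw y a * pw y b
pw-+ y zero b = sym (QP.*-identityˡ (pw y b))
pw-+ y (suc a) b = trans (cong (y *_) (pw-+ y a b)) (sym (QP.*-assoc y (pw y a) (pw y b)))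

mono-scaled : ∀ {n} x (y : Vec ℚ n) μ → mono (V.map (x *_) y) μ ≡ pw x (V.sum μ) * mono y μ
mono-scaled x [] [] = refl
mono-scaled x (y ∷ ys) (k ∷ μ) = trans (cong₂ _*_ (pw-* k) (mono-scaled x ys μ)) (trans (l (pw x k) (pw y k) (pw x (V.sum μ)) (mono ys μ))
    (cong (_* (pw y k * mono ys μ)) (sym (pw-+ x k (V.sum μ)))))
  where
  l : ∀ a b c d → a * b * (c * d) ≡ a * c * (b * d)
  l = solve-∀ ring
  pw-* : ∀ k → pw (x * y) k ≡ pw x k * pw y k
  pw-* zero = refl
  pw-* (suc k) = trans (cong (x * y *_) (pw-* k)) (l x y (pw x k) (pw y k))

-- Transfer of the identity from large natural `r` to ℚ(r)

maximum : ∀ {A : Set} → (A → ℕ) → List A → ℕ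
maximum f [] = 0
maximum f (a ∷ as) = f a ℕ.⊔ maximum f as

below-maximum : ∀ {A : Set} (f : A → ℕ) as {t} → maximum f as ℕ.≤ t → All (λ a → f a ℕ.≤ t) as
below-maximum f [] h = []
below-maximum f (a ∷ as) h = NP.≤-trans (NP.m≤m⊔n (f a) (maximum f as)) h ∷ below-maximum f as (NP.≤-trans (NP.m≤n⊔m (f a) (maximum f as)) h)

ι-≢0 : ∀ {t} → 1 ℕ.≤ t → ι t ≢ 0ℚ
ι-≢0 {suc s} _ = pos⇒≢0 (QP.positive⁻¹ (ι (suc s)) {{ι-positive s}})

module Transfer {m : ℕ} (η : Vec ℕ (suc m)) (c : Vec ℕ (suc m) → QR) (I : IsInterpolation (suc m) η c) where
  open IsInterpolation I
  d = V.sum η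

  threshold : Vec ℕ (suc m) → ℕ
  threshold γ = proj₁ (nonzero-polynomial (den (c γ)) (wf γ))

  -- Beyond it `r` is nonzero and so are all denominators that occur. The composition `γ` is listed
  -- separately because its degree may exceed `d`.
  bound : Vec ℕ (suc m) → ℕ
  bound γ = 1 ℕ.⊔ maximum threshold (η ∷ γ ∷ comps (suc m) d)

  -- Fixed before any specialisation: one and the same list has to serve all large `t`. Above degree
  -- `d` the coefficient is zero.
  b : Vec ℕ (suc m) → List ℕ
  b γ with V.sum γ ℕ.≤? d
  ... | yes _ = coef (interp η) γ
  ... | no _ = []

  module At (γ : Vec ℕ (suc m)) (t : ℕ) (large : bound γ ℕ.≤ t) where
    y = ι t
    open Values y

    y≢0 : y ≢ 0ℚ
    y≢0 = ι-≢0 (NP.≤-trans (NP.m≤m⊔n 1 (maximum threshold (η ∷ γ ∷ comps (suc m) d))) large)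

    a : ℚ
    a = proj₁ (inverse y y≢0)
    ay : a * y ≡ 1ℚ
    ay = proj₂ (inverse y y≢0)
    ya : y * a ≡ 1ℚ
    ya = trans (QP.*-comm y a) ay

    a>0 : 0ℚ ℚ.< a
    a>0 with QP.<-cmp a 0ℚ
    ... | tri> _ _ gt = gt
    ... | tri≈ _ e _ = ⊥-elim (1≢0 (trans (sym ay) (trans (cong (_* y) e) (QP.*-zeroˡ y))))
      where
      1≢0 : 1ℚ ≢ 0ℚ
      1≢0 ()
    ... | tri< lt _ _ = ⊥-elim (QP.<-irrefl refl (QP.<-≤-trans (QP.positive⁻¹ 1ℚ) (QP.≤-trans (QP.≤-reflexive (sym ay))
          (QP.≤-trans (QP.*-monoʳ-≤-nonNeg y {{ℚ.nonNegative (ι-nonneg t)}} (QP.<⇒≤ lt)) (QP.≤-reflexive (QP.*-zeroˡ y))))))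

    open Points a a>0
    open Eval a a>0
    open Weights a a>0
    open Main a a>0

    -- The default 0 makes this total; for the coefficients that occur, the threshold excludes that
    -- case.
    quotient : ∀ x → Dec (evP (den x) y ≡ 0ℚ) → ℚ
    quotient x (yes _) = 0ℚ
    quotient x (no d≢0) = evP (num x) y * proj₁ (inverse (evP (den x) y) d≢0)

    value-quotient : ∀ x dec → evP (den x) y ≢ 0ℚ → Value y x (quotient x dec)
    value-quotient x (yes e) d≢0 = ⊥-elim (d≢0 e)
    value-quotient x (no d≢0) _ = value d≢0 (sym (trans (QP.*-assoc (evP (num x) y) (proj₁ (inverse (evP (den x) y) d≢0)) (evP (den x) y))
      (trans (cong (evP (num x) y *_) (proj₂ (inverse (evP (den x) y) d≢0))) (QP.*-identityʳ (evP (num x) y)))))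

    cv : Vec ℕ (suc m) → ℚ
    cv β = quotient (c β) (evP (den (c β)) y ≟ 0ℚ)

    value-c : ∀ {β} → threshold β ℕ.≤ t → Value y (c β) (cv β)
    value-c {β} le = value-quotient (c β) (evP (den (c β)) y ≟ 0ℚ) (proj₂ (nonzero-polynomial (den (c β)) (wf β)) t le)

    thresholds : All (λ β → threshold β ℕ.≤ t) (η ∷ γ ∷ comps (suc m) d)
    thresholds = below-maximum threshold (η ∷ γ ∷ comps (suc m) d) (NP.≤-trans (NP.m≤n⊔m 1 (maximum threshold (η ∷ γ ∷ comps (suc m) d))) large)

    value-cη : Value y (c η) (cv η)
    value-cη = value-c (All.head thresholds)
    value-cγ : Value y (c γ) (cv γ)
    value-cγ = value-c (All.head (All.tail thresholds))
    values-c : All (λ β → Value y (c β) (cv β)) (comps (suc m) d)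
    values-c = All.map value-c (All.tail (All.tail thresholds))

    -- At `r = y` with `a` its inverse, `γ + yρ = y(aγ + ρ)`.
    value-bar : ∀ γ k → Value y (lookup (bar γ) k) (lookup (V.map (y *_) (ŷ γ)) k)
    value-bar γ k = subst₂ (Value y) (sym (VP.lookup∘tabulate (λ j → nat (lookup γ j) +Q r *Q nat (δ (suc m) (sortPos γ j))) k))
        (trans (cong (λ x → ι (lookup γ k) + y * x) (δ-sortPos γ k)) (trans (cong (_+ y * ρ γ k) (trans (sym (QP.*-identityˡ (ι (lookup γ k)))) (cong (_* ι (lookup γ k)) (sym ya))))
          (trans (l y a (ι (lookup γ k)) (ρ γ k)) (trans (cong (y *_) (sym (lookup-ŷ γ k))) (sym (VP.lookup-map k (y *_) (ŷ γ)))))))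
        (value-+ (value-nat (lookup γ k)) (value-* value-r (value-nat (δ (suc m) (sortPos γ k)))))
      where
      l : ∀ y a i p → y * a * i + y * p ≡ y * (a * i + p)
      l = solve-∀ ring

    -- the coefficients in the variables α x_i, scaled to be monic
    cs : Vec ℕ (suc m) → ℚ
    cs β = pw a d * (pw y (V.sum β) * cv β)

    cs-monic : cs η ≡ 1ℚ
    cs-monic = trans (cong (λ x → pw a d * (pw y d * x)) (value-≈ value-cη (value-const 1ℚ) monic))
      (trans (cong (pw a d *_) (QP.*-identityʳ (pw y d))) (pw-pos d ay))

    cs-vanishes : ∀ γ → γ ≢ η → V.sum γ ℕ.≤ d → polyQ (suc m) d cs (ŷ γ) ≡ 0ℚ
    cs-vanishes γ ne le = trans (sumL-cong (comps (suc m) d) (λ β → trans (l (pw a d) (pw y (V.sum β)) (cv β) (mono (ŷ γ) β)) (cong (λ x → pw a d * (cv β * x)) (sym (mono-scaled y (ŷ γ) β)))))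
        (trans (sumL-scaled (λ β → cv β * mono (V.map (y *_) (ŷ γ)) β) (pw a d) (comps (suc m) d))
        (trans (cong (pw a d *_) (value-≈ (value-evalPoly d c cv values-c (bar γ) (V.map (y *_) (ŷ γ)) (value-bar γ)) value-0 (vanishes γ ne le))) (QP.*-zeroʳ (pw a d))))
      where
      l : ∀ p q c m → p * (q * c) * m ≡ p * (c * (q * m))
      l = solve-∀ ring

    value-dη : Value y (dη η) (lead d η)
    value-dη = subst (Value y (dη η)) (trans (dQ≡dRows η) (dRows-lead d η refl))
      (value-prod (λ s → α *Q nat (suc (arm η (proj₁ s) (proj₂ s))) +Q nat (suc (leg η (proj₁ s) (proj₂ s)))) (weight η)
        (λ (i , j) → value-+ (value-* (value-α {a} ay) (value-nat (suc (arm η i j)))) (value-nat (suc (leg η i j)))) (boxes η))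

    value-evalℕα : ∀ bs → Value y (evalℕα bs) (evN bs)
    value-evalℕα [] = value-0
    value-evalℕα (b ∷ bs) = value-+ (value-nat b) (value-* (value-α {a} ay) (value-evalℕα bs))

    lhs : ℚ
    lhs = sgn (d ℕ.+ V.sum γ) * (lead d η * cv γ) * pw a d

    value-lhs : Value y (coefF η c γ *Q (α ^Q d)) lhs
    value-lhs = value-* (value-* (value-negPow (d ℕ.+ V.sum γ)) (value-* value-dη value-cγ)) (value-^ (value-α {a} ay) d)

    value-rhs : Value y ((α ^Q V.sum γ) *Q evalℕα (b γ)) (pw a (V.sum γ) * evN (b γ))
    value-rhs = value-* (value-^ (value-α {a} ay) (V.sum γ)) (value-evalℕα (b γ))

    lhs≡rhs : lhs ≡ pw a (V.sum γ) * evN (b γ)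
    lhs≡rhs with V.sum γ ℕ.≤? d
    -- The factor 1 is inserted as the product of the powers of `a` and `y` with exponent `V.sum γ`:
    -- the first is needed on the right, the second completes `cs γ`.
    ... | yes le = trans (trans (sym (QP.*-identityˡ lhs)) (trans (cong (_* lhs) (sym (pw-pos (V.sum γ) ay)))
          (l (sgn (d ℕ.+ V.sum γ)) (lead d η) (cv γ) (pw a d) (pw a (V.sum γ)) (pw y (V.sum γ)))))
          (cong (pw a (V.sum γ) *_) (coefficients η cs cs-monic cs-vanishes γ le))
      where
      l : ∀ s k c p q w → q * w * (s * (k * c) * p) ≡ q * (s * (k * (p * (w * c))))
      l = solve-∀ ring
    ... | no ≰ = trans (cong (λ x → sgn (d ℕ.+ V.sum γ) * (lead d η * x) * pw a d) (value-≈ value-cγ value-0 (degree γ (NP.≰⇒> ≰))))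
          (l (sgn (d ℕ.+ V.sum γ)) (lead d η) (pw a d) (pw a (V.sum γ)))
      where
      l : ∀ s k p q → s * (k * 0ℚ) * p ≡ q * 0ℚ
      l = solve-∀ ring

    difference-zero : evP (cross (num (coefF η c γ *Q (α ^Q d))) (den (coefF η c γ *Q (α ^Q d))) (num ((α ^Q V.sum γ) *Q evalℕα (b γ))) (den ((α ^Q V.sum γ) *Q evalℕα (b γ)))) y ≡ 0ℚ
    difference-zero = trans (evP-cross (num L) (den L) (num R) (den R) y) (trans (cong₂ (λ p q → p * evP (den R) y - q * evP (den L) y) (num≡ value-lhs) (num≡ value-rhs))
        (trans (cong (λ x → x * evP (den L) y * evP (den R) y - w * evP (den R) y * evP (den L) y) lhs≡rhs) (l w (evP (den L) y) (evP (den R) y))))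
      where
      L = coefF η c γ *Q (α ^Q d)
      R = (α ^Q V.sum γ) *Q evalℕα (b γ)
      w = pw a (V.sum γ) * evN (b γ)
      l : ∀ w d e → w * d * e - w * e * d ≡ 0ℚ
      l = solve-∀ ring

  coefficient : ∀ γ → coefF η c γ *Q (α ^Q V.sum η) ≈ (α ^Q V.sum γ) *Q evalℕα (b γ)
  coefficient γ = zero-polynomial _ (bound γ) (λ t large → At.difference-zero γ t large)

theoremB : (n : ℕ) → 1 ≤ n → (η : Vec ℕ n) → (c : Vec ℕ n → QR) → IsInterpolation n η c →
    (γ : Vec ℕ n) → Σ (List ℕ) (λ b → coefF η c γ *Q (α ^Q ∣ η ∣) ≈ (α ^Q ∣ γ ∣) *Q evalℕα b)
theoremB (suc m) _ η c I γ = Transfer.b η c I γ , Transfer.coefficient η c I γ
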